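{- Let $\mathcal{C}$, $\Sigma$ and the extended structure $\mathcal{P}_e$ be as described in the context (with $C$ finite). There exists an algorithm that, given a well-defined formula $\phi$ in the language of $\mathcal{P}_e$, produces a quantifier-free formula $\phi'$ that is equivalent to $\phi$ on $\mathcal{P}_e$ (i.e. $\phi$ and $\phi'$ have the same truth value under every valuation of the free variables).
   Context: Let $\mathcal{C}$ be a relational structure with finite carrier $C$ in a relational language $L_C$ with a distinguished binary symbol $\le$; let $\mathcal{C}^{ -1}$ be the same structure except that $\le$ is interpreted as the inverse of $\le^{\mathcal{C}}$. Let $\Sigma$ be a finite set of constructors, each of arity $\ge1$, with variances $v(f,i)\in\{ -1,1\}$. Terms: finite ground terms over $\Sigma\cup C$ (elements of $C$ as constants). Shapes: ground terms over $\{c^S\}\cup\{f^S: f\in\Sigma\}$, where $c^S$ is a constant and $\mathrm{ar}(f^S)=\mathrm{ar}(f)$. The two-sorted structure $\mathcal{P}_e$ (sorts: terms, shapes; equality on each sort) has: the constants $c\in C$ and constructors $f\in\Sigma$ on terms (free interpretation); selectors $f_i$ with $f_i(f(t_1,\dots,t_k))=t_i$, a partial function defined exactly when $\mathrm{Is}_f(t)$ holds; tests $\mathrm{Is}_f(t)\iff \exists t_1..t_k.\, t=f(t_1,\dots,t_k)$; the analogous constructors $c^S,f^S$, partial selectors $f^S_i$ and tests $\mathrm{Is}_{f^S}$ on shapes; the map $\mathrm{shape}$ from terms to shapes with $\mathrm{shape}(c)=c^S$ for $c\in C$ and $\mathrm{shape}(f(t_1,..,t_n))=f^S(\mathrm{shape}(t_1),\dots,\mathrm{shape}(t_n))$;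 and, for every first-order $L_C$-formula $\phi(x_1,\dots,x_m)$ and every integer $k\ge0$, cardinality relations $|\phi(t_1,\dots,t_m)|_{t^S}=k$ and $|\phi(t_1,\dots,t_m)|_{t^S}\ge k$ (with $t^S$ a shape-sorted term). A leaf of a shape $s$ is a position of $c^S$ in $s$, written as the sequence $\langle f^1,i^1\rangle\cdots\langle f^n,i^n\rangle$ of constructor/argument-index pairs along the path to it; its variance is $\prod_j v(f^j,i^j)$; for a term $t$ of shape $s$, $t[l]\in C$ is the element at leaf $l$. Then $|\phi(t_1,\dots,t_m)|_{s}$ is the number of leaves $l$ of $s$ such that $\phi(t_1[l],\dots,t_m[l])$ holds in $\mathcal{C}$ if $l$ has variance $1$ and in $\mathcal{C}^{ -1}$ if $l$ has variance $-1$; the cardinality relations are defined only when $\mathrm{shape}(t_1)=\dots=\mathrm{shape}(t_m)=s$. Partial functions are handled in strong Kleene three-valued logic with values false $<$ undefined $<$ true: undefined arguments propagate through functions and relations (yielding "undefined"), $\wedge,\vee$ are min/max, $\neg$ swaps true and false, quantifiers range over defined elements of the appropriate sort and take the min/max. A formula is well-defined if its value is true or false under every valuation. A formula is quantifier-free if it has no quantifiers outside the $L_C$-formulas $\phi$ occurring inside cardinality relations. -}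

module Defs where

open import Data.Nat using (ℕ; zero; suc; _≤_)
import Data.Nat as ℕ
open import Data.Fin using (Fin; zero; suc)
import Data.Fin as Fin
open import Data.Bool using (Bool; true; false; if_then_else_; _∧_; _∨_; not)
open import Data.Maybe using (Maybe; just; nothing)
open import Data.List using (List; []; _∷_; _++_; map; allFin)
open import Data.Bool.ListAction using (all; any)
open import Data.Nat.ListAction using (sum)
open import Data.Vec using (Vec; []; _∷_; lookup)
open import Data.Product using (Σ; _×_; _,_; ∃)
open import Data.Sum using (_⊎_)
open import Data.Unit using (⊤)
open import Data.Empty using (⊥)
import Data.Sign as Sg
open import Relation.Nullary using (¬_; yes; no; does)
open import Relation.Binary.PropositionalEquality using (_≡_; _≢_; refl)
open import Data.List.Relation.Unary.All using () renaming (All to AllL)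
import Data.Vec.Relation.Unary.All as VAll
open import Function.Bundles using (_⇔_)

-- The data of the setting:
--  * a finite relational structure 𝒞 with carrier C = Fin n, in a relational
--    language L_C consisting of the distinguished binary symbol ≤ together
--    with further symbols r : R of arity rar r (interpretations are given as
--    Boolean-valued functions, C being finite);
--  * a finite set Σ = Fin m of constructors, with arities ar f ≥ 1 and
--    variances var f i ∈ {-1,+1}.

record Setting : Set₁ where
  field
    n     : ℕ
    R     : Set
    rar   : R → ℕ
    relI  : (r : R) → Vec (Fin n) (rar r) → Bool
    leI   : Fin n → Fin n → Bool
    m     : ℕ
    ar    : Fin m → ℕ
    ar≥1  : (f : Fin m) → 1 ≤ ar f
    var   : (f : Fin m) → Fin (ar f) → Sg.Sign

module _ (S : Setting) where
  open Setting S

  data LForm : ℕ → Set where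
    lle  : ∀ {k} → Fin k → Fin k → LForm k
    lrel : ∀ {k} (r : R) → Vec (Fin k) (rar r) → LForm k
    leq  : ∀ {k} → Fin k → Fin k → LForm k
    lnot : ∀ {k} → LForm k → LForm k
    land : ∀ {k} → LForm k → LForm k → LForm k
    lor  : ∀ {k} → LForm k → LForm k → LForm k
    lall : ∀ {k} → LForm (suc k) → LForm k
    lex  : ∀ {k} → LForm (suc k) → LForm k

  -- truth in 𝒞 (sign +) or in 𝒞⁻¹ (sign -, ≤ interpreted as its inverse)
  evalL : Sg.Sign → ∀ {k} → LForm k → Vec (Fin n) k → Bool
  evalL Sg.+ (lle i j) e = leI (lookup e i) (lookup e j)
  evalL Sg.- (lle i j) e = leI (lookup e j) (lookup e i)
  evalL s (lrel r xs) e = relI r (Data.Vec.map (lookup e) xs)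
  evalL s (leq i j) e = does (lookup e i Fin.≟ lookup e j)
  evalL s (lnot φ) e = not (evalL s φ e)
  evalL s (land φ ψ) e = evalL s φ e ∧ evalL s ψ e
  evalL s (lor φ ψ) e = evalL s φ e ∨ evalL s ψ e
  evalL s (lall φ) e = all (λ c → evalL s φ (c ∷ e)) (allFin n)
  evalL s (lex φ) e = any (λ c → evalL s φ (c ∷ e)) (allFin n)

  data Term : Set where
    con : Fin n → Term
    app : (f : Fin m) → Vec Term (ar f) → Term

  data Shape : Set where
    cS : Shape
    fS : (f : Fin m) → Vec Shape (ar f) → Shape

  mutual
    shape : Term → Shape
    shape (con c) = cS
    shape (app f ts) = fS f (shapeV ts)

    shapeV : ∀ {k} → Vec Term k → Vec Shape k
    shapeV [] = []
    shapeV (t ∷ ts) = shape t ∷ shapeV ts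

  IsApp : Fin m → Term → Set
  IsApp f t = Σ (Vec Term (ar f)) λ ts → t ≡ app f ts

  IsAppS : Fin m → Shape → Set
  IsAppS f s = Σ (Vec Shape (ar f)) λ ss → s ≡ fS f ss

  sel : (f : Fin m) → Fin (ar f) → Term → Maybe Term
  sel f i (con c) = nothing
  sel f i (app g ts) with g Fin.≟ f
  ... | yes refl = just (lookup ts i)
  ... | no _ = nothing

  selS : (f : Fin m) → Fin (ar f) → Shape → Maybe Shape
  selS f i cS = nothing
  selS f i (fS g ss) with g Fin.≟ f
  ... | yes refl = just (lookup ss i)
  ... | no _ = nothing

  Path : Set
  Path = List (Σ (Fin m) λ f → Fin (ar f))

  mutual
    leaves : Shape → List Path
    leaves cS = [] ∷ []
    leaves (fS f ss) = map (λ { (j , p) → (f , j) ∷ p }) (leavesV ss)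

    leavesV : ∀ {k} → Vec Shape k → List (Fin k × Path)
    leavesV [] = []
    leavesV (s ∷ ss) = map (λ p → (zero , p)) (leaves s)
                       ++ map (λ { (j , p) → (suc j , p) }) (leavesV ss)

  variance : Path → Sg.Sign
  variance [] = Sg.+
  variance ((f , j) ∷ p) = var f j Sg.* variance p

  mutual
    at : Term → Path → Maybe (Fin n)
    at (con c) [] = just c
    at (con c) (_ ∷ _) = nothing
    at (app f ts) [] = nothing
    at (app f ts) ((g , j) ∷ p) with f Fin.≟ g
    ... | yes refl = atV ts j p
    ... | no _ = nothing

    atV : ∀ {k} → Vec Term k → Fin k → Path → Maybe (Fin n)
    atV (t ∷ ts) zero p = at t p
    atV (t ∷ ts) (suc j) p = atV ts j p

  atAll : ∀ {k} → Vec Term k → Path → Maybe (Vec (Fin n) k)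
  atAll [] l = just []
  atAll (t ∷ ts) l with at t l | atAll ts l
  ... | just c | just cs = just (c ∷ cs)
  ... | _ | _ = nothing

  count : ∀ {k} → LForm k → Vec Term k → Shape → ℕ
  count ψ ts s = sum (map hit (leaves s))
    where
    hit : Path → ℕ
    hit l with atAll ts l
    ... | nothing = 0
    ... | just cs = if evalL (variance l) ψ cs then 1 else 0

  data TExp : Set where
    tv   : ℕ → TExp
    tc   : Fin n → TExp
    tf   : (f : Fin m) → Vec TExp (ar f) → TExp
    tsel : (f : Fin m) → Fin (ar f) → TExp → TExp

  data SExp : Set where
    sv     : ℕ → SExp
    sc     : SExp
    sf     : (f : Fin m) → Vec SExp (ar f) → SExp
    ssel   : (f : Fin m) → Fin (ar f) → SExp → SExp
    sshape : TExp → SExp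

  data Formula : Set where
    eqT    : TExp → TExp → Formula
    eqS    : SExp → SExp → Formula
    isT    : Fin m → TExp → Formula
    isS    : Fin m → SExp → Formula
    cardEq : ∀ {k} → LForm k → Vec TExp k → SExp → ℕ → Formula
    cardGe : ∀ {k} → LForm k → Vec TExp k → SExp → ℕ → Formula
    fnot   : Formula → Formula
    fand   : Formula → Formula → Formula
    for    : Formula → Formula → Formula
    allT   : ℕ → Formula → Formula
    exT    : ℕ → Formula → Formula
    allS   : ℕ → Formula → Formula
    exS    : ℕ → Formula → Formula

  -- quantifier-free: no quantifiers (outside the L_C-formulas in cardinality atoms)
  QF : Formula → Set
  QF (fnot φ) = QF φ
  QF (fand φ ψ) = QF φ × QF ψ
  QF (for φ ψ) = QF φ × QF ψ
  QF (allT _ _) = ⊥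
  QF (exT _ _) = ⊥
  QF (allS _ _) = ⊥
  QF (exS _ _) = ⊥
  QF _ = ⊤

  -- Semantics (strong Kleene): partial evaluation of expressions

  record Env : Set where
    constructor env
    field
      tenv : ℕ → Term
      senv : ℕ → Shape
  open Env

  upd : {A : Set} → (ℕ → A) → ℕ → A → ℕ → A
  upd ρ x a y with y ℕ.≟ x
  ... | yes _ = a
  ... | no _ = ρ y

  setT : Env → ℕ → Term → Env
  setT ρ x t = env (upd (tenv ρ) x t) (senv ρ)

  setS : Env → ℕ → Shape → Env
  setS ρ x s = env (tenv ρ) (upd (senv ρ) x s)

  mutual
    evT : Env → TExp → Maybe Term
    evT ρ (tv x) = just (tenv ρ x)
    evT ρ (tc c) = just (con c)
    evT ρ (tf f es) with evTs ρ es
    ... | just ts = just (app f ts)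
    ... | nothing = nothing
    evT ρ (tsel f i e) with evT ρ e
    ... | just t = sel f i t
    ... | nothing = nothing

    evTs : Env → ∀ {k} → Vec TExp k → Maybe (Vec Term k)
    evTs ρ [] = just []
    evTs ρ (e ∷ es) with evT ρ e | evTs ρ es
    ... | just t | just ts = just (t ∷ ts)
    ... | _ | _ = nothing

  mutual
    evS : Env → SExp → Maybe Shape
    evS ρ (sv x) = just (senv ρ x)
    evS ρ sc = just cS
    evS ρ (sf f es) with evSs ρ es
    ... | just ss = just (fS f ss)
    ... | nothing = nothing
    evS ρ (ssel f i e) with evS ρ e
    ... | just s = selS f i s
    ... | nothing = nothing
    evS ρ (sshape e) with evT ρ e
    ... | just t = just (shape t)
    ... | nothing = nothing

    evSs : Env → ∀ {k} → Vec SExp k → Maybe (Vec Shape k)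
    evSs ρ [] = just []
    evSs ρ (e ∷ es) with evS ρ e | evSs ρ es
    ... | just s | just ss = just (s ∷ ss)
    ... | _ | _ = nothing

  CardArgs : Env → ∀ {k} → Vec TExp k → SExp → (Vec Term k → Shape → Set) → Set
  CardArgs ρ {k} es se P =
    Σ (Vec Term k) λ ts → Σ Shape λ s →
      evTs ρ es ≡ just ts × evS ρ se ≡ just s ×
      VAll.All (λ t → shape t ≡ s) ts × P ts s

  -- Three-valued truth value represented by the pair (IsTrue, IsFalse);
  -- "undefined" means neither holds.
  mutual
    IsTrue : Formula → Env → Set
    IsTrue (eqT a b) ρ = Σ Term λ u → Σ Term λ v → evT ρ a ≡ just u × evT ρ b ≡ just v × u ≡ v
    IsTrue (eqS a b) ρ = Σ Shape λ u → Σ Shape λ v → evS ρ a ≡ just u × evS ρ b ≡ just v × u ≡ v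
    IsTrue (isT f a) ρ = Σ Term λ u → evT ρ a ≡ just u × IsApp f u
    IsTrue (isS f a) ρ = Σ Shape λ u → evS ρ a ≡ just u × IsAppS f u
    IsTrue (cardEq ψ es se j) ρ = CardArgs ρ es se λ ts s → count ψ ts s ≡ j
    IsTrue (cardGe ψ es se j) ρ = CardArgs ρ es se λ ts s → j ≤ count ψ ts s
    IsTrue (fnot φ) ρ = IsFalse φ ρ
    IsTrue (fand φ ψ) ρ = IsTrue φ ρ × IsTrue ψ ρ
    IsTrue (for φ ψ) ρ = IsTrue φ ρ ⊎ IsTrue ψ ρ
    IsTrue (allT x φ) ρ = (t : Term) → IsTrue φ (setT ρ x t)
    IsTrue (exT x φ) ρ = Σ Term λ t → IsTrue φ (setT ρ x t)
    IsTrue (allS x φ) ρ = (s : Shape) → IsTrue φ (setS ρ x s)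
    IsTrue (exS x φ) ρ = Σ Shape λ s → IsTrue φ (setS ρ x s)

    IsFalse : Formula → Env → Set
    IsFalse (eqT a b) ρ = Σ Term λ u → Σ Term λ v → evT ρ a ≡ just u × evT ρ b ≡ just v × u ≢ v
    IsFalse (eqS a b) ρ = Σ Shape λ u → Σ Shape λ v → evS ρ a ≡ just u × evS ρ b ≡ just v × u ≢ v
    IsFalse (isT f a) ρ = Σ Term λ u → evT ρ a ≡ just u × ¬ IsApp f u
    IsFalse (isS f a) ρ = Σ Shape λ u → evS ρ a ≡ just u × ¬ IsAppS f u
    IsFalse (cardEq ψ es se j) ρ = CardArgs ρ es se λ ts s → count ψ ts s ≢ j
    IsFalse (cardGe ψ es se j) ρ = CardArgs ρ es se λ ts s → ¬ (j ≤ count ψ ts s)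
    IsFalse (fnot φ) ρ = IsTrue φ ρ
    IsFalse (fand φ ψ) ρ = IsFalse φ ρ ⊎ IsFalse ψ ρ
    IsFalse (for φ ψ) ρ = IsFalse φ ρ × IsFalse ψ ρ
    IsFalse (allT x φ) ρ = Σ Term λ t → IsFalse φ (setT ρ x t)
    IsFalse (exT x φ) ρ = (t : Term) → IsFalse φ (setT ρ x t)
    IsFalse (allS x φ) ρ = Σ Shape λ s → IsFalse φ (setS ρ x s)
    IsFalse (exS x φ) ρ = (s : Shape) → IsFalse φ (setS ρ x s)

  WellDefined : Formula → Set
  WellDefined φ = (ρ : Env) → ¬ (¬ IsTrue φ ρ × ¬ IsFalse φ ρ)

  Equivalent : Formula → Formula → Set
  Equivalent φ ψ = (ρ : Env) → (IsTrue φ ρ ⇔ IsTrue ψ ρ) × (IsFalse φ ρ ⇔ IsFalse ψ ρ)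

{-# OPTIONS --safe #-}
module Submission where

-- Truth and falsity of a formula are translated separately into two-valued
-- formulas, so it suffices to eliminate one existential quantifier.  A shape
-- together with the labels of its leaves determines a term.
--
-- The quantified variable is split along all patterns of the depth of the
-- selectors applied to it, after which the bound terms x₁ … x_r occur under no
-- selector.  Next the labels are eliminated, starting with a term x of maximal
-- height: an expression properly containing x then cannot have the shape of
-- another bound variable, so every cardinality constraint on x compares x with
-- terms of its own shape.  Leaf by leaf, the possible labels of x realise certain
-- truth patterns of the constraints; which patterns are realisable is expressible
-- by a 𝒞-formula in the other terms, and the existence of x depends only on how
-- many leaves, up to a threshold, admit which set of patterns.
--
-- What remains are bound shapes, subject to equations and to lower bounds on leaf
-- counts.  An equation in one unknown shape is an identity or has at most one
-- solution, and for an unknown of maximal height that solution is given by a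
-- subexpression.  An unknown solving none of the equations can be replaced by one
-- of finitely many ground shapes with the same truncated leaf counts.

open import Defs
open import Data.Bool as Bool using (Bool; true; false; if_then_else_; _∧_; _∨_; not)
open import Data.Bool.ListAction using (all; any)
open import Data.Empty using (⊥; ⊥-elim)
open import Data.Fin as Fin using (Fin; zero; suc; toℕ; fromℕ<; punchIn; punchOut; _↑ˡ_; _↑ʳ_)
open import Data.Fin.Properties using (toℕ-fromℕ<; fromℕ<-cong; punchIn-punchOut)
open import Data.List as List using (List; []; _∷_; _++_; length; foldr; zipWith; allFin; upTo; filter; deduplicate; concatMap)
import Data.List.Membership.DecPropositional as DecMembership
open import Data.List.Membership.Propositional using (_∈_; lose; find)
open import Data.List.Membership.Propositional.Properties using (∈-++⁺ˡ; ∈-++⁺ʳ; ∈-++⁻; ∈-map⁺; ∈-map⁻; ∈-allFin; ∈-upTo⁺; ∈-filter⁺; ∈-filter⁻; ∈-deduplicate⁺; ∈-deduplicate⁻; ∈-concatMap⁺; ∈-concatMap⁻; ∈-cartesianProductWith⁺; ∈-cartesianProductWith⁻; ∈-∃++)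
import Data.List.Properties as List
open import Data.List.Relation.Unary.All as LAll using ([]; _∷_) renaming (All to AllL)
import Data.List.Relation.Unary.All.Properties as LAll
open import Data.List.Relation.Unary.AllPairs using ([]; _∷_)
open import Data.List.Relation.Unary.Any as Any using (here; there)
open import Data.List.Relation.Unary.Unique.Propositional using (Unique)
import Data.List.Relation.Unary.Unique.DecPropositional.Properties as Unique
open import Data.Maybe using (Maybe; just; nothing)
open import Data.Maybe.Properties using (just-injective)
open import Data.Nat using (ℕ; zero; suc; _+_; _*_; _∸_; _⊔_; _⊓_; _≤_; _<_; _≤ᵇ_; _≤?_; _<?_; z≤n; s≤s)
open import Data.Nat.ListAction using (sum)
open import Data.Nat.Properties as ℕ using (≤-refl; ≤-trans; suc-injective)
open import Data.Product using (Σ; _×_; _,_; proj₁; proj₂)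
import Data.Sign as Sg
open import Data.Sum using (_⊎_; inj₁; inj₂; [_,_]′)
import Data.Sum.Properties as Sum⊎
open import Data.Unit using (⊤; tt)
open import Data.Vec as Vec using (Vec; []; _∷_; lookup; insertAt; removeAt; tabulate; _[_]≔_)
import Data.Vec.Properties as Vec
open import Data.Vec.Relation.Unary.All as VAll using (All; []; _∷_)
open import Function using (_∘_; _⇔_; mk⇔)
open import Relation.Binary.Definitions using (DecidableEquality)
open import Relation.Binary.PropositionalEquality
open import Relation.Nullary
open import Relation.Nullary.Decidable using (decidable-stable)

-- No atom compares heights, yet the order of elimination depends on them. Each elimination step is
-- therefore a disjunction over all bound variables. Every disjunct is sound by itself: for terms
-- because it carries disequations of shapes as explicit guards, for shapes because it only tries
-- out given expressions. Maximality serves to show that some disjunct holds.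
--
-- Thresholds come from counting. Once a contribution has been used `K` times, `K` being the largest
-- bound, a further use changes no lower bound; so with `d` available contributions and more than
-- `d * K` leaves of one type, some contribution can be repeated or dropped. For shapes, an equation
-- without a suitable solved form separates the unknown from at most one member of its class, so a
-- class with more members than the formula has atoms contains a substitute.
--
-- Partiality is confined to the two ends: in between, selectors are total and definedness
-- conditions are ordinary conjuncts; on the way back every possibly undefined branch stands next to
-- a false guard.

-- Booleans and Boolean combinations of atoms

Tr : Bool → Set
Tr b = b ≡ true

Tr⇒≡ : ∀ {a b} → (Tr a → Tr b) → (Tr b → Tr a) → a ≡ b
Tr⇒≡ {true} f g = sym (f refl)
Tr⇒≡ {false} {false} f g = refl
Tr⇒≡ {false} {true} f g = g refl

¬Tr⇒false : ∀ {b} → ¬ Tr b → b ≡ false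
¬Tr⇒false {true} n = ⊥-elim (n refl)
¬Tr⇒false {false} n = refl

false⇒¬Tr : ∀ {b} → b ≡ false → ¬ Tr b
false⇒¬Tr refl ()

does⁺ : ∀ {P : Set} (d : Dec P) → P → Tr (does d)
does⁺ (yes _) p = refl
does⁺ (no ¬p) p = ⊥-elim (¬p p)

does⁻ : ∀ {P : Set} (d : Dec P) → Tr (does d) → P
does⁻ (yes p) _ = p

≤ᵇ⁺ : ∀ {a b} → a ≤ b → Tr (a ≤ᵇ b)
≤ᵇ⁺ {a} {b} = does⁺ (a ≤? b)

≤ᵇ⁻ : ∀ {a b} → Tr (a ≤ᵇ b) → a ≤ b
≤ᵇ⁻ {a} {b} = does⁻ (a ≤? b)

∨-true : ∀ a {b} → Tr (a ∨ b) → Tr a ⊎ Tr b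
∨-true true p = inj₁ refl
∨-true false p = inj₂ p

data BF (A : Set) : Set where
  atm : A → BF A
  cst : Bool → BF A
  neg : BF A → BF A
  and : BF A → BF A → BF A
  or  : BF A → BF A → BF A

module _ {A : Set} where
  ev : (A → Bool) → BF A → Bool
  ev e (atm a) = e a
  ev e (cst b) = b
  ev e (neg φ) = not (ev e φ)
  ev e (and φ ψ) = ev e φ ∧ ev e ψ
  ev e (or φ ψ) = ev e φ ∨ ev e ψ

  atoms : BF A → List A
  atoms (atm a) = a ∷ []
  atoms (cst b) = []
  atoms (neg φ) = atoms φ
  atoms (and φ ψ) = atoms φ ++ atoms ψ
  atoms (or φ ψ) = atoms φ ++ atoms ψ

  ev-cong-∈ : ∀ {e e'} (φ : BF A) → (∀ a → a ∈ atoms φ → e a ≡ e' a) → ev e φ ≡ ev e' φ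
  ev-cong-∈ (atm a) h = h a (here refl)
  ev-cong-∈ (cst b) h = refl
  ev-cong-∈ (neg φ) h = cong not (ev-cong-∈ φ h)
  ev-cong-∈ (and φ ψ) h = cong₂ _∧_ (ev-cong-∈ φ (λ a → h a ∘ ∈-++⁺ˡ)) (ev-cong-∈ ψ (λ a → h a ∘ ∈-++⁺ʳ (atoms φ)))
  ev-cong-∈ (or φ ψ) h = cong₂ _∨_ (ev-cong-∈ φ (λ a → h a ∘ ∈-++⁺ˡ)) (ev-cong-∈ ψ (λ a → h a ∘ ∈-++⁺ʳ (atoms φ)))

  ev-cong : ∀ {e e'} (φ : BF A) → (∀ a → e a ≡ e' a) → ev e φ ≡ ev e' φ
  ev-cong φ h = ev-cong-∈ φ (λ a _ → h a)

  some every : {X : Set} → List X → (X → BF A) → BF A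
  some xs g = foldr (or ∘ g) (cst false) xs
  every xs g = foldr (and ∘ g) (cst true) xs

  module _ {e : A → Bool} where
    and⁺ : ∀ {φ ψ} → Tr (ev e φ) → Tr (ev e ψ) → Tr (ev e (and φ ψ))
    and⁺ p q rewrite p = q

    and⁻ : ∀ φ ψ → Tr (ev e (and φ ψ)) → Tr (ev e φ) × Tr (ev e ψ)
    and⁻ φ ψ p with ev e φ
    ... | true = refl , p

    or⁺ˡ : ∀ φ ψ → Tr (ev e φ) → Tr (ev e (or φ ψ))
    or⁺ˡ φ ψ p rewrite p = refl

    or⁺ʳ : ∀ φ ψ → Tr (ev e ψ) → Tr (ev e (or φ ψ))
    or⁺ʳ φ ψ p with ev e φ
    ... | true = refl
    ... | false = p

    or⁻ : ∀ φ ψ → Tr (ev e (or φ ψ)) → Tr (ev e φ) ⊎ Tr (ev e ψ)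
    or⁻ φ ψ p with ev e φ
    ... | true = inj₁ refl
    ... | false = inj₂ p

    neg⁺ : ∀ φ → ¬ Tr (ev e φ) → Tr (ev e (neg φ))
    neg⁺ φ p with ev e φ
    ... | true = ⊥-elim (p refl)
    ... | false = refl

    neg⁻ : ∀ φ → Tr (ev e (neg φ)) → ¬ Tr (ev e φ)
    neg⁻ φ p q rewrite q with p
    ... | ()

    some⁺ : {X : Set} {xs : List X} (g : X → BF A) {x : X} → x ∈ xs → Tr (ev e (g x)) → Tr (ev e (some xs g))
    some⁺ {xs = y ∷ xs} g (here refl) p = or⁺ˡ (g y) (some xs g) p
    some⁺ {xs = y ∷ xs} g (there i) p = or⁺ʳ (g y) (some xs g) (some⁺ g i p)

    some⁻ : {X : Set} (xs : List X) (g : X → BF A) → Tr (ev e (some xs g)) → Σ X λ x → x ∈ xs × Tr (ev e (g x))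
    some⁻ (x ∷ xs) g p with or⁻ (g x) (some xs g) p
    ... | inj₁ q = x , here refl , q
    ... | inj₂ q with some⁻ xs g q
    ...   | y , i , r = y , there i , r

    every⁺ : {X : Set} (xs : List X) (g : X → BF A) → (∀ {x} → x ∈ xs → Tr (ev e (g x))) → Tr (ev e (every xs g))
    every⁺ [] g h = refl
    every⁺ (x ∷ xs) g h = and⁺ {g x} {every xs g} (h (here refl)) (every⁺ xs g (h ∘ there))

    every⁻ : {X : Set} {xs : List X} (g : X → BF A) → Tr (ev e (every xs g)) → ∀ {x} → x ∈ xs → Tr (ev e (g x))
    every⁻ {xs = y ∷ xs} g p (here refl) = proj₁ (and⁻ (g y) (every xs g) p)
    every⁻ {xs = y ∷ xs} g p (there i) = every⁻ g (proj₂ (and⁻ (g y) (every xs g) p)) i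


bind : {A B : Set} → BF A → (A → BF B) → BF B
bind (atm a) g = g a
bind (cst b) g = cst b
bind (neg φ) g = neg (bind φ g)
bind (and φ ψ) g = and (bind φ g) (bind ψ g)
bind (or φ ψ) g = or (bind φ g) (bind ψ g)

ev-bind : {A B : Set} {e : B → Bool} (φ : BF A) (g : A → BF B) → ev e (bind φ g) ≡ ev (ev e ∘ g) φ
ev-bind (atm a) g = refl
ev-bind (cst b) g = refl
ev-bind (neg φ) g = cong not (ev-bind φ g)
ev-bind (and φ ψ) g = cong₂ _∧_ (ev-bind φ g) (ev-bind ψ g)
ev-bind (or φ ψ) g = cong₂ _∨_ (ev-bind φ g) (ev-bind ψ g)

-- One contribution per leaf: only truncated multiplicities matter

module Choice {W : Set} (_⊕_ : W → W → W) (𝟘 : W)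
  (⊕-assoc : ∀ x y z → (x ⊕ y) ⊕ z ≡ x ⊕ (y ⊕ z))
  (⊕-comm : ∀ x y → x ⊕ y ≡ y ⊕ x)
  (⊕-idˡ : ∀ x → 𝟘 ⊕ x ≡ x) where

  mul : ℕ → W → W
  mul zero d = 𝟘
  mul (suc a) d = d ⊕ mul a d

  -- A multiset of `n` members of `D`, repetitions allowed, listed in the order of `D`, so that all
  -- copies of the head can be split off at once.
  data Sum : List W → ℕ → W → Set where
    done : ∀ {D} → Sum D 0 𝟘
    use  : ∀ {d D n w} → Sum (d ∷ D) n w → Sum (d ∷ D) (suc n) (d ⊕ w)
    skip : ∀ {d D n w} → Sum D n w → Sum (d ∷ D) n w

  hit : List W → ℕ → (W → Bool) → Bool
  hit D zero X = X 𝟘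
  hit [] (suc n) X = false
  hit (d ∷ D) (suc n) X = hit (d ∷ D) n (λ w → X (d ⊕ w)) ∨ hit D (suc n) X

  Sum-zero : ∀ {D w} → Sum D 0 w → w ≡ 𝟘
  Sum-zero done = refl
  Sum-zero (skip s) = Sum-zero s

  hit⁻ : ∀ D n X → Tr (hit D n X) → Σ W λ w → Sum D n w × Tr (X w)
  hit⁻ D zero X p = 𝟘 , done , p
  hit⁻ (d ∷ D) (suc n) X p = [
    (λ q → let w , s , x = hit⁻ (d ∷ D) n (λ w → X (d ⊕ w)) q in d ⊕ w , use s , x) ,
    (λ q → let w , s , x = hit⁻ D (suc n) X q in w , skip s , x) ]′
    (∨-true (hit (d ∷ D) n (λ w → X (d ⊕ w))) p)

  hit⁺ : ∀ D n X {w} → Sum D n w → Tr (X w) → Tr (hit D n X)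
  hit⁺ D zero X s x rewrite Sum-zero s = x
  hit⁺ (d ∷ D) (suc n) X (use s) x rewrite hit⁺ (d ∷ D) n (λ w → X (d ⊕ w)) s x = refl
  hit⁺ (d ∷ D) (suc n) X (skip s) x with hit (d ∷ D) n (λ w → X (d ⊕ w))
  ... | true = refl
  ... | false = hit⁺ D (suc n) X s x

  -- Beyond K copies of d, X does not notice further ones.
  record Saturated (K : ℕ) (X : W → Bool) : Set where
    constructor saturated
    field
      absorb : ∀ {a} d w → K ≤ a → X (mul a d ⊕ w) ≡ X (mul (suc a) d ⊕ w)
  open Saturated

  swap-head : ∀ x y z → x ⊕ (y ⊕ z) ≡ y ⊕ (x ⊕ z)
  swap-head x y z = trans (sym (⊕-assoc x y z)) (trans (cong (_⊕ z) (⊕-comm x y)) (⊕-assoc y x z))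

  Saturated-shift : ∀ {K X} u → Saturated K X → Saturated K (λ w → X (u ⊕ w))
  Saturated-shift {K} {X} u S .absorb {a} d w le = trans (cong X (swap-head u (mul a d) w))
    (trans (S .absorb d (u ⊕ w) le) (cong X (swap-head (mul (suc a) d) u w)))

  split : ∀ {d D n w} → Sum (d ∷ D) n w →
    Σ ℕ λ a → Σ ℕ λ b → Σ W λ v → a + b ≡ n × mul a d ⊕ v ≡ w × Sum D b v
  split done = 0 , 0 , 𝟘 , refl , ⊕-idˡ 𝟘 , done
  split {d} (use s) with split s
  ... | a , b , v , refl , refl , t = suc a , b , v , refl , ⊕-assoc d (mul a d) v , t
  split (skip s) = 0 , _ , _ , refl , ⊕-idˡ _ , s

  unsplit : ∀ {d D b v} a → Sum D b v → Sum (d ∷ D) (a + b) (mul a d ⊕ v)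
  unsplit zero s = subst (Sum _ _) (sym (⊕-idˡ _)) (skip s)
  unsplit {d} (suc a) s = subst (Sum _ _) (sym (⊕-assoc d (mul a d) _)) (use (unsplit a s))

  -- Pigeonhole: with more than `K` uses per member of `D` on average, some member is used at least
  -- `K` times, and saturation permits one more copy. If the head is used fewer than `K` times, the
  -- uses that remain still exceed `K` per remaining member.
  up : ∀ {K X} D n {w} → Saturated K X → length D * K < n → Sum D n w → Tr (X w) →
    Σ W λ w' → Sum D (suc n) w' × Tr (X w')
  up [] (suc n) S lt ()
  up {K} {X} (d ∷ D) n S lt s x with split s
  ... | a , b , v , refl , refl , t with K ≤? a
  ...   | yes le = _ , unsplit (suc a) t , trans (sym (S .absorb d v le)) x
  ...   | no ¬le with up D b (Saturated-shift (mul a d) S) lt' t x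
    where
    lt' : length D * K < b
    lt' = ℕ.+-cancelˡ-< K _ _ (ℕ.<-≤-trans lt (ℕ.+-monoˡ-≤ b (ℕ.<⇒≤ (ℕ.≰⇒> ¬le))))
  ...     | v' , t' , x' = _ , subst (λ k → Sum (d ∷ D) k (mul a d ⊕ v')) (ℕ.+-suc a b) (unsplit a t') , x'

  -- Here `suc K` copies are required, since the copy taken away must leave `K` behind. The same
  -- inequality for `n` suffices because the given sum has `suc n` members.
  down : ∀ {K X} D n {w} → Saturated K X → length D * K < n → Sum D (suc n) w → Tr (X w) →
    Σ W λ w' → Sum D n w' × Tr (X w')
  down [] n S lt ()
  down {K} {X} (d ∷ D) n S lt s x with split s
  ... | a , b , v , eq , refl , t with suc K ≤? a
  down {K} {X} (d ∷ D) n S lt s x | suc a , b , v , refl , refl , t | yes (s≤s le) =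
    _ , unsplit a t , trans (S .absorb d v le) x
  ... | no ¬le with b | t
  ...   | zero | t = ⊥-elim (ℕ.<-irrefl refl
      (ℕ.<-≤-trans lt (≤-trans (ℕ.≤-pred
      (≤-trans (ℕ.≤-reflexive (sym eq))
      (≤-trans (ℕ.≤-reflexive (ℕ.+-identityʳ a)) (≤-trans (ℕ.≤-pred (ℕ.≰⇒> ¬le)) (ℕ.n≤1+n K))))) (ℕ.m≤m+n K _))))
  ...   | suc b | t with down D b (Saturated-shift (mul a d) S) lt' t x
    where
    eq' : a + b ≡ n
    eq' = suc-injective (trans (sym (ℕ.+-suc a b)) eq)
    lt' : length D * K < b
    lt' = ℕ.+-cancelˡ-< K _ _ (ℕ.<-≤-trans lt
        (≤-trans (ℕ.≤-reflexive (sym eq')) (ℕ.+-monoˡ-≤ b (ℕ.≤-pred (ℕ.≰⇒> ¬le)))))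
  ...     | v' , t' , x' = _ , subst (λ k → Sum _ k _) (suc-injective (trans (sym (ℕ.+-suc a b)) eq)) (unsplit a t') ,
      x'

  hit-step : ∀ {K X} D n → Saturated K X → length D * K < n → hit D n X ≡ hit D (suc n) X
  hit-step {K} {X} D n S lt = Tr⇒≡
    (λ p → let w , s , x = hit⁻ D n X p ; w' , s' , x' = up D n S lt s x in hit⁺ D (suc n) X s' x')
    (λ p → let w , s , x = hit⁻ D (suc n) X p ; w' , s' , x' = down D n S lt s x in hit⁺ D n X s' x')

  hit-stable : ∀ {K X} D m → Saturated K X → hit D (suc (length D * K)) X ≡ hit D (m + suc (length D * K)) X
  hit-stable D zero S = refl
  hit-stable {K} D (suc m) S = trans (hit-stable D m S)
      (hit-step D (m + suc (length D * K)) S (ℕ.m≤n+m (suc (length D * K)) m))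

  module Types {Ty : Set} (_≟_ : DecidableEquality Ty) (D : Ty → List W) where

    data Choose : List Ty → W → Set where
      []  : Choose [] 𝟘
      _∷_ : ∀ {A L d w} → d ∈ D A → Choose L w → Choose (A ∷ L) (d ⊕ w)

    occ : Ty → List Ty → ℕ
    occ A [] = 0
    occ A (B ∷ L) = if does (B ≟ A) then suc (occ A L) else occ A L

    del : Ty → List Ty → List Ty
    del A [] = []
    del A (B ∷ L) = if does (B ≟ A) then del A L else B ∷ del A L

    occ-del : ∀ A B L → occ B (del A L) ≡ (if does (B ≟ A) then 0 else occ B L)
    occ-del A B [] with does (B ≟ A)
    ... | true = refl
    ... | false = refl
    occ-del A B (C ∷ L) with C ≟ A | C ≟ B | occ-del A B L
    occ-del A B (C ∷ L) | yes refl | yes refl | ih with B ≟ B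
    ... | yes _ = ih
    ... | no ¬p = ⊥-elim (¬p refl)
    occ-del A B (C ∷ L) | yes refl | no q | ih = ih
    occ-del A B (C ∷ L) | no p | yes refl | ih with C ≟ C | C ≟ A
    ... | _ | yes q = ⊥-elim (p q)
    ... | yes _ | no _ = cong suc ih
    ... | no ¬q | no _ = ⊥-elim (¬q refl)
    occ-del A B (C ∷ L) | no p | no q | ih with C ≟ B
    ... | yes r = ⊥-elim (q r)
    ... | no _ = ih

    -- Members are listed in the order of `D`, so a member of the tail has to be inserted behind all
    -- copies of the head; these are split off and put back.
    Sum-add : ∀ {D d n u} → d ∈ D → Sum D n u → Sum D (suc n) (d ⊕ u)
    Sum-add (here refl) s = use s
    Sum-add {D = x ∷ D} {d = d} (there i) s with split s
    ... | a , b , v , refl , refl , t = subst (Sum _ _) (swap-head _ d v)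
      (subst (λ k → Sum (x ∷ D) k (mul a x ⊕ (d ⊕ v))) (ℕ.+-suc a b) (unsplit a (Sum-add i t)))

    Sum-take : ∀ {D n w} → Sum D (suc n) w → Σ W λ d → Σ W λ u → d ∈ D × Sum D n u × d ⊕ u ≡ w
    Sum-take (use s) = _ , _ , here refl , s , refl
    Sum-take (skip s) with Sum-take s
    ... | d , u , i , t , e = d , u , there i , skip t , e

    -- Choices made for equal types are interchangeable: those for `A` collapse to a sum with
    -- `occ A L` members, whatever their positions in `L`.
    choose⁻ : ∀ A {L w} → Choose L w → Σ W λ u → Σ W λ v → Sum (D A) (occ A L) u × Choose (del A L) v × u ⊕ v ≡ w
    choose⁻ A [] = 𝟘 , 𝟘 , done , [] , ⊕-idˡ 𝟘
    choose⁻ A (_∷_ {B} {L} {d} i c) with choose⁻ A c | B ≟ A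
    ... | u , v , s , t , refl | yes refl = _ , v , Sum-add i s , t , ⊕-assoc d u v
    ... | u , v , s , t , refl | no _ = u , _ , s , i ∷ t , swap-head u d v

    choose⁺ : ∀ A L {u v} → Sum (D A) (occ A L) u → Choose (del A L) v → Choose L (u ⊕ v)
    choose⁺ A [] s [] rewrite Sum-zero s | ⊕-idˡ 𝟘 = []
    choose⁺ A (B ∷ L) s c with B ≟ A
    choose⁺ A (B ∷ L) s c | yes refl with Sum-take s
    ... | d , u , i , t , refl = subst (Choose _) (sym (⊕-assoc d u _)) (i ∷ choose⁺ A L t c)
    choose⁺ A (B ∷ L) {u} s (_∷_ {d = d} {w} i c) | no _ = subst (Choose _) (swap-head d u w) (i ∷ choose⁺ A L s c)

    module _ (K : ℕ) where

      cap : Ty → ℕ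
      cap A = suc (length (D A) * K)

      -- Existential image: `m` choices for `A` are absorbed into the predicate, which then
      -- constrains only the choices for the other types.
      after : Ty → ℕ → (W → Bool) → W → Bool
      after A m X w = hit (D A) m (λ u → X (u ⊕ w))

      dropAtom : Ty → Ty × ℕ → BF (Ty × ℕ)
      dropAtom A (B , j) = if does (B ≟ A) then cst (j ≤ᵇ 0) else atm (B , j)

      exactly : Ty → ℕ → BF (Ty × ℕ)
      exactly A m = and (atm (A , m)) (neg (atm (A , suc m)))

      -- Only the number of occurrences of A up to cap A matters; A is deleted before
      -- the remaining types are treated, which explains dropAtom.
      choosable : List Ty → (W → Bool) → BF (Ty × ℕ)
      choosable [] X = cst (X 𝟘)
      choosable (A ∷ As) X = or (some (upTo (cap A)) (λ m → and (exactly A m) (rest m)))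
          (and (atm (A , cap A)) (rest (cap A)))
        where
        rest : ℕ → BF (Ty × ℕ)
        rest m = bind (choosable As (after A m X)) (dropAtom A)

      occᵇ : List Ty → Ty × ℕ → Bool
      occᵇ L (B , j) = j ≤ᵇ occ B L

      ev-drop : ∀ A L φ → ev (occᵇ L) (bind φ (dropAtom A)) ≡ ev (occᵇ (del A L)) φ
      ev-drop A L φ = trans (ev-bind φ (dropAtom A)) (ev-cong φ go)
        where
        go : ∀ a → ev (occᵇ L) (dropAtom A a) ≡ occᵇ (del A L) a
        go (B , j) rewrite occ-del A B L with does (B ≟ A)
        ... | true = refl
        ... | false = refl

      Saturated-flip : ∀ {X} w → Saturated K X → Saturated K (λ u → X (u ⊕ w))
      Saturated-flip {X} w S .absorb {a} d v le =
          trans (cong X (⊕-assoc _ _ _)) (trans (S .absorb d (v ⊕ w) le) (cong X (sym (⊕-assoc _ _ _))))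

      -- `hit` is a finite disjunction of translates of `X`, each saturated with the same `K`; hence
      -- the bound `K` does not grow along the recursion over the types.
      Saturated-after : ∀ {X} A m → Saturated K X → Saturated K (after A m X)
      Saturated-after {X} A m S .absorb {a} d w le =
          go (D A) m (λ u → trans (cong X (swap-head u _ w))
          (trans (S .absorb d (u ⊕ w) le) (cong X (swap-head _ u w))))
        where
        go : ∀ D n {X Y : W → Bool} → (∀ u → X u ≡ Y u) → hit D n X ≡ hit D n Y
        go D zero h = h 𝟘
        go [] (suc n) h = refl
        go (d ∷ D) (suc n) h = cong₂ _∨_ (go (d ∷ D) n (λ u → h (d ⊕ u))) (go D (suc n) h)

      del-⊆ : ∀ A {As} L → AllL (_∈ A ∷ As) L → AllL (_∈ As) (del A L)
      del-⊆ A [] [] = []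
      del-⊆ A (B ∷ L) (p ∷ ps) with B ≟ A
      ... | yes _ = del-⊆ A L ps
      del-⊆ A (B ∷ L) (here p ∷ ps) | no q = ⊥-elim (q p)
      del-⊆ A (B ∷ L) (there p ∷ ps) | no q = p ∷ del-⊆ A L ps

      module _ (A : Ty) (As : List Ty) (X : W → Bool) (S : Saturated K X) (L : List Ty) where

        rest few many : ℕ → BF (Ty × ℕ)
        rest m = bind (choosable As (after A m X)) (dropAtom A)
        few m = and (exactly A m) (rest m)
        many m = and (atm (A , m)) (rest m)

        small : BF (Ty × ℕ)
        small = some (upTo (cap A)) few

        capped : cap A ≤ occ A L → ∀ w → after A (cap A) X w ≡ after A (occ A L) X w
        capped le w = trans (hit-stable (D A) (occ A L ∸ cap A) (Saturated-flip w S))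
            (cong (λ k → after A k X w) (ℕ.m∸n+n≡m le))

        -- The number `m` found need not be `occ A L` but is indistinguishable from it: either it is
        -- exact, or both are at least `cap A`, from where on `hit` is constant.
        branch⁻ : Tr (ev (occᵇ L) (choosable (A ∷ As) X)) →
          Σ ℕ λ m → (∀ w → after A m X w ≡ after A (occ A L) X w) × Tr (ev (occᵇ L) (rest m))
        branch⁻ p with or⁻ {e = occᵇ L} small (many (cap A)) p
        ... | inj₁ q with some⁻ {e = occᵇ L} (upTo (cap A)) few q
        ...   | m , _ , r with and⁻ {e = occᵇ L} (exactly A m) (rest m) r
        ...     | r₁ , r₂ with and⁻ {e = occᵇ L} (atm (A , m)) (neg (atm (A , suc m))) r₁
        ...       | r₃ , r₄ = m , (λ w → cong (λ k → after A k X w) (ℕ.≤-antisym (≤ᵇ⁻ {m} {occ A L} r₃)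
                      (ℕ.≮⇒≥ (neg⁻ {e = occᵇ L} (atm (A , suc m)) r₄ ∘ ≤ᵇ⁺)))) , r₂
        branch⁻ p | inj₂ q with and⁻ {e = occᵇ L} (atm (A , cap A)) (rest (cap A)) q
        ... | r₁ , r₂ = cap A , capped (≤ᵇ⁻ {cap A} {occ A L} r₁) , r₂

        branch⁺ : (∀ m → (∀ w → after A m X w ≡ after A (occ A L) X w) → Tr (ev (occᵇ L) (rest m))) →
          Tr (ev (occᵇ L) (choosable (A ∷ As) X))
        branch⁺ h with occ A L <? cap A
        ... | yes lt = or⁺ˡ {e = occᵇ L} small (many (cap A)) (some⁺ {e = occᵇ L} few (∈-upTo⁺ lt)
              (and⁺ {e = occᵇ L} {exactly A (occ A L)} {rest (occ A L)} exact (h (occ A L) (λ _ → refl))))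
          where
          exact : Tr (ev (occᵇ L) (exactly A (occ A L)))
          exact = and⁺ {e = occᵇ L} {atm (A , occ A L)} {neg (atm (A , suc (occ A L)))} (≤ᵇ⁺ {occ A L} ≤-refl)
            (neg⁺ {e = occᵇ L} (atm (A , suc (occ A L))) (λ p → ℕ.<-irrefl refl (≤ᵇ⁻ {suc (occ A L)} p)))
        ... | no ¬lt = or⁺ʳ {e = occᵇ L} small (many (cap A))
              (and⁺ {e = occᵇ L} {atm (A , cap A)} {rest (cap A)} (≤ᵇ⁺ (ℕ.≮⇒≥ ¬lt)) (h (cap A) (capped (ℕ.≮⇒≥ ¬lt))))

      choosable⁻ : ∀ As X L → Saturated K X → AllL (_∈ As) L → Tr (ev (occᵇ L) (choosable As X)) → Σ W λ w →
          Choose L w × Tr (X w)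
      choosable⁻ [] X [] S [] p = 𝟘 , [] , p
      choosable⁻ [] X (_ ∷ _) S (() ∷ _) p
      choosable⁻ (A ∷ As) X L S h p with branch⁻ A As X S L p
      ... | m , same , q with choosable⁻ As (after A m X) (del A L) (Saturated-after A m S) (del-⊆ A L h)
          (trans (sym (ev-drop A L (choosable As (after A m X)))) q)
      ... | w , c , x with hit⁻ (D A) (occ A L) (λ u → X (u ⊕ w)) (trans (sym (same w)) x)
      ... | u , s , y = u ⊕ w , choose⁺ A L s c , y

      choosable⁺ : ∀ As X L {w} → Saturated K X → AllL (_∈ As) L → Choose L w → Tr (X w) →
          Tr (ev (occᵇ L) (choosable As X))
      choosable⁺ [] X [] S h [] x = x
      choosable⁺ [] X (_ ∷ _) S (() ∷ _) c x
      choosable⁺ (A ∷ As) X L S h c x with choose⁻ A c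
      ... | u , v , s , t , refl = branch⁺ A As X S L λ m same →
        trans (ev-drop A L (choosable As (after A m X)))
          (choosable⁺ As (after A m X) (del A L) (Saturated-after A m S) (del-⊆ A L h) t
            (trans (same v) (hit⁺ (D A) (occ A L) (λ u → X (u ⊕ v)) s x)))

-- Shapes, leaves and labels

module QE (S : Setting) where
  open Setting S
  open Env

  Sh Tm : Set
  Sh = Shape S
  Tm = Term S

  LF : ℕ → Set
  LF = LForm S

  Pos : Set
  Pos = Path S

  mutual
    _≟S_ : DecidableEquality Sh
    cS ≟S cS = yes refl
    cS ≟S fS f ss = no λ ()
    fS f ss ≟S cS = no λ ()
    fS f ss ≟S fS g us with f Fin.≟ g
    ... | no ne = no λ { refl → ne refl }
    ... | yes refl with ss ≟Ss us
    ...   | yes refl = yes refl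
    ...   | no ne = no λ { refl → ne refl }

    _≟Ss_ : ∀ {k} → DecidableEquality (Vec Sh k)
    [] ≟Ss [] = yes refl
    (s ∷ ss) ≟Ss (u ∷ us) with s ≟S u | ss ≟Ss us
    ... | yes refl | yes refl = yes refl
    ... | no ne | _ = no λ { refl → ne refl }
    ... | _ | no ne = no λ { refl → ne refl }

  fS-injective : ∀ {f ss us} → fS {S} f ss ≡ fS f us → ss ≡ us
  fS-injective refl = refl

  -- Selectors are made total: applied to a wrong constructor they act as the identity.
  selT : (f : Fin m) → Fin (ar f) → Tm → Tm
  selT f k (con c) = con c
  selT f k (app g ts) with g Fin.≟ f
  ... | yes refl = lookup ts k
  ... | no _ = app g ts

  selSh : (f : Fin m) → Fin (ar f) → Sh → Sh
  selSh f k cS = cS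
  selSh f k (fS g ss) with g Fin.≟ f
  ... | yes refl = lookup ss k
  ... | no _ = fS g ss

  navT : Tm → Pos → Tm
  navT t [] = t
  navT t ((f , k) ∷ p) = navT (selT f k t) p

  navS : Sh → Pos → Sh
  navS s [] = s
  navS s ((f , k) ∷ p) = navS (selSh f k s) p

  snoc : Pos → (f : Fin m) → Fin (ar f) → Pos
  snoc p f k = p ++ (f , k) ∷ []

  navT-snoc : ∀ t p f k → navT t (snoc p f k) ≡ selT f k (navT t p)
  navT-snoc t [] f k = refl
  navT-snoc t ((g , j) ∷ p) f k = navT-snoc (selT g j t) p f k

  navS-snoc : ∀ s p f k → navS s (snoc p f k) ≡ selSh f k (navS s p)
  navS-snoc s [] f k = refl
  navS-snoc s ((g , j) ∷ p) f k = navS-snoc (selSh g j s) p f k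

  selT-app : ∀ f k ts → selT f k (app f ts) ≡ lookup ts k
  selT-app f k ts with f Fin.≟ f
  ... | yes refl = refl
  ... | no ne = ⊥-elim (ne refl)

  selSh-fS : ∀ f k ss → selSh f k (fS f ss) ≡ lookup ss k
  selSh-fS f k ss with f Fin.≟ f
  ... | yes refl = refl
  ... | no ne = ⊥-elim (ne refl)

  shapeV-map : ∀ {k} (ts : Vec Tm k) → shapeV S ts ≡ Vec.map (shape S) ts
  shapeV-map [] = refl
  shapeV-map (t ∷ ts) = cong (shape S t ∷_) (shapeV-map ts)

  lookup-shapeV : ∀ {k} (ts : Vec Tm k) i → lookup (shapeV S ts) i ≡ shape S (lookup ts i)
  lookup-shapeV ts i = trans (cong (λ v → lookup v i) (shapeV-map ts)) (Vec.lookup-map i (shape S) ts)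

  shape-selT : ∀ f k t → shape S (selT f k t) ≡ selSh f k (shape S t)
  shape-selT f k (con c) = refl
  shape-selT f k (app g ts) with g Fin.≟ f
  ... | yes refl = sym (lookup-shapeV ts k)
  ... | no _ = refl

  shape-navT : ∀ t p → shape S (navT t p) ≡ navS (shape S t) p
  shape-navT t [] = refl
  shape-navT t ((f , k) ∷ p) = trans (shape-navT (selT f k t) p) (cong (λ s → navS s p) (shape-selT f k t))

  shape≡fS : ∀ t {f ss} → shape S t ≡ fS f ss → Σ (Vec Tm (ar f)) λ ts → t ≡ app f ts × shapeV S ts ≡ ss
  shape≡fS (app f ts) refl = ts , refl , refl

  mutual
    height : Sh → ℕ
    height cS = 0
    height (fS f ss) = suc (heightV ss)

    heightV : ∀ {k} → Vec Sh k → ℕ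
    heightV [] = 0
    heightV (s ∷ ss) = height s ⊔ heightV ss

  height-lookup : ∀ {k} (ss : Vec Sh k) i → height (lookup ss i) ≤ heightV ss
  height-lookup (s ∷ ss) zero = ℕ.m≤m⊔n _ _
  height-lookup (s ∷ ss) (suc i) = ≤-trans (height-lookup ss i) (ℕ.m≤n⊔m (height s) _)

  mutual
    -- Variances of the leaves from left to right, the order also used by `labs`: leaf and label are
    -- matched by rank, and positions can be forgotten.
    signs : Sh → List Sg.Sign
    signs cS = Sg.+ ∷ []
    signs (fS f ss) = signsV (var f) ss

    signsV : ∀ {k} → (Fin k → Sg.Sign) → Vec Sh k → List Sg.Sign
    signsV v [] = []
    signsV v (s ∷ ss) = List.map (v zero Sg.*_) (signs s) ++ signsV (v ∘ suc) ss

  mutual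
    labs : Tm → List (Fin n)
    labs (con c) = c ∷ []
    labs (app f ts) = labsV ts

    labsV : ∀ {k} → Vec Tm k → List (Fin n)
    labsV [] = []
    labsV (t ∷ ts) = labs t ++ labsV ts

  length-++-cong : ∀ {A B : Set} (as as' : List A) (bs bs' : List B) → length as ≡ length bs → length as'
      ≡ length bs' →
    length (as ++ as') ≡ length (bs ++ bs')
  length-++-cong as as' bs bs' p q = trans (List.length-++ as) (trans (cong₂ _+_ p q) (sym (List.length-++ bs)))

  mutual
    length-labs : ∀ t → length (labs t) ≡ length (signs (shape S t))
    length-labs (con c) = refl
    length-labs (app f ts) = length-labsV (var f) ts

    length-labsV : ∀ {k} v (ts : Vec Tm k) → length (labsV ts) ≡ length (signsV v (shapeV S ts))
    length-labsV v [] = refl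
    length-labsV v (t ∷ ts) = length-++-cong (labs t) (labsV ts) (List.map (v zero Sg.*_) (signs (shape S t)))
        (signsV (v ∘ suc) (shapeV S ts))
      (trans (length-labs t) (sym (List.length-map (v zero Sg.*_) (signs (shape S t))))) (length-labsV (v ∘ suc) ts)

  split-length : ∀ {A B : Set} (cs : List A) (as bs : List B) → length cs ≡ length (as ++ bs) →
    Σ (List A) λ xs → Σ (List A) λ ys → cs ≡ xs ++ ys × length xs ≡ length as × length ys ≡ length bs
  split-length cs [] bs p = [] , cs , refl , refl , p
  split-length (c ∷ cs) (a ∷ as) bs p with split-length cs as bs (suc-injective p)
  ... | xs , ys , refl , q , r = c ∷ xs , ys , refl , cong suc q , r

  mutual
    label : ∀ s cs → length cs ≡ length (signs s) → Σ Tm λ t → shape S t ≡ s × labs t ≡ cs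
    label cS (c ∷ []) p = con c , refl , refl
    label (fS f ss) cs p with labelV (var f) ss cs p
    ... | ts , refl , refl = app f ts , refl , refl

    labelV : ∀ {k} v (ss : Vec Sh k) cs → length cs ≡ length (signsV v ss) →
      Σ (Vec Tm k) λ ts → shapeV S ts ≡ ss × labsV ts ≡ cs
    labelV v [] [] p = [] , refl , refl
    labelV v (s ∷ ss) cs p with split-length cs (List.map (v zero Sg.*_) (signs s)) (signsV (v ∘ suc) ss) p
    ... | xs , ys , refl , q , r with label s xs (trans q (List.length-map _ (signs s))) | labelV (v ∘ suc) ss ys r
    ... | t , refl , refl | ts , refl , refl = t ∷ ts , refl , refl

  -- Rows and leaf counts

  -- What a tuple of terms of one shape shows at a single leaf: the variance of the leaf and the
  -- label of each term there.
  Row : ℕ → Set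
  Row k = Sg.Sign × Vec (Fin n) k

  consRow : ∀ {k} → Fin n → Row k → Row (suc k)
  consRow c (σ , e) = σ , c ∷ e

  zipRow : ∀ {k} → List (Fin n) → List (Row k) → List (Row (suc k))
  zipRow = zipWith consRow

  rows : ∀ {k} → Vec Tm k → Sh → List (Row k)
  rows [] s = List.map (_, []) (signs s)
  rows (t ∷ ts) s = zipRow (labs t) (rows ts s)

  bit : Bool → ℕ
  bit b = if b then 1 else 0

  cntR : {X : Set} → (X → Bool) → List X → ℕ
  cntR g [] = 0
  cntR g (x ∷ xs) = bit (g x) + cntR g xs

  evalR : ∀ {k} → LF k → Row k → Bool
  evalR ψ (σ , e) = evalL S σ ψ e

  cnt : ∀ {k} → LF k → Vec Tm k → Sh → ℕ
  cnt ψ ts s = cntR (evalR ψ) (rows ts s)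

  cntR-map : ∀ {X Y : Set} (g : Y → Bool) (h : X → Y) xs → cntR g (List.map h xs) ≡ cntR (g ∘ h) xs
  cntR-map g h [] = refl
  cntR-map g h (x ∷ xs) = cong (bit (g (h x)) +_) (cntR-map g h xs)

  cntR-cong : ∀ {X : Set} {g h : X → Bool} xs → (∀ x → g x ≡ h x) → cntR g xs ≡ cntR h xs
  cntR-cong [] e = refl
  cntR-cong (x ∷ xs) e = cong₂ _+_ (cong bit (e x)) (cntR-cong xs e)

  cntR-++ : ∀ {X : Set} (g : X → Bool) xs ys → cntR g (xs ++ ys) ≡ cntR g xs + cntR g ys
  cntR-++ g [] ys = refl
  cntR-++ g (x ∷ xs) ys = trans (cong (bit (g x) +_) (cntR-++ g xs ys)) (sym (ℕ.+-assoc (bit (g x)) _ _))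

  length-zipRow : ∀ {k} cs (R : List (Row k)) → length cs ≡ length R → length (zipRow cs R) ≡ length R
  length-zipRow [] [] p = refl
  length-zipRow (c ∷ cs) (r ∷ R) p = cong suc (length-zipRow cs R (suc-injective p))

  length-rows : ∀ {k} (ts : Vec Tm k) s → All (λ t → shape S t ≡ s) ts → length (rows ts s) ≡ length (signs s)
  length-rows [] s [] = List.length-map _ (signs s)
  length-rows (t ∷ ts) .(shape S t) (refl ∷ ps) = trans (length-zipRow (labs t) _ (trans (length-labs t) (sym ih))) ih
    where ih = length-rows ts (shape S t) ps

  -- Agreement with the counting function of the structure.

  mutual
    variances : ∀ s → List.map (variance S) (leaves S s) ≡ signs s
    variances cS = refl
    variances (fS f ss) = trans (sym (List.map-∘ (leavesV S ss))) (variancesV (var f) ss)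

    variancesV : ∀ {k} (v : Fin k → Sg.Sign) ss →
      List.map (λ { (j , p) → v j Sg.* variance S p }) (leavesV S ss) ≡ signsV v ss
    variancesV v [] = refl
    variancesV v (s ∷ ss) = trans (List.map-++ _ (List.map (zero ,_) (leaves S s)) _) (cong₂ _++_
      (trans (sym (List.map-∘ (leaves S s))) (trans (List.map-∘ (leaves S s)) (cong (List.map _) (variances s))))
      (trans (sym (List.map-∘ (leavesV S ss))) (variancesV (v ∘ suc) ss)))

  mutual
    labels : ∀ t → List.map (at S t) (leaves S (shape S t)) ≡ List.map just (labs t)
    labels (con c) = refl
    labels (app f ts) = trans (sym (List.map-∘ (leavesV S (shapeV S ts))))
      (trans (List.map-cong diag (leavesV S (shapeV S ts))) (labelsV ts))
      where
      diag : ∀ jp → at S (app f ts) ((f , proj₁ jp) ∷ proj₂ jp) ≡ atV S ts (proj₁ jp) (proj₂ jp)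
      diag (j , p) with f Fin.≟ f
      ... | yes refl = refl
      ... | no ne = ⊥-elim (ne refl)

    labelsV : ∀ {k} (ts : Vec Tm k) →
      List.map (λ jp → atV S ts (proj₁ jp) (proj₂ jp)) (leavesV S (shapeV S ts)) ≡ List.map just (labsV ts)
    labelsV [] = refl
    labelsV (t ∷ ts) = trans (List.map-++ _ (List.map (zero ,_) (leaves S (shape S t))) _) (trans (cong₂ _++_
      (trans (sym (List.map-∘ (leaves S (shape S t)))) (labels t))
      (trans (sym (List.map-∘ (leavesV S (shapeV S ts)))) (labelsV ts)))
      (sym (List.map-++ just (labs t) _)))

  atRow : ∀ {k} → Vec Tm k → Pos → Sg.Sign × Maybe (Vec (Fin n) k)
  atRow ts l = variance S l , atAll S ts l

  justRow : ∀ {k} → Row k → Sg.Sign × Maybe (Vec (Fin n) k)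
  justRow (σ , e) = σ , just e

  atRows : ∀ {k} (ts : Vec Tm k) s → All (λ t → shape S t ≡ s) ts →
    List.map (atRow ts) (leaves S s) ≡ List.map justRow (rows ts s)
  atRows [] s [] = trans (List.map-∘ (leaves S s))
      (trans (cong (List.map (_, just [])) (variances s)) (List.map-∘ (signs s)))
  atRows (t ∷ ts) .(shape S t) (refl ∷ ps) =
      zipped (leaves S (shape S t)) (labs t) (rows ts (shape S t)) (labels t) (atRows ts (shape S t) ps)
    where
    zipped : ∀ ls cs R → List.map (at S t) ls ≡ List.map just cs → List.map (atRow ts) ls ≡ List.map justRow R →
      List.map (atRow (t ∷ ts)) ls ≡ List.map justRow (zipRow cs R)
    zipped [] [] R p q = refl
    zipped (l ∷ ls) (c ∷ cs) ((σ , e) ∷ R) p q =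
        cong₂ _∷_ one (zipped ls cs R (List.∷-injectiveʳ p) (List.∷-injectiveʳ q))
      where
      one : atRow (t ∷ ts) l ≡ justRow (consRow c (σ , e))
      one rewrite List.∷-injectiveˡ p | cong proj₂ (List.∷-injectiveˡ q) | cong proj₁ (List.∷-injectiveˡ q) = refl

  -- The function summed in count is local to its definition; unification recovers it.
  hitΣ : ∀ {k} (ψ : LF k) (ts : Vec Tm k) (s : Sh) → Σ (Pos → ℕ) λ h → count S ψ ts s ≡ sum (List.map h (leaves S s))
  hitΣ ψ ts s = _ , refl

  hitRow : ∀ {k} → LF k → Sg.Sign × Maybe (Vec (Fin n) k) → ℕ
  hitRow ψ (σ , nothing) = 0
  hitRow ψ (σ , just e) = bit (evalL S σ ψ e)

  hit-atRow : ∀ {k} (ψ : LF k) ts s l → proj₁ (hitΣ ψ ts s) l ≡ hitRow ψ (atRow ts l)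
  hit-atRow ψ ts s l with atAll S ts l
  ... | nothing = refl
  ... | just e = refl

  count≡cnt : ∀ {k} (ψ : LF k) ts s → All (λ t → shape S t ≡ s) ts → count S ψ ts s ≡ cnt ψ ts s
  count≡cnt ψ ts s ps = trans (cong sum (List.map-cong (hit-atRow ψ ts s) (leaves S s)))
    (trans (cong sum (trans (List.map-∘ (leaves S s)) (cong (List.map (hitRow ψ)) (atRows ts s ps))))
        (go (rows ts s)))
    where
    go : ∀ R → sum (List.map (hitRow ψ) (List.map justRow R)) ≡ cntR (evalR ψ) R
    go [] = refl
    go (r ∷ R) = cong (bit (evalR ψ r) +_) (go R)

  -- Operations on 𝒞-formulas.

  evalL-not : ∀ σ {k} (φ : LF k) e → evalL S σ (lnot φ) e ≡ not (evalL S σ φ e)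
  evalL-not Sg.+ φ e = refl
  evalL-not Sg.- φ e = refl

  evalL-and : ∀ σ {k} (φ ψ : LF k) e → evalL S σ (land φ ψ) e ≡ evalL S σ φ e ∧ evalL S σ ψ e
  evalL-and Sg.+ φ ψ e = refl
  evalL-and Sg.- φ ψ e = refl

  evalL-or : ∀ σ {k} (φ ψ : LF k) e → evalL S σ (lor φ ψ) e ≡ evalL S σ φ e ∨ evalL S σ ψ e
  evalL-or Sg.+ φ ψ e = refl
  evalL-or Sg.- φ ψ e = refl

  evalL-all : ∀ σ {k} (φ : LF (suc k)) e → evalL S σ (lall φ) e ≡ all (λ c → evalL S σ φ (c ∷ e)) (allFin n)
  evalL-all Sg.+ φ e = refl
  evalL-all Sg.- φ e = refl

  evalL-ex : ∀ σ {k} (φ : LF (suc k)) e → evalL S σ (lex φ) e ≡ any (λ c → evalL S σ φ (c ∷ e)) (allFin n)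
  evalL-ex Sg.+ φ e = refl
  evalL-ex Sg.- φ e = refl

  evalL-eq : ∀ σ {k} (i j : Fin k) e → evalL S σ (leq i j) e ≡ does (lookup e i Fin.≟ lookup e j)
  evalL-eq Sg.+ i j e = refl
  evalL-eq Sg.- i j e = refl

  evalL-rel : ∀ σ {k} r (xs : Vec (Fin k) (rar r)) e → evalL S σ (lrel r xs) e ≡ relI r (Vec.map (lookup e) xs)
  evalL-rel Sg.+ r xs e = refl
  evalL-rel Sg.- r xs e = refl

  all-cong : ∀ {A : Set} {p q : A → Bool} xs → (∀ x → p x ≡ q x) → all p xs ≡ all q xs
  all-cong [] h = refl
  all-cong (x ∷ xs) h = cong₂ _∧_ (h x) (all-cong xs h)

  any-cong : ∀ {A : Set} {p q : A → Bool} xs → (∀ x → p x ≡ q x) → any p xs ≡ any q xs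
  any-cong [] h = refl
  any-cong (x ∷ xs) h = cong₂ _∨_ (h x) (any-cong xs h)

  invL : ∀ {k} → LF k → LF k
  invL (lle i j) = lle j i
  invL (lrel r xs) = lrel r xs
  invL (leq i j) = leq i j
  invL (lnot φ) = lnot (invL φ)
  invL (land φ ψ) = land (invL φ) (invL ψ)
  invL (lor φ ψ) = lor (invL φ) (invL ψ)
  invL (lall φ) = lall (invL φ)
  invL (lex φ) = lex (invL φ)

  evalL-inv : ∀ σ {k} (φ : LF k) e → evalL S (Sg.opposite σ) φ e ≡ evalL S σ (invL φ) e
  evalL-inv Sg.+ (lle i j) e = refl
  evalL-inv Sg.- (lle i j) e = refl
  evalL-inv Sg.+ (lrel r xs) e = refl
  evalL-inv Sg.- (lrel r xs) e = refl
  evalL-inv Sg.+ (leq i j) e = refl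
  evalL-inv Sg.- (leq i j) e = refl
  evalL-inv Sg.+ (lnot φ) e = cong not (evalL-inv Sg.+ φ e)
  evalL-inv Sg.- (lnot φ) e = cong not (evalL-inv Sg.- φ e)
  evalL-inv Sg.+ (land φ ψ) e = cong₂ _∧_ (evalL-inv Sg.+ φ e) (evalL-inv Sg.+ ψ e)
  evalL-inv Sg.- (land φ ψ) e = cong₂ _∧_ (evalL-inv Sg.- φ e) (evalL-inv Sg.- ψ e)
  evalL-inv Sg.+ (lor φ ψ) e = cong₂ _∨_ (evalL-inv Sg.+ φ e) (evalL-inv Sg.+ ψ e)
  evalL-inv Sg.- (lor φ ψ) e = cong₂ _∨_ (evalL-inv Sg.- φ e) (evalL-inv Sg.- ψ e)
  evalL-inv Sg.+ (lall φ) e = all-cong (allFin n) (λ c → evalL-inv Sg.+ φ (c ∷ e))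
  evalL-inv Sg.- (lall φ) e = all-cong (allFin n) (λ c → evalL-inv Sg.- φ (c ∷ e))
  evalL-inv Sg.+ (lex φ) e = any-cong (allFin n) (λ c → evalL-inv Sg.+ φ (c ∷ e))
  evalL-inv Sg.- (lex φ) e = any-cong (allFin n) (λ c → evalL-inv Sg.- φ (c ∷ e))

  -- The variance of an argument position multiplies that of every leaf below it. Absorbed into the
  -- formula, it turns the count below that position into an ordinary count for the argument.
  twist : ∀ {k} → Sg.Sign → LF k → LF k
  twist Sg.+ φ = φ
  twist Sg.- φ = invL φ

  evalL-twist : ∀ τ σ {k} (φ : LF k) e → evalL S (τ Sg.* σ) φ e ≡ evalL S σ (twist τ φ) e
  evalL-twist Sg.+ σ φ e = refl
  evalL-twist Sg.- σ φ e = evalL-inv σ φ e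

  renL : ∀ {a b} → Vec (Fin b) a → LF a → LF b
  renL v (lle i j) = lle (lookup v i) (lookup v j)
  renL v (lrel r xs) = lrel r (Vec.map (lookup v) xs)
  renL v (leq i j) = leq (lookup v i) (lookup v j)
  renL v (lnot φ) = lnot (renL v φ)
  renL v (land φ ψ) = land (renL v φ) (renL v ψ)
  renL v (lor φ ψ) = lor (renL v φ) (renL v ψ)
  renL v (lall φ) = lall (renL (zero ∷ Vec.map suc v) φ)
  renL v (lex φ) = lex (renL (zero ∷ Vec.map suc v) φ)

  map-lift : ∀ {a b} (v : Vec (Fin b) a) c (e : Vec (Fin n) b) →
    Vec.map (lookup (c ∷ e)) (zero ∷ Vec.map suc v) ≡ c ∷ Vec.map (lookup e) v
  map-lift v c e = cong (c ∷_) (sym (Vec.map-∘ (lookup (c ∷ e)) suc v))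

  evalL-ren : ∀ σ {a b} (v : Vec (Fin b) a) φ e → evalL S σ (renL v φ) e ≡ evalL S σ φ (Vec.map (lookup e) v)
  evalL-ren Sg.+ v (lle i j) e = cong₂ leI (sym (Vec.lookup-map i _ v)) (sym (Vec.lookup-map j _ v))
  evalL-ren Sg.- v (lle i j) e = cong₂ leI (sym (Vec.lookup-map j _ v)) (sym (Vec.lookup-map i _ v))
  evalL-ren σ v (lrel r xs) e = trans (evalL-rel σ r _ e) (trans (cong (relI r)
    (trans (sym (Vec.map-∘ (lookup e) (lookup v) xs)) (Vec.map-cong (λ i → sym (Vec.lookup-map i (lookup e) v)) xs)))
        (sym (evalL-rel σ r xs _)))
  evalL-ren σ v (leq i j) e = trans (evalL-eq σ _ _ e) (trans (cong₂ (λ x y → does (x Fin.≟ y))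
    (sym (Vec.lookup-map i (lookup e) v)) (sym (Vec.lookup-map j (lookup e) v))) (sym (evalL-eq σ i j _)))
  evalL-ren σ v (lnot φ) e = trans (evalL-not σ _ e) (trans (cong not (evalL-ren σ v φ e)) (sym (evalL-not σ φ _)))
  evalL-ren σ v (land φ ψ) e = trans (evalL-and σ _ _ e)
      (trans (cong₂ _∧_ (evalL-ren σ v φ e) (evalL-ren σ v ψ e)) (sym (evalL-and σ φ ψ _)))
  evalL-ren σ v (lor φ ψ) e = trans (evalL-or σ _ _ e)
      (trans (cong₂ _∨_ (evalL-ren σ v φ e) (evalL-ren σ v ψ e)) (sym (evalL-or σ φ ψ _)))
  evalL-ren σ v (lall φ) e = trans (evalL-all σ _ e) (trans (all-cong (allFin n)
    (λ c → trans (evalL-ren σ _ φ (c ∷ e)) (cong (evalL S σ φ) (map-lift v c e)))) (sym (evalL-all σ φ _)))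
  evalL-ren σ v (lex φ) e = trans (evalL-ex σ _ e) (trans (any-cong (allFin n)
    (λ c → trans (evalL-ren σ _ φ (c ∷ e)) (cong (evalL S σ φ) (map-lift v c e)))) (sym (evalL-ex σ φ _)))

  -- Counting below a constructor.

  rowsV : ∀ {k a} → Vec (Vec Tm a) k → (Fin a → Sg.Sign) → Vec Sh a → List (Row k)
  rowsV [] v ss = List.map (_, []) (signsV v ss)
  rowsV (us ∷ uss) v ss = zipRow (labsV us) (rowsV uss v ss)

  rows-app : ∀ {k} f (uss : Vec (Vec Tm (ar f)) k) ss → rows (Vec.map (app f) uss) (fS f ss) ≡ rowsV uss (var f) ss
  rows-app f [] ss = refl
  rows-app f (us ∷ uss) ss = cong (zipRow (labsV us)) (rows-app f uss ss)

  twistRow : ∀ {k} → Sg.Sign → Row k → Row k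
  twistRow τ (σ , e) = τ Sg.* σ , e

  zipRow-++ : ∀ {k} cs cs' (R R' : List (Row k)) → length cs ≡ length R → zipRow (cs ++ cs') (R ++ R')
      ≡ zipRow cs R ++ zipRow cs' R'
  zipRow-++ [] cs' [] R' p = refl
  zipRow-++ (c ∷ cs) cs' (r ∷ R) R' p = cong (consRow c r ∷_) (zipRow-++ cs cs' R R' (suc-injective p))

  zipRow-twist : ∀ {k} τ cs (R : List (Row k)) → zipRow cs (List.map (twistRow τ) R)
      ≡ List.map (twistRow τ) (zipRow cs R)
  zipRow-twist τ [] R = refl
  zipRow-twist τ (c ∷ cs) [] = refl
  zipRow-twist τ (c ∷ cs) (r ∷ R) = cong (_ ∷_) (zipRow-twist τ cs R)

  column : ∀ {k a} → Fin a → Vec (Vec Tm a) k → Vec Tm k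
  column i = Vec.map (λ us → lookup us i)

  shapeV-uncons : ∀ {k a s} {ss : Vec Sh a} (uss : Vec (Vec Tm (suc a)) k) → All (λ us → shapeV S us ≡ s ∷ ss) uss →
    All (λ t → shape S t ≡ s) (column zero uss) × All (λ us → shapeV S us ≡ ss) (Vec.map Vec.tail uss)
  shapeV-uncons [] [] = [] , []
  shapeV-uncons ((u ∷ us) ∷ uss) (refl ∷ ps) with shapeV-uncons uss ps
  ... | p , q = refl ∷ p , refl ∷ q

  rowsV-uncons : ∀ {k a} (uss : Vec (Vec Tm (suc a)) k) v s (ss : Vec Sh a) → All (λ us → shapeV S us ≡ s ∷ ss) uss →
    rowsV uss v (s ∷ ss) ≡ List.map (twistRow (v zero)) (rows (column zero uss) s) ++ rowsV (Vec.map Vec.tail uss)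
        (v ∘ suc) ss
  rowsV-uncons [] v s ss [] = trans (List.map-++ (_, []) (List.map (v zero Sg.*_) (signs s)) _)
    (cong (_++ List.map (_, []) (signsV (v ∘ suc) ss)) (trans (sym (List.map-∘ (signs s))) (List.map-∘ (signs s))))
  rowsV-uncons ((u ∷ us) ∷ uss) v s ss (refl ∷ ps) =
      trans (cong (zipRow (labs u ++ labsV us)) (rowsV-uncons uss v s ss ps))
    (trans (zipRow-++ (labs u) (labsV us) (List.map (twistRow (v zero)) (rows (column zero uss) s)) _ lengths)
      (cong (_++ _) (zipRow-twist (v zero) (labs u) (rows (column zero uss) s))))
    where
    lengths : length (labs u) ≡ length (List.map (twistRow (v zero)) (rows (column zero uss) s))
    lengths = trans (length-labs u)
        (sym (trans (List.length-map _ (rows (column zero uss) s))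
        (length-rows (column zero uss) s (proj₁ (shapeV-uncons uss ps)))))

  sumF : ∀ {a} → (Fin a → ℕ) → ℕ
  sumF {zero} g = 0
  sumF {suc a} g = g zero + sumF (g ∘ suc)

  sumF-cong : ∀ {a} {g h : Fin a → ℕ} → (∀ i → g i ≡ h i) → sumF g ≡ sumF h
  sumF-cong {zero} e = refl
  sumF-cong {suc a} e = cong₂ _+_ (e zero) (sumF-cong (e ∘ suc))

  rowsV-[] : ∀ {k} (uss : Vec (Vec Tm 0) k) v → rowsV uss v [] ≡ []
  rowsV-[] [] v = refl
  rowsV-[] ([] ∷ uss) v = refl

  cntR-rowsV : ∀ {k a} (ψ : LF k) (uss : Vec (Vec Tm a) k) v ss → All (λ us → shapeV S us ≡ ss) uss →
    cntR (evalR ψ) (rowsV uss v ss) ≡ sumF (λ i → cnt (twist (v i) ψ) (column i uss) (lookup ss i))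
  cntR-rowsV ψ uss v [] ps = cong (cntR (evalR ψ)) (rowsV-[] uss v)
  cntR-rowsV ψ uss v (s ∷ ss) ps = trans (cong (cntR (evalR ψ)) (rowsV-uncons uss v s ss ps))
    (trans (cntR-++ (evalR ψ) (List.map (twistRow (v zero)) (rows (column zero uss) s)) _) (cong₂ _+_
      (trans (cntR-map (evalR ψ) (twistRow (v zero)) (rows (column zero uss) s))
        (cntR-cong (rows (column zero uss) s) (λ r → evalL-twist (v zero) (proj₁ r) ψ (proj₂ r))))
      (trans (cntR-rowsV ψ (Vec.map Vec.tail uss) (v ∘ suc) ss (proj₂ (shapeV-uncons uss ps)))
        (sumF-cong (λ i → cong (λ c → cnt (twist (v (suc i)) ψ) c (lookup ss i)) (tail-column i uss))))))
    where
    tail-column : ∀ {k a} (i : Fin a) (uss : Vec (Vec Tm (suc a)) k) → column i (Vec.map Vec.tail uss)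
        ≡ column (suc i) uss
    tail-column i [] = refl
    tail-column i ((u ∷ us) ∷ uss) = cong (_ ∷_) (tail-column i uss)

  cnt-app : ∀ {k} f (ψ : LF k) (uss : Vec (Vec Tm (ar f)) k) ss → All (λ us → shapeV S us ≡ ss) uss →
    cnt ψ (Vec.map (app f) uss) (fS f ss) ≡ sumF (λ i → cnt (twist (var f i) ψ) (column i uss) (lookup ss i))
  cnt-app f ψ uss ss ps = trans (cong (cntR (evalR ψ)) (rows-app f uss ss)) (cntR-rowsV ψ uss (var f) ss ps)

  -- Eliminating one column of labels

  allV : ∀ p → List (Vec Bool p)
  allV zero = [] ∷ []
  allV (suc p) = List.map (true ∷_) (allV p) ++ List.map (false ∷_) (allV p)

  ∈-allV : ∀ {p} (v : Vec Bool p) → v ∈ allV p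
  ∈-allV [] = here refl
  ∈-allV (true ∷ v) = ∈-++⁺ˡ (∈-map⁺ (true ∷_) (∈-allV v))
  ∈-allV {suc p} (false ∷ v) = ∈-++⁺ʳ (List.map (true ∷_) (allV p)) (∈-map⁺ (false ∷_) (∈-allV v))

  all-true : ∀ {A : Set} (p : A → Bool) xs → (∀ x → Tr (p x)) → Tr (all p xs)
  all-true p [] h = refl
  all-true p (x ∷ xs) h rewrite h x = all-true p xs h

  any⁺ : ∀ {A : Set} (p : A → Bool) {x xs} → x ∈ xs → Tr (p x) → Tr (any p xs)
  any⁺ p (here refl) h rewrite h = refl
  any⁺ p {xs = y ∷ ys} (there i) h with p y
  ... | true = refl
  ... | false = any⁺ p i h

  any⁻ : ∀ {A : Set} (p : A → Bool) xs → Tr (any p xs) → Σ A λ x → x ∈ xs × Tr (p x)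
  any⁻ p (x ∷ xs) h with ∨-true (p x) h
  ... | inj₁ q = x , here refl , q
  ... | inj₂ q with any⁻ p xs q
  ...   | y , i , r = y , there i , r

  literal : ∀ {k} → Bool → LF k → LF k
  literal b θ = if b then θ else lnot θ

  -- `LForm` has no constant for truth; the empty conjunction is the sentence that everything equals
  -- itself, which holds over an empty carrier too.
  minterm : ∀ {k p} → Vec (LF k) p → Vec Bool p → LF k
  minterm [] [] = lall (leq zero zero)
  minterm (θ ∷ θs) (b ∷ bs) = land (literal b θ) (minterm θs bs)

  evalR-literal : ∀ {k} b (θ : LF k) r → evalR (literal b θ) r ≡ does (evalR θ r Bool.≟ b)
  evalR-literal true θ r with evalR θ r
  ... | true = refl
  ... | false = refl
  evalR-literal false θ r@(σ , e) rewrite evalL-not σ θ e with evalL S σ θ e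
  ... | true = refl
  ... | false = refl

  minterm⁺ : ∀ {k p} (θs : Vec (LF k) p) r → Tr (evalR (minterm θs (Vec.map (λ θ → evalR θ r) θs)) r)
  minterm⁺ [] (σ , e) = trans (evalL-all σ _ e) (all-true _ (allFin n) λ c →
    trans (evalL-eq σ zero zero (c ∷ e)) (does⁺ (c Fin.≟ c) refl))
  minterm⁺ (θ ∷ θs) r@(σ , e)
    rewrite evalL-and σ (literal (evalR θ r) θ) (minterm θs (Vec.map (λ θ → evalR θ r) θs)) e
    | evalR-literal (evalR θ r) θ r
    | does⁺ (evalR θ r Bool.≟ evalR θ r) refl = minterm⁺ θs r

  minterm⁻ : ∀ {k p} (θs : Vec (LF k) p) bs r → Tr (evalR (minterm θs bs) r) → Vec.map (λ θ → evalR θ r) θs ≡ bs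
  minterm⁻ [] [] r h = refl
  minterm⁻ (θ ∷ θs) (b ∷ bs) r@(σ , e) h rewrite evalL-and σ (literal b θ) (minterm θs bs) e
    with evalR (literal b θ) r in eq
  ... | true = cong₂ _∷_ (does⁻ (evalR θ r Bool.≟ b) (trans (sym (evalR-literal b θ r)) eq)) (minterm⁻ θs bs r h)

  -- A pair (j , v) under the formula ψ demands that "ψ holds on at least j rows" has truth value v.
  Constraint : ℕ → Set
  Constraint K = LF (suc K) × ℕ × Bool

  meets : ∀ {K p} → Vec (Constraint K) p → Vec ℕ p → Bool
  meets [] [] = true
  meets ((_ , j , v) ∷ cs) (w ∷ ws) = does ((j ≤ᵇ w) Bool.≟ v) ∧ meets cs ws

  bound : ∀ {K p} → Vec (Constraint K) p → ℕ
  bound [] = 0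
  bound ((_ , j , _) ∷ cs) = j ⊔ bound cs

  _⊕_ : ∀ {p} → Vec ℕ p → Vec ℕ p → Vec ℕ p
  _⊕_ = Vec.zipWith _+_

  𝟘 : ∀ {p} → Vec ℕ p
  𝟘 = Vec.replicate _ 0

  module Tally (p : ℕ) = Choice (_⊕_ {p}) 𝟘 (Vec.zipWith-assoc ℕ.+-assoc) (Vec.zipWith-comm ℕ.+-comm)
      (Vec.zipWith-identityˡ ℕ.+-identityˡ)

  mul-∷ : ∀ {p} a d (ds : Vec ℕ p) → Tally.mul (suc p) a (d ∷ ds) ≡ a * d ∷ Tally.mul p a ds
  mul-∷ zero d ds = refl
  mul-∷ (suc a) d ds = cong ((d ∷ ds) ⊕_) (mul-∷ a d ds)

  -- Either `d` is zero and its copies add nothing, or `a` copies of it already reach the bound `j`.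
  ≤ᵇ-absorb : ∀ {j a} d w → j ≤ a → (j ≤ᵇ a * d + w) ≡ (j ≤ᵇ suc a * d + w)
  ≤ᵇ-absorb {j} {a} zero w le = cong (λ x → j ≤ᵇ x + w) (trans (ℕ.*-zeroʳ a) (sym (ℕ.*-zeroʳ (suc a))))
  ≤ᵇ-absorb {j} {a} (suc d) w le = trans (≤ᵇ⁺ (enough a le)) (sym (≤ᵇ⁺ (enough (suc a) (ℕ.m≤n⇒m≤1+n le))))
    where
    enough : ∀ b → j ≤ b → j ≤ b * suc d + w
    enough b le = ≤-trans le (≤-trans (ℕ.m≤m*n b (suc d)) (ℕ.m≤m+n _ w))

  meets-saturated : ∀ {K p} (cs : Vec (Constraint K) p) → Tally.Saturated p (bound cs) (meets cs)
  meets-saturated {K} {p} cs = Tally.saturated λ d w → go cs d w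
    where
    go : ∀ {p} (cs : Vec (Constraint K) p) {a} d w → bound cs ≤ a →
      meets cs (Tally.mul p a d ⊕ w) ≡ meets cs (Tally.mul p (suc a) d ⊕ w)
    go [] {a} [] [] le with Tally.mul 0 a []
    ... | [] = refl
    go ((_ , j , v) ∷ cs) {a} (d ∷ ds) (w ∷ ws) le rewrite mul-∷ a d ds =
      cong₂ _∧_ (cong (λ b → does (b Bool.≟ v)) (≤ᵇ-absorb d w (≤-trans (ℕ.m≤m⊔n j _) le)))
                (go cs ds ws (≤-trans (ℕ.m≤n⊔m j _) le))

  pick : ∀ {X : Set} {N} → Vec X N → Vec Bool N → List X
  pick [] [] = []
  pick (x ∷ xs) (true ∷ bs) = x ∷ pick xs bs
  pick (x ∷ xs) (false ∷ bs) = pick xs bs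

  pick⁺ : ∀ {X : Set} (g : X → Bool) {x} xs → x ∈ xs → Tr (g x) →
      x ∈ pick (Vec.fromList xs) (Vec.map g (Vec.fromList xs))
  pick⁺ g (x ∷ xs) (here refl) h rewrite h = here refl
  pick⁺ g (y ∷ xs) (there i) h with g y
  ... | true = there (pick⁺ g xs i h)
  ... | false = pick⁺ g xs i h

  pick⁻ : ∀ {X : Set} (g : X → Bool) {x} xs → x ∈ pick (Vec.fromList xs) (Vec.map g (Vec.fromList xs)) → Tr (g x)
  pick⁻ g (y ∷ xs) i with g y in eq
  pick⁻ g (y ∷ xs) (here refl) | true = eq
  pick⁻ g (y ∷ xs) (there i) | true = pick⁻ g xs i
  ... | false = pick⁻ g xs i

  tally : ∀ {k p} → Vec (LF k) p → List (Row k) → Vec ℕ p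
  tally ψs R = Vec.map (λ ψ → cntR (evalR ψ) R) ψs

  bits : ∀ {k p} → Vec (LF k) p → Row k → Vec Bool p
  bits ψs r = Vec.map (λ ψ → evalR ψ r) ψs

  tally-[] : ∀ {k p} (ψs : Vec (LF k) p) → tally ψs [] ≡ 𝟘
  tally-[] [] = refl
  tally-[] (ψ ∷ ψs) = cong (0 ∷_) (tally-[] ψs)

  tally-∷ : ∀ {k p} (ψs : Vec (LF k) p) r R → tally ψs (r ∷ R) ≡ Vec.map bit (bits ψs r) ⊕ tally ψs R
  tally-∷ [] r R = refl
  tally-∷ (ψ ∷ ψs) r R = cong (_ ∷_) (tally-∷ ψs r R)

  -- The type of a row records which truth patterns of the ψs some label realises there.
  module Core {K p : ℕ} (cs : Vec (Constraint K) p) where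

    ψs : Vec (LF (suc K)) p
    ψs = Vec.map proj₁ cs

    N : ℕ
    N = length (allV p)

    αs : Vec (Vec Bool p) N
    αs = Vec.fromList (allV p)

    realise : Vec Bool p → LF K
    realise α = lex (minterm ψs α)

    type : Row K → Vec Bool N
    type r = Vec.map (λ α → evalR (realise α) r) αs

    -- A label raises the count of each constraint by 0 or 1. Only these vectors matter, and the
    -- type of a row determines which of them some label realises there.
    D : Vec Bool N → List (Vec ℕ p)
    D A = List.map (Vec.map bit) (pick αs A)

    open Tally p
    open Types (Vec.≡-dec Bool._≟_) D

    ∈-D⁺ : ∀ r c → Vec.map bit (bits ψs (consRow c r)) ∈ D (type r)
    ∈-D⁺ r@(σ , e) c = ∈-map⁺ (Vec.map bit)
        (pick⁺ (λ α → evalR (realise α) r) (allV p) (∈-allV (bits ψs (consRow c r)))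
      (trans (evalL-ex σ _ e) (any⁺ _ (∈-allFin c) (minterm⁺ ψs (consRow c r)))))

    ∈-D⁻ : ∀ r {d} → d ∈ D (type r) → Σ (Fin n) λ c → d ≡ Vec.map bit (bits ψs (consRow c r))
    ∈-D⁻ r@(σ , e) i with ∈-map⁻ (Vec.map bit) i
    ... | α , j , refl with any⁻ _ (allFin n)
        (trans (sym (evalL-ex σ _ e)) (pick⁻ (λ α → evalR (realise α) r) (allV p) j))
    ...   | c , _ , h = c , cong (Vec.map bit) (sym (minterm⁻ ψs α (consRow c r) h))

    labelled : List (Fin n) → List (Row K) → Vec ℕ p
    labelled ls L = tally ψs (zipRow ls L)

    choose-labels⁺ : ∀ ls L → length ls ≡ length L → Choose (List.map type L) (labelled ls L)
    choose-labels⁺ [] [] eq = subst (Choose []) (sym (tally-[] ψs)) []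
    choose-labels⁺ (c ∷ ls) (r ∷ L) eq = subst (Choose _) (sym (tally-∷ ψs (consRow c r) (zipRow ls L)))
      (∈-D⁺ r c ∷ choose-labels⁺ ls L (suc-injective eq))

    choose-labels⁻ : ∀ L {w} → Choose (List.map type L) w → Σ (List (Fin n)) λ ls → length ls ≡ length L × w
        ≡ labelled ls L
    choose-labels⁻ [] [] = [] , refl , sym (tally-[] ψs)
    choose-labels⁻ (r ∷ L) (i ∷ c) with ∈-D⁻ r i | choose-labels⁻ L c
    ... | l , refl | ls , eq , refl = l ∷ ls , cong suc eq , sym (tally-∷ ψs (consRow l r) (zipRow ls L))

    θs : Vec (LF K) N
    θs = Vec.map realise αs

    -- Types are definable by 𝒞-formulas in the remaining terms, so the number of rows of a given
    -- type is again a leaf count.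
    hasType : Vec Bool N → LF K
    hasType A = minterm θs A

    type-θs : ∀ r → Vec.map (λ θ → evalR θ r) θs ≡ type r
    type-θs r = sym (Vec.map-∘ (λ θ → evalR θ r) realise αs)

    evalR-hasType : ∀ A r → evalR (hasType A) r ≡ does (Vec.≡-dec Bool._≟_ (type r) A)
    evalR-hasType A r = Tr⇒≡
      (λ h → does⁺ (Vec.≡-dec Bool._≟_ (type r) A) (trans (sym (type-θs r)) (minterm⁻ θs A r h)))
      (λ h → subst (λ A → Tr (evalR (hasType A) r)) (trans (type-θs r) (does⁻ (Vec.≡-dec Bool._≟_ (type r) A) h))
          (minterm⁺ θs r))

    occ-type : ∀ A L → occ A (List.map type L) ≡ cntR (evalR (hasType A)) L
    occ-type A [] = refl
    occ-type A (r ∷ L) rewrite evalR-hasType A r with does (Vec.≡-dec Bool._≟_ (type r) A)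
    ... | true = cong suc (occ-type A L)
    ... | false = occ-type A L

    -- The rows involve the other terms only, so the labels of the missing column may be chosen
    -- independently from leaf to leaf; this makes the existence of the column an instance of
    -- `choosable`.
    coreF : BF (LF K × ℕ)
    coreF = bind (choosable (bound cs) (allV N) (meets cs)) (λ { (A , j) → atm (hasType A , j) })

    atLeast : List (Row K) → LF K × ℕ → Bool
    atLeast L (θ , j) = j ≤ᵇ cntR (evalR θ) L

    ev-coreF : ∀ L → ev (atLeast L) coreF
        ≡ ev (occᵇ (bound cs) (List.map type L)) (choosable (bound cs) (allV N) (meets cs))
    ev-coreF L = trans (ev-bind (choosable (bound cs) (allV N) (meets cs)) _)
      (ev-cong (choosable (bound cs) (allV N) (meets cs)) λ { (A , j) → cong (j ≤ᵇ_) (sym (occ-type A L)) })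

    allTyped : ∀ L → AllL (_∈ allV N) (List.map type L)
    allTyped L = LAll.tabulate λ {A} _ → ∈-allV A

    core⁻ : ∀ L → Tr (ev (atLeast L) coreF) → Σ (List (Fin n)) λ ls → length ls ≡ length L ×
        Tr (meets cs (labelled ls L))
    core⁻ L h with choosable⁻ (bound cs) (allV N) (meets cs) (List.map type L) (meets-saturated cs) (allTyped L)
        (trans (sym (ev-coreF L)) h)
    ... | w , c , x with choose-labels⁻ L c
    ...   | ls , eq , refl = ls , eq , x

    core⁺ : ∀ L ls → length ls ≡ length L → Tr (meets cs (labelled ls L)) → Tr (ev (atLeast L) coreF)
    core⁺ L ls eq x = trans (ev-coreF L)
      (choosable⁺ (bound cs) (allV N) (meets cs) (List.map type L) (meets-saturated cs) (allTyped L)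
          (choose-labels⁺ ls L eq) x)

  -- Expressions and atoms over outer and bound variables

  data Ex (L V : Set) : Set where
    vr   : V → Ex L V
    leaf : L → Ex L V
    node : (f : Fin m) → Vec (Ex L V) (ar f) → Ex L V

  Alg : Set → Set
  Alg A = (f : Fin m) → Vec A (ar f) → A

  module _ {L V A : Set} (alg : Alg A) (l : L → A) (v : V → A) where
    mutual
      eval : Ex L V → A
      eval (vr x) = v x
      eval (leaf a) = l a
      eval (node f es) = alg f (evalV es)

      evalV : ∀ {k} → Vec (Ex L V) k → Vec A k
      evalV [] = []
      evalV (e ∷ es) = eval e ∷ evalV es

    evalV-map : ∀ {k} (es : Vec (Ex L V) k) → evalV es ≡ Vec.map eval es
    evalV-map [] = refl
    evalV-map (e ∷ es) = cong (eval e ∷_) (evalV-map es)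

    lookup-evalV : ∀ {k} (es : Vec (Ex L V) k) i → lookup (evalV es) i ≡ eval (lookup es i)
    lookup-evalV es i = trans (cong (λ xs → lookup xs i) (evalV-map es)) (Vec.lookup-map i eval es)

  module _ {L V A B : Set} {alg : Alg A} {alg' : Alg B} {l : L → A} {l' : L → B} {v : V → A} {v' : V → B}
    (h : A → B) (h-alg : ∀ f as → h (alg f as) ≡ alg' f (Vec.map h as))
    (h-l : ∀ a → h (l a) ≡ l' a) (h-v : ∀ x → h (v x) ≡ v' x) where
    mutual
      -- Uniqueness of the fold; the substitution lemma `eval-sub` and the passage from terms to
      -- shapes are instances.
      fusion : ∀ e → h (eval alg l v e) ≡ eval alg' l' v' e
      fusion (vr x) = h-v x
      fusion (leaf a) = h-l a
      fusion (node f es) = trans (h-alg f _) (cong (alg' f) (fusionV es))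

      fusionV : ∀ {k} (es : Vec (Ex L V) k) → Vec.map h (evalV alg l v es) ≡ evalV alg' l' v' es
      fusionV [] = refl
      fusionV (e ∷ es) = cong₂ _∷_ (fusion e) (fusionV es)

  sub : {L L' V V' : Set} → (L → Ex L' V') → (V → Ex L' V') → Ex L V → Ex L' V'
  sub = eval node

  eval-sub : ∀ {L L' V V' A : Set} {alg : Alg A} {l : L → Ex L' V'} {v : V → Ex L' V'} {l'} {v'} {l″ : L → A}
      {v″ : V → A} →
    (∀ a → eval alg l' v' (l a) ≡ l″ a) → (∀ x → eval alg l' v' (v x) ≡ v″ x) →
    ∀ e → eval alg l' v' (sub l v e) ≡ eval alg l″ v″ e
  eval-sub {alg = alg} {l' = l'} {v'} = fusion (eval alg l' v') (λ f es → cong (alg f) (evalV-map alg l' v' es))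

  -- `to x p` is the subterm of the outer variable `x` reached by the total selectors along `p`.
  -- Outer variables keep their selectors; bound variables, which enter through `vr`, have none.
  data TL : Set where
    to  : ℕ → Pos → TL
    tcn : Fin n → TL

  -- An outer shape is the shape of a term variable (inj₁) or the value of a shape variable (inj₂).
  data SL : Set where
    so  : ℕ ⊎ ℕ → Pos → SL
    scn : SL

  TE SE : ℕ → Set
  TE q = Ex TL (Fin q)
  SE r = Ex SL (Fin r)

  outer : Env S → ℕ ⊎ ℕ → Sh
  outer ρ (inj₁ x) = shape S (tenv ρ x)
  outer ρ (inj₂ x) = senv ρ x

  leafT : Env S → TL → Tm
  leafT ρ (to x p) = navT (tenv ρ x) p
  leafT ρ (tcn c) = con c

  leafS : Env S → SL → Sh
  leafS ρ (so o p) = navS (outer ρ o) p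
  leafS ρ scn = cS

  valT : Env S → ∀ {q} → Vec Tm q → TE q → Tm
  valT ρ xs = eval app (leafT ρ) (lookup xs)

  valS : Env S → ∀ {r} → Vec Sh r → SE r → Sh
  valS ρ ss = eval fS (leafS ρ) (lookup ss)

  shLeaf : ∀ {r} → TL → SE r
  shLeaf (to x p) = leaf (so (inj₁ x) p)
  shLeaf (tcn c) = leaf scn

  shE : ∀ {r q} → Vec (Fin r) q → TE q → SE r
  shE τ = sub shLeaf (vr ∘ lookup τ)

  Coherent : ∀ {r q} → Vec (Fin r) q → Vec Sh r → Vec Tm q → Set
  Coherent τ ss xs = ∀ j → shape S (lookup xs j) ≡ lookup ss (lookup τ j)

  valS-shE : ∀ ρ {r q} {τ : Vec (Fin r) q} {ss xs} → Coherent τ ss xs → ∀ E → valS ρ ss (shE τ E)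
      ≡ shape S (valT ρ xs E)
  valS-shE ρ {τ = τ} {ss} {xs} coh E = trans (eval-sub leaves-ok (λ j → sym (coh j)) E)
    (sym (fusion (shape S) (λ f ts → cong (fS f) (shapeV-map ts)) (λ _ → refl) (λ _ → refl) E))
    where
    leaves-ok : ∀ a → valS ρ ss (shLeaf a) ≡ shape S (leafT ρ a)
    leaves-ok (to x p) = sym (shape-navT (tenv ρ x) p)
    leaves-ok (tcn c) = refl

  -- Atoms over r bound shapes and q bound terms: card demands that its arguments
  -- have one common shape, and size is the case without term arguments.
  data Atom (r q : ℕ) : Set where
    same : SE r → SE r → Atom r q
    size : LF 0 → SE r → ℕ → Atom r q
    card : ∀ {k} → LF (suc k) → Vec (TE q) (suc k) → ℕ → Atom r q

  SameShape : ∀ {k} → Vec Tm (suc k) → Set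
  SameShape ts = All (λ t → shape S t ≡ shape S (Vec.head ts)) ts

  Card : ∀ {k} → LF (suc k) → Vec Tm (suc k) → ℕ → Set
  Card ψ ts j = SameShape ts × j ≤ cnt ψ ts (shape S (Vec.head ts))

  card? : ∀ {k} (ψ : LF (suc k)) ts j → Dec (Card ψ ts j)
  card? ψ ts j = VAll.all? (λ t → shape S t ≟S shape S (Vec.head ts)) ts ×-dec (j ≤? cnt ψ ts (shape S (Vec.head ts)))

  valA : Env S → ∀ {r q} → Vec Sh r → Vec Tm q → Atom r q → Bool
  valA ρ ss xs (same a b) = does (valS ρ ss a ≟S valS ρ ss b)
  valA ρ ss xs (size ψ s j) = j ≤ᵇ cnt ψ [] (valS ρ ss s)
  valA ρ ss xs (card ψ Es j) = does (card? ψ (Vec.map (valT ρ xs) Es) j)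

  Card-cong : ∀ {k ψ ts ts' j} → ts ≡ ts' → Card {k} ψ ts j → Card ψ ts' j
  Card-cong refl c = c

  -- Reindexing of tuples.

  signs-rows : ∀ {k} (ts : Vec Tm k) s → All (λ t → shape S t ≡ s) ts → List.map proj₁ (rows ts s) ≡ signs s
  signs-rows [] s [] = trans (sym (List.map-∘ (signs s))) (List.map-id (signs s))
  signs-rows (t ∷ ts) s (p ∷ ps) = trans (go (labs t) (rows ts s) lens) (signs-rows ts s ps)
    where
    lens : length (labs t) ≡ length (rows ts s)
    lens = trans (length-labs t) (trans (cong (length ∘ signs) p) (sym (length-rows ts s ps)))
    go : ∀ {k} cs (R : List (Row k)) → length cs ≡ length R → List.map proj₁ (zipRow cs R) ≡ List.map proj₁ R
    go [] [] e = refl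
    go (c ∷ cs) (r ∷ R) e = cong (_ ∷_) (go cs R (suc-injective e))

  lookup-rows : ∀ {k} (ts : Vec Tm k) s → All (λ t → shape S t ≡ s) ts → ∀ i →
    labs (lookup ts i) ≡ List.map (λ r → lookup (proj₂ r) i) (rows ts s)
  lookup-rows (t ∷ ts) s (p ∷ ps) = go
    where
    lens : length (labs t) ≡ length (rows ts s)
    lens = trans (length-labs t) (trans (cong (length ∘ signs) p) (sym (length-rows ts s ps)))
    head-ok : ∀ {k} cs (R : List (Row k)) → length cs ≡ length R → cs
        ≡ List.map (λ r → lookup (proj₂ r) zero) (zipRow cs R)
    head-ok [] [] e = refl
    head-ok (c ∷ cs) (r ∷ R) e = cong (c ∷_) (head-ok cs R (suc-injective e))
    tail-ok : ∀ {k} cs (R : List (Row k)) i → length cs ≡ length R →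
      List.map (λ r → lookup (proj₂ r) i) R ≡ List.map (λ r → lookup (proj₂ r) (suc i)) (zipRow cs R)
    tail-ok [] [] i e = refl
    tail-ok (c ∷ cs) (r ∷ R) i e = cong (_ ∷_) (tail-ok cs R i (suc-injective e))
    go : ∀ i → labs (lookup (t ∷ ts) i) ≡ List.map (λ r → lookup (proj₂ r) i) (zipRow (labs t) (rows ts s))
    go zero = head-ok (labs t) (rows ts s) lens
    go (suc i) = trans (lookup-rows ts s ps i) (tail-ok (labs t) (rows ts s) i lens)

  reindex : ∀ {a b} → Vec (Fin b) a → Row b → Row a
  reindex is (σ , e) = σ , Vec.map (lookup e) is

  rows-reindex : ∀ {a b} (is : Vec (Fin b) a) (ts : Vec Tm b) s → All (λ t → shape S t ≡ s) ts →
    rows (Vec.map (lookup ts) is) s ≡ List.map (reindex is) (rows ts s)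
  rows-reindex [] ts s ps = trans (cong (List.map (_, [])) (sym (signs-rows ts s ps))) (sym (List.map-∘ (rows ts s)))
  rows-reindex (i ∷ is) ts s ps =
      trans (cong₂ zipRow (lookup-rows ts s ps i) (rows-reindex is ts s ps)) (go (rows ts s))
    where
    go : ∀ R → zipRow (List.map (λ r → lookup (proj₂ r) i) R) (List.map (reindex is) R)
        ≡ List.map (reindex (i ∷ is)) R
    go [] = refl
    go (r ∷ R) = cong (_ ∷_) (go R)

  cnt-ren : ∀ {a b} (is : Vec (Fin b) a) ψ (ts : Vec Tm b) s → All (λ t → shape S t ≡ s) ts →
    cnt (renL is ψ) ts s ≡ cnt ψ (Vec.map (lookup ts) is) s
  cnt-ren is ψ ts s ps = trans (cntR-cong (rows ts s) (λ r → evalL-ren (proj₁ r) is ψ (proj₂ r)))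
    (sym (trans (cong (cntR (evalR ψ)) (rows-reindex is ts s ps)) (cntR-map (evalR ψ) (reindex is) (rows ts s))))

  -- Occurrences of a bound variable.

  thin : ∀ {L q} → Fin (suc q) → Ex L (Fin q) → Ex L (Fin (suc q))
  thin i = sub leaf (vr ∘ punchIn i)

  data Occ {L q} (i : Fin (suc q)) : Ex L (Fin (suc q)) → Set where
    here  : Occ i (vr i)
    there : ∀ {f es} k → Occ i (lookup es k) → Occ i (node f es)

  mutual
    thin? : ∀ {L q} i (e : Ex L (Fin (suc q))) → (Σ (Ex L (Fin q)) λ e' → e ≡ thin i e') ⊎ Occ i e
    thin? i (vr j) with i Fin.≟ j
    ... | yes refl = inj₂ here
    ... | no ne = inj₁ (vr (punchOut ne) , cong vr (sym (punchIn-punchOut ne)))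
    thin? i (leaf a) = inj₁ (leaf a , refl)
    thin? i (node f es) with thinV? i es
    ... | inj₁ (es' , refl) = inj₁ (node f es' , refl)
    ... | inj₂ (k , o) = inj₂ (there k o)

    thinV? : ∀ {L q k} i (es : Vec (Ex L (Fin (suc q))) k) →
      (Σ (Vec (Ex L (Fin q)) k) λ es' → es ≡ evalV node leaf (vr ∘ punchIn i) es') ⊎
          (Σ (Fin k) λ j → Occ i (lookup es j))
    thinV? i [] = inj₁ ([] , refl)
    thinV? i (e ∷ es) with thin? i e | thinV? i es
    ... | inj₁ (e' , refl) | inj₁ (es' , refl) = inj₁ (e' ∷ es' , refl)
    ... | inj₂ o | _ = inj₂ (zero , o)
    ... | _ | inj₂ (k , o) = inj₂ (suc k , o)

  eval-thin : ∀ {L q A} {alg : Alg A} {l : L → A} (xs : Vec A q) i x e →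
    eval alg l (lookup (insertAt xs i x)) (thin i e) ≡ eval alg l (lookup xs) e
  eval-thin xs i x = eval-sub (λ _ → refl) (λ j → Vec.insertAt-punchIn xs i x j)

  -- Distributing a lower bound over the arguments of a constructor

  splitGe : ∀ {A : Set} {a} → (Fin a → ℕ → BF A) → ℕ → BF A
  splitGe {a = zero} g j = cst (j ≤ᵇ 0)
  splitGe {a = suc a} g j = some (upTo (suc j)) (λ i → and (g zero i) (splitGe (g ∘ suc) (j ∸ i)))

  module _ {A : Set} {e : A → Bool} where
    -- `g k i` may assert more than a lower bound. The side condition `P k` is recovered for every
    -- summand, including those whose share is zero; for cardinalities it is the equality of shapes.
    splitGe⁻ : ∀ {a} {g : Fin a → ℕ → BF A} {P : Fin a → Set} {c : Fin a → ℕ} {j} →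
      (∀ k i → Tr (ev e (g k i)) → P k × i ≤ c k) → Tr (ev e (splitGe g j)) → (∀ k → P k) × j ≤ sumF c
    splitGe⁻ {zero} h p = (λ ()) , ≤ᵇ⁻ p
    splitGe⁻ {suc a} {g} {j = j} h p with some⁻ {e = e} (upTo (suc j)) _ p
    ... | i , _ , q with and⁻ {e = e} (g zero i) (splitGe (g ∘ suc) (j ∸ i)) q
    ...   | q₁ , q₂ with h zero i q₁ | splitGe⁻ {g = g ∘ suc} (h ∘ suc) q₂
    ...     | p₀ , le₀ | ps , le = (λ { zero → p₀ ; (suc k) → ps k }) ,
              ≤-trans (ℕ.m≤n+m∸n j i) (ℕ.+-mono-≤ le₀ le)

    splitGe⁺ : ∀ {a} {g : Fin a → ℕ → BF A} {c : Fin a → ℕ} {j} →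
      (∀ k i → i ≤ c k → Tr (ev e (g k i))) → j ≤ sumF c → Tr (ev e (splitGe g j))
    splitGe⁺ {zero} h le = ≤ᵇ⁺ le
    splitGe⁺ {suc a} {g} {c} {j} h le = some⁺ {e = e} _ (∈-upTo⁺ (s≤s (ℕ.m⊓n≤m j (c zero))))
      (and⁺ {e = e} {g zero (j ⊓ c zero)} {splitGe (g ∘ suc) (j ∸ (j ⊓ c zero))} (h zero _ (ℕ.m⊓n≤n j (c zero)))
          (splitGe⁺ {g = g ∘ suc} (h ∘ suc) rest))
      where
      rest : j ∸ (j ⊓ c zero) ≤ sumF (c ∘ suc)
      rest with ℕ.≤-total j (c zero)
      ... | inj₁ q rewrite ℕ.m≤n⇒m⊓n≡m q | ℕ.n∸n≡0 j = z≤n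
      ... | inj₂ q rewrite ℕ.m≥n⇒m⊓n≡n q = ℕ.m≤n+o⇒m∸n≤o j (c zero) le

  lookup-ext : ∀ {A : Set} {k} {xs ys : Vec A k} → (∀ i → lookup xs i ≡ lookup ys i) → xs ≡ ys
  lookup-ext {xs = xs} {ys} h = trans (sym (Vec.tabulate∘lookup xs))
      (trans (Vec.tabulate-cong h) (Vec.tabulate∘lookup ys))

  all-lookup : ∀ {A : Set} {P : A → Set} {k} (xs : Vec A k) → (∀ i → P (lookup xs i)) → All P xs
  all-lookup [] h = []
  all-lookup (x ∷ xs) h = h zero ∷ all-lookup xs (h ∘ suc)

  all-at : ∀ {A : Set} {P : A → Set} {k} {xs : Vec A k} → All P xs → ∀ i → P (lookup xs i)
  all-at (p ∷ ps) zero = p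
  all-at (p ∷ ps) (suc i) = all-at ps i

  head-map : ∀ {A B : Set} {k} (g : A → B) (xs : Vec A (suc k)) → Vec.head (Vec.map g xs) ≡ g (Vec.head xs)
  head-map g (x ∷ xs) = refl

  module _ (f : Fin m) {k} (ψ : LF (suc k)) (uss : Vec (Vec Tm (ar f)) (suc k)) where
    colCount : Fin (ar f) → ℕ
    colCount i = cnt (twist (var f i) ψ) (column i uss) (shape S (Vec.head (column i uss)))

    head-column : ∀ i → Vec.head (column i uss) ≡ lookup (Vec.head uss) i
    head-column i = head-map _ uss

    head-apps : Vec.head (Vec.map (app {S} f) uss) ≡ app f (Vec.head uss)
    head-apps = head-map (app f) uss

    same-shapes : SameShape (Vec.map (app f) uss) → ∀ b → shapeV S (lookup uss b) ≡ shapeV S (Vec.head uss)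
    same-shapes p b = fS-injective (trans (cong (shape S) (sym (Vec.lookup-map b (app f) uss)))
      (trans (all-at p b) (cong (shape S) head-apps)))

    columns-count : (∀ b → shapeV S (lookup uss b) ≡ shapeV S (Vec.head uss)) →
      cnt ψ (Vec.map (app f) uss) (shape S (Vec.head (Vec.map (app f) uss))) ≡ sumF colCount
    columns-count eqs = trans (cong (cnt ψ (Vec.map (app f) uss)) (cong (shape S) head-apps))
      (trans (cnt-app f ψ uss (shapeV S (Vec.head uss)) (all-lookup uss eqs))
        (sumF-cong λ i → cong (cnt (twist (var f i) ψ) (column i uss))
          (trans (lookup-shapeV (Vec.head uss) i) (cong (shape S) (sym (head-column i))))))

    Card-app⁻ : ∀ {j} → Card ψ (Vec.map (app f) uss) j → (∀ i → SameShape (column i uss)) × j ≤ sumF colCount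
    Card-app⁻ (p , le) = (λ i → all-lookup (column i uss) (λ b → trans (cong (shape S) (Vec.lookup-map b _ uss))
        (trans (sym (lookup-shapeV (lookup uss b) i)) (trans (cong (λ v → lookup v i) (same-shapes p b))
          (trans (lookup-shapeV (Vec.head uss) i) (cong (shape S) (sym (head-column i)))))))) ,
      subst (_ ≤_) (columns-count (same-shapes p)) le

    Card-app⁺ : ∀ {j} → (∀ i → SameShape (column i uss)) → j ≤ sumF colCount → Card ψ (Vec.map (app f) uss) j
    Card-app⁺ ps le = all-lookup _ (λ b → trans (cong (shape S) (Vec.lookup-map b (app f) uss))
        (trans (cong (fS f) (eqs b)) (cong (shape S) (sym head-apps)))) ,
      subst (_ ≤_) (sym (columns-count eqs)) le
      where
      eqs : ∀ b → shapeV S (lookup uss b) ≡ shapeV S (Vec.head uss)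
      eqs b = lookup-ext λ i → trans (lookup-shapeV (lookup uss b) i)
          (trans (cong (shape S) (sym (Vec.lookup-map b _ uss)))
        (trans (all-at (ps i) b) (trans (cong (shape S) (head-column i)) (sym (lookup-shapeV (Vec.head uss) i)))))

  -- Surjectivity is essential: a component of `ts` not reached by `is` would not be forced to have
  -- the common shape.
  Card-ren⁺ : ∀ {a b} (is : Vec (Fin (suc b)) (suc a)) ψ ts {j} → (∀ i → Σ (Fin (suc a)) λ l → lookup is l ≡ i) →
    Card ψ (Vec.map (lookup ts) is) j → Card (renL is ψ) ts j
  Card-ren⁺ is ψ (t ∷ ts) {j} surj (p , le) = here-all ,
      subst (j ≤_) (trans (cong (cnt ψ (Vec.map (lookup (t ∷ ts)) is)) hd)
      (sym (cnt-ren is ψ (t ∷ ts) (shape S t) here-all))) le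
    where
    at-index : ∀ i → shape S (lookup (t ∷ ts) i) ≡ shape S (Vec.head (Vec.map (lookup (t ∷ ts)) is))
    at-index i with surj i
    ... | l , refl = trans (cong (shape S) (sym (Vec.lookup-map l _ is))) (all-at p l)
    hd : shape S (Vec.head (Vec.map (lookup (t ∷ ts)) is)) ≡ shape S t
    hd = sym (at-index zero)
    here-all : All (λ u → shape S u ≡ shape S t) (t ∷ ts)
    here-all = all-lookup (t ∷ ts) (λ i → trans (at-index i) hd)

  Card-ren⁻ : ∀ {a b} (is : Vec (Fin (suc b)) (suc a)) ψ ts {j} → Card (renL is ψ) ts j →
      Card ψ (Vec.map (lookup ts) is) j
  Card-ren⁻ is ψ (t ∷ ts) {j} (p , le) = all-lookup _ (λ l → trans (each l) (sym hd)) ,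
    subst (j ≤_) (trans (cnt-ren is ψ (t ∷ ts) (shape S t) p) (cong (cnt ψ (Vec.map (lookup (t ∷ ts)) is)) (sym hd)))
        le
    where
    each : ∀ l → shape S (lookup (Vec.map (lookup (t ∷ ts)) is) l) ≡ shape S t
    each l = trans (cong (shape S) (Vec.lookup-map l _ is)) (all-at p (lookup is l))
    hd : shape S (Vec.head (Vec.map (lookup (t ∷ ts)) is)) ≡ shape S t
    hd = trans (cong (shape S) (head-map (lookup (t ∷ ts)) is)) (all-at p (Vec.head is))

  -- Reducing cardinality constraints to the eliminated term itself

  maxV : ∀ {k} → Vec ℕ k → ℕ
  maxV = Vec.foldr′ _⊔_ 0

  lookup≤maxV : ∀ {k} (xs : Vec ℕ k) i → lookup xs i ≤ maxV xs
  lookup≤maxV (x ∷ xs) zero = ℕ.m≤m⊔n _ _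
  lookup≤maxV (x ∷ xs) (suc i) = ≤-trans (lookup≤maxV xs i) (ℕ.m≤n⊔m x _)

  depth : ∀ {L V} → Ex L V → ℕ
  depth = eval (λ _ hs → suc (maxV hs)) (λ _ → 0) (λ _ → 0)

  depth-lookup : ∀ {L V h f} (es : Vec (Ex L V) (ar f)) i → depth (node f es) ≤ suc h → depth (lookup es i) ≤ h
  depth-lookup es i (s≤s le) = ≤-trans
      (≤-trans (ℕ.≤-reflexive (sym (lookup-evalV _ _ _ es i))) (lookup≤maxV (evalV _ _ _ es) i)) le

  -- ca ψ Ts j is the atom card ψ (x ∷ Ts) j for the term x being eliminated.
  data CA (q : ℕ) : Set where
    ca : ∀ {k} → LF (suc k) → Vec (TE q) k → ℕ → CA q

  FA : ℕ → ℕ → Set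
  FA r q = Atom r q ⊎ CA q

  valCA : Env S → ∀ {q} → Vec Tm q → Tm → CA q → Bool
  valCA ρ xs x (ca ψ Ts j) = does (card? ψ (x ∷ Vec.map (valT ρ xs) Ts) j)

  valFA : Env S → ∀ {r q} → Vec Sh r → Vec Tm q → Tm → FA r q → Bool
  valFA ρ ss xs x (inj₁ a) = valA ρ ss xs a
  valFA ρ ss xs x (inj₂ c) = valCA ρ xs x c

  module Flatten {r q} (τ : Vec (Fin r) (suc q)) (i : Fin (suc q)) where

    Plain Inner : TE (suc q) → Set
    Plain E = (Σ (TE q) λ E' → E ≡ thin i E') ⊎ E ≡ vr i
    Inner E = Σ (Fin m) λ f → Σ (Vec (TE (suc q)) (ar f)) λ es → E ≡ node f es × Σ (Occ i E) λ o → thin? i E ≡ inj₂ o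

    plain? : ∀ E → Plain E ⊎ Inner E
    plain? E = decide (thin? i E) refl
      where
      decide : ∀ {E} t → thin? i E ≡ t → Plain E ⊎ Inner E
      decide (inj₁ p) eq = inj₁ (inj₁ p)
      decide (inj₂ here) eq = inj₁ (inj₂ refl)
      decide (inj₂ o@(there {f} {es} k _)) eq = inj₂ (f , es , refl , o , eq)

    scan : ∀ {k} (Es : Vec (TE (suc q)) k) → All Plain Es ⊎ Σ (Fin k) λ b → Inner (lookup Es b)
    scan [] = inj₁ []
    scan (E ∷ Es) with plain? E | scan Es
    ... | inj₁ p | inj₁ ps = inj₁ (p ∷ ps)
    ... | inj₂ o | _ = inj₂ (zero , o)
    ... | _ | inj₂ (b , o) = inj₂ (suc b , o)

    up : ∀ {k} → Fin (suc k) → Fin (suc (suc k))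
    up zero = zero
    up (suc j) = suc (suc j)

    kept : ∀ {k} {Es : Vec (TE (suc q)) k} → All Plain Es → ℕ
    kept [] = 0
    kept (inj₁ _ ∷ ps) = suc (kept ps)
    kept (inj₂ _ ∷ ps) = kept ps

    keptE : ∀ {k} {Es : Vec (TE (suc q)) k} (ps : All Plain Es) → Vec (TE q) (kept ps)
    keptE [] = []
    keptE (inj₁ (E' , _) ∷ ps) = E' ∷ keptE ps
    keptE (inj₂ _ ∷ ps) = keptE ps

    -- All occurrences of the eliminated term as an argument are merged into position `zero`; the
    -- other arguments follow in their order.
    index : ∀ {k} {Es : Vec (TE (suc q)) k} (ps : All Plain Es) → Vec (Fin (suc (kept ps))) k
    index [] = []
    index (inj₁ _ ∷ ps) = suc zero ∷ Vec.map up (index ps)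
    index (inj₂ _ ∷ ps) = zero ∷ index ps

    index-suc : ∀ {k} {Es : Vec (TE (suc q)) k} (ps : All Plain Es) j → Σ (Fin k) λ l → lookup (index ps) l ≡ suc j
    index-suc (inj₁ _ ∷ ps) zero = zero , refl
    index-suc (inj₁ _ ∷ ps) (suc j) with index-suc ps j
    ... | l , e = suc l , trans (Vec.lookup-map l up (index ps)) (cong up e)
    index-suc (inj₂ _ ∷ ps) j with index-suc ps j
    ... | l , e = suc l , e

    -- In the second case `index` hits `zero` and, by `index-suc`, is surjective, as `Card-ren⁺`
    -- demands. In the first case the atom does not involve the eliminated term at all.
    frees : ∀ {k} {Es : Vec (TE (suc q)) k} (ps : All Plain Es) →
      (Σ (Vec (TE q) k) λ Es' → Es ≡ Vec.map (thin i) Es') ⊎ (Σ (Fin k) λ l → lookup (index ps) l ≡ zero)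
    frees [] = inj₁ ([] , refl)
    frees (inj₂ _ ∷ ps) = inj₂ (zero , refl)
    frees (inj₁ (E' , refl) ∷ ps) with frees ps
    ... | inj₁ (Es' , refl) = inj₁ (E' ∷ Es' , refl)
    ... | inj₂ (l , e) = inj₂ (suc l , trans (Vec.lookup-map l up (index ps)) (cong up e))

    -- Meaningful only for expressions headed by `f`. The remaining values are arbitrary as long as
    -- they keep the depth small and satisfy the guards trivially.
    col : (f : Fin m) → Fin (ar f) → TE (suc q) → TE (suc q)
    col f k (vr j) = vr j
    col f k (leaf (to x p)) = leaf (to x (snoc p f k))
    col f k (leaf (tcn c)) = leaf (tcn c)
    col f k (node g es) with g Fin.≟ f
    ... | yes refl = lookup es k
    ... | no _ = vr i

    -- A bound variable is answered negatively although its value may well be headed by `f`. This is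
    -- where selectors on bound variables would arise, and where the guards are needed to exclude
    -- the case.
    headIs : (f : Fin m) → TE (suc q) → BF (FA r q)
    headIs f (vr j) = cst false
    headIs f (leaf (to x p)) = atm (inj₁
        (same (leaf (so (inj₁ x) p)) (node f (tabulate λ k → leaf (so (inj₁ x) (snoc p f k))))))
    headIs f (leaf (tcn c)) = cst false
    headIs f (node g es) = cst (does (g Fin.≟ f))

    heads : ∀ {k} → Fin m → Vec (TE (suc q)) k → BF (FA r q)
    heads f Es = every (allFin _) (λ b → headIs f (lookup Es b))

    -- If some argument is a node `f` with the eliminated term strictly inside, equality of shapes
    -- forces the head `f` on all arguments, and the count is distributed over the argument
    -- positions. The number `h` bounds the depth of the arguments, which drops at each descent.
    flat : ∀ {k} → ℕ → LF (suc k) → Vec (TE (suc q)) (suc k) → ℕ → BF (FA r q)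
    flat h ψ Es j with scan Es
    flat h ψ Es j | inj₁ ps with frees ps
    ... | inj₁ (Es' , _) = atm (inj₁ (card ψ Es' j))
    ... | inj₂ _ = atm (inj₂ (ca (renL (index ps) ψ) (keptE ps) j))
    -- Unreachable under the depth bound, since a node has depth at least one.
    flat zero ψ Es j | inj₂ _ = cst false
    flat (suc h) ψ Es j | inj₂ (_ , f , _) = and (heads f Es)
      (splitGe (λ k → flat h (twist (var f k) ψ) (Vec.map (col f k) Es)) j)

    -- An expression with the eliminated term strictly inside must not have the shape of any bound
    -- term, that term included. Only shapes are compared, so the condition survives the removal of
    -- the term.
    guardNode : TE (suc q) → BF (Atom r q)
    guardNode E with thin? i E
    ... | inj₁ _ = cst true
    ... | inj₂ _ = every (allFin (suc q)) (λ j → neg (atm (same (shE τ E) (vr (lookup τ j)))))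

    mutual
      guard : TE (suc q) → BF (Atom r q)
      guard (vr j) = cst true
      guard (leaf a) = cst true
      guard (node f es) = and (guardNode (node f es)) (guardV es)

      guardV : ∀ {k} → Vec (TE (suc q)) k → BF (Atom r q)
      guardV [] = cst true
      guardV (E ∷ Es) = and (guard E) (guardV Es)

    guardV⁻ : ∀ {e k} (Es : Vec (TE (suc q)) k) → Tr (ev e (guardV Es)) → ∀ b → Tr (ev e (guard (lookup Es b)))
    guardV⁻ {e} (E ∷ Es) p zero = proj₁ (and⁻ {e = e} (guard E) (guardV Es) p)
    guardV⁻ {e} (E ∷ Es) p (suc b) = guardV⁻ Es (proj₂ (and⁻ {e = e} (guard E) (guardV Es) p)) b

    guard-col : ∀ {e} f k E → Tr (ev e (guard E)) → Tr (ev e (guard (col f k E)))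
    guard-col f k (vr j) p = refl
    guard-col f k (leaf (to x p)) _ = refl
    guard-col f k (leaf (tcn c)) p = refl
    guard-col {e} f k (node g es) p with g Fin.≟ f
    ... | yes refl = guardV⁻ es (proj₂ (and⁻ {e = e} (guardNode (node g es)) (guardV es) p)) k
    ... | no _ = refl

    depth-col : ∀ {h} f k E → depth E ≤ suc h → depth (col f k E) ≤ h
    depth-col f k (vr j) le = z≤n
    depth-col f k (leaf (to x p)) le = z≤n
    depth-col f k (leaf (tcn c)) le = z≤n
    depth-col f k (node g es) le with g Fin.≟ f
    ... | yes refl = depth-lookup es k le
    ... | no _ = z≤n

    module _ (ρ : Env S) (ss : Vec Sh r) (xs : Vec Tm q) (x : Tm) (coh : Coherent τ ss (insertAt xs i x)) where

      ys : Vec Tm (suc q)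
      ys = insertAt xs i x

      vFA : FA r q → Bool
      vFA = valFA ρ ss xs x

      values : ∀ {k} {Es : Vec (TE (suc q)) k} (ps : All Plain Es) →
        Vec.map (valT ρ ys) Es ≡ Vec.map (lookup (x ∷ Vec.map (valT ρ xs) (keptE ps))) (index ps)
      values [] = refl
      values (inj₁ (E' , refl) ∷ ps) = cong₂ _∷_ (eval-thin xs i x E')
        (trans (values ps) (trans (Vec.map-cong up-ok (index ps)) (Vec.map-∘ _ up (index ps))))
        where
        up-ok : ∀ j → lookup (x ∷ Vec.map (valT ρ xs) (keptE ps)) j
            ≡ lookup (x ∷ valT ρ xs E' ∷ Vec.map (valT ρ xs) (keptE ps)) (up j)
        up-ok zero = refl
        up-ok (suc j) = refl
      values (inj₂ refl ∷ ps) = cong₂ _∷_ (Vec.insertAt-lookup xs i x) (values ps)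

      head-app : ∀ f E → Tr (ev vFA (headIs f E)) → valT ρ ys E ≡ app f (tabulate λ k → valT ρ ys (col f k E))
      head-app f (leaf (to y p)) h with shape≡fS (navT (tenv ρ y) p)
        (trans (shape-navT (tenv ρ y) p) (does⁻ (navS (outer ρ (inj₁ y)) p ≟S _) h))
      ... | ts , eq , _ = trans eq (cong (app f) (lookup-ext λ k → sym (trans (Vec.lookup∘tabulate _ k)
              (trans (navT-snoc (tenv ρ y) p f k) (trans (cong (selT f k) eq) (selT-app f k ts))))))
      head-app f (node g es) h with g Fin.≟ f
      ... | yes refl = cong (app f) (lookup-ext λ k → trans (lookup-evalV _ _ _ es k) (sym (Vec.lookup∘tabulate _ k)))

      -- Bound variables are the one kind of expression on which `headIs` may err, and the last
      -- hypothesis rules them out.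
      app-head : ∀ f ss' E → shape S (valT ρ ys E) ≡ fS f ss' → (∀ j → fS f ss' ≢ lookup ss (lookup τ j)) →
          Tr (ev vFA (headIs f E))
      app-head f ss' (vr j) eq ne = ⊥-elim (ne j (trans (sym eq) (coh j)))
      app-head f ss' (leaf (to y p)) eq ne with shape≡fS (navT (tenv ρ y) p) eq
      ... | ts , _ , refl = does⁺ (navS (outer ρ (inj₁ y)) p ≟S _) (trans (sym (shape-navT (tenv ρ y) p)) (trans eq
              (cong (fS f) (lookup-ext λ k → sym (trans (lookup-evalV _ _ _ (tabulate children) k)
                (trans (cong (valS ρ ss) (Vec.lookup∘tabulate children k)) (trans (navS-snoc (outer ρ (inj₁ y)) p f k)
                (trans (cong (selSh f k) (trans (sym (shape-navT (tenv ρ y) p)) eq)) (selSh-fS f k _)))))))))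
        where
        children : Fin (ar f) → SE r
        children k = leaf (so (inj₁ y) (snoc p f k))
      app-head f ss' (node g es) eq ne with g Fin.≟ f
      ... | yes refl = refl
      app-head f ss' (node .f es) refl ne | no ¬p = ⊥-elim (¬p refl)

      inner-not-var : ∀ {E f es} → E ≡ node f es → (Σ (Occ i E) λ o → thin? i E ≡ inj₂ o) →
          Tr (ev (valA ρ ss xs) (guard E)) →
        ∀ j → shape S (valT ρ ys E) ≢ lookup ss (lookup τ j)
      inner-not-var {f = f} {es} refl (o , eq) g j e with thin? i (node f es) | eq | proj₁
          (and⁻ {e = valA ρ ss xs} (guardNode (node f es)) (guardV es) g)
      ... | _ | refl | gn = neg⁻ {e = valA ρ ss xs} (atm (same (shE τ (node f es)) (vr (lookup τ j))))
              (every⁻ {e = valA ρ ss xs} (λ j → neg (atm (same (shE τ (node f es)) (vr (lookup τ j))))) gn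
                  (∈-allFin j))
              (does⁺ (valS ρ ss (shE τ (node f es)) ≟S lookup ss (lookup τ j))
                  (trans (valS-shE ρ {τ = τ} {ss} {ys} coh (node f es)) e))

      Good : ∀ {k} → ℕ → Vec (TE (suc q)) k → Set
      Good h Es = (∀ b → depth (lookup Es b) ≤ h) × (∀ b → Tr (ev (valA ρ ss xs) (guard (lookup Es b))))

      Good-col : ∀ {h k} f l (Es : Vec (TE (suc q)) k) → Good (suc h) Es → Good h (Vec.map (col f l) Es)
      Good-col {h} f l Es (d , g) = (λ b →
          subst (λ E → depth E ≤ h) (sym (Vec.lookup-map b (col f l) Es)) (depth-col f l (lookup Es b) (d b))) ,
        (λ b → subst (λ E → Tr (ev (valA ρ ss xs) (guard E))) (sym (Vec.lookup-map b (col f l) Es))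
            (guard-col f l (lookup Es b) (g b)))

      args : ∀ {k} (f : Fin m) → Vec (TE (suc q)) k → Vec (Vec Tm (ar f)) k
      args f = Vec.map (λ E → tabulate λ l → valT ρ ys (col f l E))

      column-args : ∀ {k} f l (Es : Vec (TE (suc q)) k) → column l (args f Es)
          ≡ Vec.map (valT ρ ys) (Vec.map (col f l) Es)
      column-args f l Es = trans (sym (Vec.map-∘ _ _ Es))
          (trans (Vec.map-cong (λ E → Vec.lookup∘tabulate _ l) Es) (Vec.map-∘ _ _ Es))

      apps : ∀ {k} f (Es : Vec (TE (suc q)) k) → (∀ b → Tr (ev vFA (headIs f (lookup Es b)))) →
        Vec.map (valT ρ ys) Es ≡ Vec.map (app f) (args f Es)
      apps f Es h = lookup-ext λ b → trans (Vec.lookup-map b _ Es) (trans (head-app f (lookup Es b) (h b))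
        (sym (trans (Vec.lookup-map b _ (args f Es)) (cong (app f) (Vec.lookup-map b _ Es)))))

      flat⁻ : ∀ {k} h ψ (Es : Vec (TE (suc q)) (suc k)) j → Good h Es →
        Tr (ev vFA (flat h ψ Es j)) → Card ψ (Vec.map (valT ρ ys) Es) j
      flat⁻ h ψ Es j good p with scan Es
      flat⁻ h ψ Es j good p | inj₁ ps with frees ps
      ... | inj₁ (Es' , refl) = Card-cong
          (trans (Vec.map-cong (λ E → sym (eval-thin xs i x E)) Es') (Vec.map-∘ _ _ Es')) (does⁻ (card? ψ _ j) p)
      ... | inj₂ _ = Card-cong (sym (values ps))
          (Card-ren⁻ (index ps) ψ (x ∷ Vec.map (valT ρ xs) (keptE ps)) (does⁻ (card? (renL (index ps) ψ) _ j) p))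
      flat⁻ (suc h) ψ Es j good p | inj₂ (b , f , _)
        with and⁻ {e = vFA} (heads f Es) (splitGe (λ k → flat h (twist (var f k) ψ) (Vec.map (col f k) Es)) j) p
      ... | hs , sp with splitGe⁻ {e = vFA} {P = λ l → SameShape (column l (args f Es))}
          {c = colCount f ψ (args f Es)} {j = j}
              (λ l j' p' → Card-cong (sym (column-args f l Es))
                  (flat⁻ h (twist (var f l) ψ) (Vec.map (col f l) Es) j' (Good-col f l Es good) p')) sp
      ...   | ss' , le = Card-cong (sym (apps f Es (λ b → every⁻ {e = vFA} _ hs (∈-allFin b))))
          (Card-app⁺ f ψ (args f Es) ss' le)

      -- The guards enter here: all arguments share the shape of the one containing the eliminated
      -- term strictly inside, which is the shape of no bound variable, so each argument passes
      -- `headIs`.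
      flat⁺ : ∀ {k} h ψ (Es : Vec (TE (suc q)) (suc k)) j → Good h Es →
        Card ψ (Vec.map (valT ρ ys) Es) j → Tr (ev vFA (flat h ψ Es j))
      flat⁺ h ψ Es j good c with scan Es
      flat⁺ h ψ Es j good c | inj₁ ps with frees ps
      ... | inj₁ (Es' , refl) = does⁺ (card? ψ _ j)
          (Card-cong (sym (trans (Vec.map-cong (λ E → sym (eval-thin xs i x E)) Es') (Vec.map-∘ _ _ Es'))) c)
      ... | inj₂ z = does⁺ (card? (renL (index ps) ψ) _ j)
          (Card-ren⁺ (index ps) ψ (x ∷ Vec.map (valT ρ xs) (keptE ps)) (λ { zero → z ; (suc l) → index-suc ps l })
          (Card-cong (values ps) c))
      flat⁺ zero ψ Es j (d , _) c | inj₂ (b , f , es , eq , _) with lookup Es b | d b | eq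
      ... | _ | () | refl
      flat⁺ (suc h) ψ Es j good c | inj₂ (b , f , es , eq , o) =
          and⁺ {e = vFA} {heads f Es} {splitGe (λ k → flat h (twist (var f k) ψ) (Vec.map (col f k) Es)) j}
          (every⁺ {e = vFA} (allFin _) _ (λ {b} _ → headed b))
          (splitGe⁺ {e = vFA} {c = colCount f ψ (args f Es)} {j = j}
              (λ l j' le → flat⁺ h (twist (var f l) ψ) (Vec.map (col f l) Es) j' (Good-col f l Es good)
            (Card-cong (column-args f l Es) (proj₁ cols l , le))) (proj₂ cols))
        where
        agree : ∀ b' → shape S (valT ρ ys (lookup Es b')) ≡ shape S (valT ρ ys (lookup Es b))
        agree b' = trans (cong (shape S) (sym (Vec.lookup-map b' _ Es))) (trans (all-at (proj₁ c) b')
          (trans (sym (all-at (proj₁ c) b)) (cong (shape S) (Vec.lookup-map b _ Es))))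
        shape-b : shape S (valT ρ ys (lookup Es b)) ≡ fS f (shapeV S (evalV app (leafT ρ) (lookup ys) es))
        shape-b = cong (shape S ∘ valT ρ ys) eq
        headed : ∀ b' → Tr (ev vFA (headIs f (lookup Es b')))
        headed b' = app-head f _ (lookup Es b') (trans (agree b') shape-b)
          (λ j e → inner-not-var eq o (proj₂ good b) j (trans shape-b e))
        cols = Card-app⁻ f ψ (args f Es) {j} (Card-cong (apps f Es headed) c)

  -- Eliminating a bound term

  CAs : ℕ → Set
  CAs q = List (CA q × Bool)

  module _ {r q : ℕ} where

    -- Every occurrence of a `ca`-atom is replaced by a guessed truth value, and the guess is
    -- recorded as a demand on the eliminated term. Occurrences are guessed separately;
    -- contradictory demands are harmless because no term meets them.
    guesses : BF (FA r q) → List (BF (Atom r q) × CAs q)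
    guesses (atm (inj₁ a)) = (atm a , []) ∷ []
    guesses (atm (inj₂ c)) = (cst true , (c , true) ∷ []) ∷ (cst false , (c , false) ∷ []) ∷ []
    guesses (cst b) = (cst b , []) ∷ []
    guesses (neg φ) = List.map (λ g → neg (proj₁ g) , proj₂ g) (guesses φ)
    guesses (and φ ψ) = List.cartesianProductWith (λ g h → and (proj₁ g) (proj₁ h) , proj₂ g ++ proj₂ h) (guesses φ)
        (guesses ψ)
    guesses (or φ ψ) = List.cartesianProductWith (λ g h → or (proj₁ g) (proj₁ h) , proj₂ g ++ proj₂ h) (guesses φ)
        (guesses ψ)

    module _ (e : FA r q → Bool) where

      Right : CAs q → Set
      Right = AllL (λ cv → e (inj₂ (proj₁ cv)) ≡ proj₂ cv)

      guesses-sound : ∀ φ {g} → g ∈ guesses φ → Right (proj₂ g) → ev e φ ≡ ev (e ∘ inj₁) (proj₁ g)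
      guesses-sound (atm (inj₁ a)) (here refl) rt = refl
      guesses-sound (atm (inj₂ c)) (here refl) (p LAll.∷ _) = p
      guesses-sound (atm (inj₂ c)) (there (here refl)) (p LAll.∷ _) = p
      guesses-sound (cst b) (here refl) rt = refl
      guesses-sound (neg φ) i rt with ∈-map⁻ _ i
      ... | g , j , refl = cong not (guesses-sound φ j rt)
      guesses-sound (and φ ψ) i rt with ∈-cartesianProductWith⁻ _ (guesses φ) (guesses ψ) i
      ... | g , h , j , k , refl = cong₂ _∧_ (guesses-sound φ j (LAll.++⁻ˡ (proj₂ g) rt))
          (guesses-sound ψ k (LAll.++⁻ʳ (proj₂ g) rt))
      guesses-sound (or φ ψ) i rt with ∈-cartesianProductWith⁻ _ (guesses φ) (guesses ψ) i
      ... | g , h , j , k , refl = cong₂ _∨_ (guesses-sound φ j (LAll.++⁻ˡ (proj₂ g) rt))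
          (guesses-sound ψ k (LAll.++⁻ʳ (proj₂ g) rt))

      guesses-complete : ∀ φ → Σ (BF (Atom r q) × CAs q) λ g → g ∈ guesses φ × Right (proj₂ g)
      guesses-complete (atm (inj₁ a)) = _ , here refl , LAll.[]
      guesses-complete (atm (inj₂ c)) with e (inj₂ c) in eq
      ... | true = _ , here refl , eq LAll.∷ LAll.[]
      ... | false = _ , there (here refl) , eq LAll.∷ LAll.[]
      guesses-complete (cst b) = _ , here refl , LAll.[]
      guesses-complete (neg φ) with guesses-complete φ
      ... | g , i , rt = _ , ∈-map⁺ _ i , rt
      guesses-complete (and φ ψ) with guesses-complete φ | guesses-complete ψ
      ... | g , i , rt | h , j , rt' = _ , ∈-cartesianProductWith⁺ _ i j , LAll.++⁺ rt rt'
      guesses-complete (or φ ψ) with guesses-complete φ | guesses-complete ψ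
      ... | g , i , rt | h , j , rt' = _ , ∈-cartesianProductWith⁺ _ i j , LAll.++⁺ rt rt'

  -- Two blocks of arguments are put side by side while both share the eliminated term as position
  -- `zero`.
  embˡ : ∀ k K → Vec (Fin (suc (k + K))) (suc k)
  embˡ k K = zero ∷ tabulate (λ b → suc (b ↑ˡ K))

  embʳ : ∀ k K → Vec (Fin (suc (k + K))) (suc K)
  embʳ k K = zero ∷ tabulate (λ b → suc (k ↑ʳ b))

  lookup-embˡ : ∀ {k K} (x : Tm) (us : Vec Tm k) (ts : Vec Tm K) → Vec.map (lookup (x ∷ us Vec.++ ts)) (embˡ k K)
      ≡ x ∷ us
  lookup-embˡ x us ts = cong (x ∷_) (lookup-ext λ b → trans (Vec.lookup-map b _ (tabulate _))
    (trans (cong (lookup (x ∷ us Vec.++ ts)) (Vec.lookup∘tabulate _ b)) (Vec.lookup-++ˡ us ts b)))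

  lookup-embʳ : ∀ {k K} (x : Tm) (us : Vec Tm k) (ts : Vec Tm K) → Vec.map (lookup (x ∷ us Vec.++ ts)) (embʳ k K)
      ≡ x ∷ ts
  lookup-embʳ x us ts = cong (x ∷_) (lookup-ext λ b → trans (Vec.lookup-map b _ (tabulate _))
    (trans (cong (lookup (x ∷ us Vec.++ ts)) (Vec.lookup∘tabulate _ b)) (Vec.lookup-++ʳ us ts b)))

  liftC : ∀ k {K} → Constraint K → Constraint (k + K)
  liftC k {K} (ψ , c) = renL (embʳ k K) ψ , c

  satisfies : ∀ {K p} → Vec (Constraint K) p → List (Row (suc K)) → Bool
  satisfies cs R = meets cs (tally (Vec.map proj₁ cs) R)

  satisfies-lift : ∀ {K p k} (cs : Vec (Constraint K) p) (x : Tm) (us : Vec Tm k) ts s →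
      All (λ t → shape S t ≡ s) (x ∷ us Vec.++ ts) →
    satisfies (Vec.map (liftC k) cs) (rows (x ∷ us Vec.++ ts) s) ≡ satisfies cs (rows (x ∷ ts) s)
  satisfies-lift [] x us ts s ps = refl
  satisfies-lift {k = k} ((ψ , j , v) ∷ cs) x us ts s ps = cong₂ _∧_
    (cong (λ w → does ((j ≤ᵇ w) Bool.≟ v))
        (trans (cnt-ren (embʳ k _) ψ (x ∷ us Vec.++ ts) s ps) (cong (λ ts → cnt ψ ts s) (lookup-embʳ x us ts))))
    (satisfies-lift cs x us ts s ps)

  module ElimCA {r q} (τ : Vec (Fin r) q) (s : Fin r) where

    shapesAre : ∀ {k} → Vec (TE q) k → BF (Atom r q)
    shapesAre {k} Ts = every (allFin k) (λ b → atm (same (shE τ (lookup Ts b)) (vr s)))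

    -- Without companions of the eliminated term the rows carry only variances, and the condition
    -- concerns the shape alone.
    coreAtom : ∀ {K} → Vec (TE q) K → LF K × ℕ → Atom r q
    coreAtom [] (θ , j) = size θ (vr s) j
    coreAtom T@(_ ∷ _) (θ , j) = card θ T j

    joined : ∀ {k K p} → LF (suc k) → ℕ → Bool → Vec (Constraint K) p → Vec (Constraint (k + K)) (suc p)
    joined {k} {K} ψ j v cs = (renL (embˡ k K) ψ , j , v) ∷ Vec.map (liftC k) cs

    -- All terms in T are known to have the shape of x; each ca-atom either has a
    -- mismatching shape, and is false, or joins T.
    elimCA : ∀ {K p} → Vec (TE q) K → Vec (Constraint K) p → CAs q → BF (Atom r q)
    elimCA T cs [] = bind (Core.coreF cs) (atm ∘ coreAtom T)
    elimCA {K} T cs ((ca {k} ψ Ts j , v) ∷ l) = or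
      (and (neg (shapesAre Ts)) (if v then cst false else elimCA T cs l))
      (and (shapesAre Ts) (elimCA (Ts Vec.++ T) (joined ψ j v cs) l))

    module _ (ρ : Env S) (ss : Vec Sh r) (xs : Vec Tm q) (coh : Coherent τ ss xs) where

      e : Atom r q → Bool
      e = valA ρ ss xs

      σ : Sh
      σ = lookup ss s

      vals : ∀ {k} → Vec (TE q) k → Vec Tm k
      vals = Vec.map (valT ρ xs)

      OfShape : ∀ {k} → Vec Tm k → Set
      OfShape = All (λ t → shape S t ≡ σ)

      shapesAre⁻ : ∀ {k} (Ts : Vec (TE q) k) → Tr (ev e (shapesAre Ts)) → OfShape (vals Ts)
      shapesAre⁻ Ts h = all-lookup (vals Ts) λ b → trans (cong (shape S) (Vec.lookup-map b _ Ts))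
        (trans (sym (valS-shE ρ {τ = τ} {ss} {xs} coh (lookup Ts b)))
          (does⁻ (valS ρ ss (shE τ (lookup Ts b)) ≟S σ)
              (every⁻ {e = e} (λ b → atm (same (shE τ (lookup Ts b)) (vr s))) h (∈-allFin b))))

      shapesAre⁺ : ∀ {k} (Ts : Vec (TE q) k) → OfShape (vals Ts) → Tr (ev e (shapesAre Ts))
      shapesAre⁺ Ts ps = every⁺ {e = e} (allFin _) _ λ {b} _ → does⁺ (valS ρ ss (shE τ (lookup Ts b)) ≟S σ)
        (trans (valS-shE ρ {τ = τ} {ss} {xs} coh (lookup Ts b))
            (trans (cong (shape S) (sym (Vec.lookup-map b _ Ts))) (all-at ps b)))

      card-OfShape : ∀ {k} (ψ : LF (suc k)) ts j → OfShape ts → does (card? ψ ts j) ≡ (j ≤ᵇ cnt ψ ts σ)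
      card-OfShape ψ (t ∷ ts) j (p ∷ ps) = Tr⇒≡
        (λ h → ≤ᵇ⁺ (subst (λ s → j ≤ cnt ψ (t ∷ ts) s) p (proj₂ (does⁻ (card? ψ (t ∷ ts) j) h))))
        (λ h → does⁺ (card? ψ (t ∷ ts) j)
            (VAll.map (λ e → trans e (sym p)) (p ∷ ps) , subst (λ s → j ≤ cnt ψ (t ∷ ts) s) (sym p) (≤ᵇ⁻ h)))

      core-ev : ∀ {K p} (T : Vec (TE q) K) (cs : Vec (Constraint K) p) → OfShape (vals T) →
        ev e (bind (Core.coreF cs) (atm ∘ coreAtom T)) ≡ ev (Core.atLeast cs (rows (vals T) σ)) (Core.coreF cs)
      core-ev T cs ps = trans (ev-bind (Core.coreF cs) (atm ∘ coreAtom T))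
          (ev-cong (Core.coreF cs) λ θj → one T θj ps)
        where
        one : ∀ {K} (T : Vec (TE q) K) θj → OfShape (vals T) → e (coreAtom T θj)
            ≡ (proj₂ θj ≤ᵇ cnt (proj₁ θj) (vals T) σ)
        one [] (θ , j) ps = refl
        one T@(_ ∷ _) (θ , j) ps = card-OfShape θ (vals T) j ps

      Solution : ∀ {K p} → Vec (TE q) K → Vec (Constraint K) p → CAs q → Tm → Set
      Solution T cs l x = shape S x ≡ σ × Tr (satisfies cs (rows (x ∷ vals T) σ)) ×
          AllL (λ cv → valCA ρ xs x (proj₁ cv) ≡ proj₂ cv) l

      add-shapes : ∀ {k K} (Ts : Vec (TE q) k) (T : Vec (TE q) K) → OfShape (vals Ts) → OfShape (vals T) →
          OfShape (vals (Ts Vec.++ T))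
      add-shapes Ts T ps ps' = subst OfShape (sym (Vec.map-++ (valT ρ xs) Ts T)) (go ps ps')
        where
        go : ∀ {k K} {us : Vec Tm k} {ts : Vec Tm K} → OfShape us → OfShape ts → OfShape (us Vec.++ ts)
        go [] qs = qs
        go (p ∷ ps) qs = p ∷ go ps qs

      added : ∀ {k K p} (Ts : Vec (TE q) k) (T : Vec (TE q) K) ψ j v (cs : Vec (Constraint K) p) x → shape S x ≡ σ →
        OfShape (vals Ts) → OfShape (vals T) →
        satisfies (joined ψ j v cs) (rows (x ∷ vals (Ts Vec.++ T)) σ)
          ≡ does (valCA ρ xs x (ca ψ Ts j) Bool.≟ v) ∧ satisfies cs (rows (x ∷ vals T) σ)
      added {k} {K} Ts T ψ j v cs x px ps ps' = cong₂ _∧_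
          (cong (λ b → does (b Bool.≟ v))
              (trans (cong (j ≤ᵇ_) (trans (cnt-ren (embˡ k K) ψ (x ∷ vals (Ts Vec.++ T)) σ (px ∷ shs))
              (cong (λ ts → cnt ψ ts σ) (trans (cong (λ us → Vec.map (lookup (x ∷ us)) (embˡ k K)) eq)
                  (lookup-embˡ x (vals Ts) (vals T))))))
            (sym (card-OfShape ψ (x ∷ vals Ts) j (px ∷ ps)))))
          (trans (cong (λ us → satisfies (Vec.map (liftC k) cs) (rows (x ∷ us) σ)) eq)
            (satisfies-lift cs x (vals Ts) (vals T) σ (px ∷ subst OfShape eq shs)))
        where
        shs = add-shapes Ts T ps ps'
        eq : vals (Ts Vec.++ T) ≡ vals Ts Vec.++ vals T
        eq = Vec.map-++ (valT ρ xs) Ts T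

      mismatch : ∀ {k} (ψ : LF (suc k)) Ts j x → shape S x ≡ σ → ¬ Tr (ev e (shapesAre Ts)) → valCA ρ xs x (ca ψ Ts j)
          ≡ false
      mismatch ψ Ts j x px ne = ¬Tr⇒false λ h → ne (shapesAre⁺ Ts (VAll.map (λ p → trans p px)
        (VAll.tail (proj₁ (does⁻ (card? ψ (x ∷ vals Ts) j) h)))))

      ∧⁻ : ∀ a {b} → Tr (a ∧ b) → Tr a × Tr b
      ∧⁻ true h = refl , h

      elimCA⁻ : ∀ {K p} (T : Vec (TE q) K) (cs : Vec (Constraint K) p) l → OfShape (vals T) →
        Tr (ev e (elimCA T cs l)) → Σ Tm (Solution T cs l)
      elimCA⁻ T cs [] ps h with Core.core⁻ cs (rows (vals T) σ) (trans (sym (core-ev T cs ps)) h)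
      ... | ls , len , ok with label σ ls (trans len (length-rows (vals T) σ ps))
      ...   | x , px , refl = x , px , ok , LAll.[]
      elimCA⁻ {K} T cs ((ca {k} ψ Ts j , v) ∷ l) ps h
        with or⁻ {e = e} (and (neg (shapesAre Ts)) (if v then cst false else elimCA T cs l))
            (and (shapesAre Ts) (elimCA (Ts Vec.++ T) (joined ψ j v cs) l)) h
      elimCA⁻ T cs ((ca ψ Ts j , v) ∷ l) ps h | inj₁ h' with and⁻ {e = e} (neg (shapesAre Ts))
          (if v then cst false else elimCA T cs l) h'
      elimCA⁻ T cs ((ca ψ Ts j , false) ∷ l) ps h | inj₁ h' | ne , h″ with elimCA⁻ T cs l ps h″
      ... | x , px , ok , rt = x , px , ok , mismatch ψ Ts j x px (neg⁻ {e = e} (shapesAre Ts) ne) LAll.∷ rt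
      elimCA⁻ {K} T cs ((ca {k} ψ Ts j , v) ∷ l) ps h | inj₂ h'
        with and⁻ {e = e} (shapesAre Ts) (elimCA (Ts Vec.++ T) (joined ψ j v cs) l) h'
      ... | sh , h″ with elimCA⁻ (Ts Vec.++ T) (joined ψ j v cs) l (add-shapes Ts T (shapesAre⁻ Ts sh) ps) h″
      ...   | x , px , ok , rt with ∧⁻ _ (trans (sym (added Ts T ψ j v cs x px (shapesAre⁻ Ts sh) ps)) ok)
      ...     | c , ok' = x , px , ok' , does⁻ (_ Bool.≟ v) c LAll.∷ rt

      elimCA⁺ : ∀ {K p} (T : Vec (TE q) K) (cs : Vec (Constraint K) p) l → OfShape (vals T) →
        ∀ x → Solution T cs l x → Tr (ev e (elimCA T cs l))
      elimCA⁺ T cs [] ps x (px , ok , _) = trans (core-ev T cs ps) (Core.core⁺ cs (rows (vals T) σ) (labs x)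
        (trans (length-labs x) (trans (cong (length ∘ signs) px) (sym (length-rows (vals T) σ ps)))) ok)
      elimCA⁺ {K} T cs ((ca {k} ψ Ts j , v) ∷ l) ps x (px , ok , c LAll.∷ rt) with ev e (shapesAre Ts) in eq
      ... | true = elimCA⁺ (Ts Vec.++ T) _ l (add-shapes Ts T (shapesAre⁻ Ts eq) ps) x (px ,
                trans (added Ts T ψ j v cs x px (shapesAre⁻ Ts eq) ps) (trans (cong (_∧ _) (does⁺ (_ Bool.≟ v) c)) ok)
                    , rt)
      ... | false with v
      ...   | true = ⊥-elim (false⇒¬Tr (mismatch ψ Ts j x px (false⇒¬Tr eq)) c)
      ...   | false = cong (_∨ false) (elimCA⁺ T cs l ps x (px , ok , rt))

  lookup-removeAt : ∀ {A : Set} {k} (xs : Vec A (suc k)) i j → lookup (removeAt xs i) j ≡ lookup xs (punchIn i j)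
  lookup-removeAt (x ∷ xs) zero j = refl
  lookup-removeAt (x ∷ y ∷ xs) (suc i) zero = refl
  lookup-removeAt (x ∷ y ∷ xs) (suc i) (suc j) = lookup-removeAt (y ∷ xs) i j

  argmax : ∀ {k} (hs : Vec ℕ (suc k)) → Σ (Fin (suc k)) λ i → ∀ j → lookup hs j ≤ lookup hs i
  argmax (h ∷ []) = zero , λ { zero → ≤-refl }
  argmax (h ∷ hs@(_ ∷ _)) with argmax hs
  ... | i , max with ℕ.≤-total h (lookup hs i)
  ...   | inj₁ le = suc i , λ { zero → le ; (suc j) → max j }
  ...   | inj₂ ge = zero , λ { zero → ≤-refl ; (suc j) → ≤-trans (max j) ge }

  Coherent-insert : ∀ {r q} (τ : Vec (Fin r) (suc q)) i {ss xs x} → Coherent (removeAt τ i) ss xs →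
    shape S x ≡ lookup ss (lookup τ i) → Coherent τ ss (insertAt xs i x)
  Coherent-insert τ i {ss} {xs} {x} coh px j with i Fin.≟ j
  ... | yes refl = trans (cong (shape S) (Vec.insertAt-lookup xs i x)) px
  ... | no ne = subst (λ j → shape S (lookup (insertAt xs i x) j) ≡ lookup ss (lookup τ j)) (punchIn-punchOut ne)
    (trans (cong (shape S) (Vec.insertAt-punchIn xs i x (punchOut ne)))
      (trans (coh (punchOut ne)) (cong (lookup ss) (lookup-removeAt τ i (punchOut ne)))))

  Coherent-remove : ∀ {r q} (τ : Vec (Fin r) (suc q)) i {ss xs} → Coherent τ ss xs →
      Coherent (removeAt τ i) ss (removeAt xs i)
  Coherent-remove τ i {ss} {xs} coh j = trans (cong (shape S) (lookup-removeAt xs i j))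
    (trans (coh (punchIn i j)) (cong (lookup ss) (sym (lookup-removeAt τ i j))))

  module _ {L : Set} {q} {i : Fin (suc q)} {l : L → Sh} {v : Fin (suc q) → Sh} where
    occ-height : ∀ {e : Ex L (Fin (suc q))} → Occ i e → height (v i) ≤ height (eval fS l v e)
    occ-height-node : ∀ {f} (es : Vec (Ex L (Fin (suc q))) (ar f)) k → Occ i (lookup es k) →
        height (v i) < height (eval fS l v (node f es))

    occ-height here = ≤-refl
    occ-height (there {f} {es} k o) = ℕ.<⇒≤ (occ-height-node es k o)

    occ-height-node es k o = s≤s (≤-trans (occ-height o)
        (≤-trans (ℕ.≤-reflexive (cong height (sym (lookup-evalV _ _ _ es k))))
      (height-lookup (evalV fS l v es) k)))

  module Elim1 {r q} (τ : Vec (Fin r) (suc q)) (i : Fin (suc q)) where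
    open Flatten τ i
    open ElimCA (removeAt τ i) (lookup τ i)

    flatAtom : Atom r (suc q) → BF (FA r q)
    flatAtom (same a b) = atm (inj₁ (same a b))
    flatAtom (size ψ a j) = atm (inj₁ (size ψ a j))
    flatAtom (card ψ Es j) = flat (maxV (Vec.map depth Es)) ψ Es j

    guardAtom : Atom r (suc q) → BF (Atom r q)
    guardAtom (card ψ Es j) = guardV Es
    guardAtom _ = cst true

    guards : BF (Atom r (suc q)) → BF (Atom r q)
    guards P = every (atoms P) guardAtom

    elim1 : BF (Atom r (suc q)) → BF (Atom r q)
    elim1 P = some (guesses (bind P flatAtom)) (λ g → and (proj₁ g) (elimCA [] [] (proj₂ g)))

    module _ (ρ : Env S) (ss : Vec Sh r) where

      flat-ev : ∀ P xs x → Coherent τ ss (insertAt xs i x) → Tr (ev (valA ρ ss xs) (guards P)) →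
        ev (valFA ρ ss xs x) (bind P flatAtom) ≡ ev (valA ρ ss (insertAt xs i x)) P
      flat-ev P xs x coh g = trans (ev-bind P flatAtom)
          (ev-cong-∈ P λ a a∈ → one a (every⁻ {e = valA ρ ss xs} guardAtom g a∈))
        where
        one : ∀ a → Tr (ev (valA ρ ss xs) (guardAtom a)) → ev (valFA ρ ss xs x) (flatAtom a)
            ≡ valA ρ ss (insertAt xs i x) a
        one (same a b) _ = refl
        one (size ψ a j) _ = refl
        one (card ψ Es j) g = Tr⇒≡
          (λ h → does⁺ (card? ψ (Vec.map (valT ρ (insertAt xs i x)) Es) j) (flat⁻ ρ ss xs x coh _ ψ Es j good h))
          (λ h → flat⁺ ρ ss xs x coh _ ψ Es j good (does⁻ (card? ψ (Vec.map (valT ρ (insertAt xs i x)) Es) j) h))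
          where
          good : Good ρ ss xs x coh (maxV (Vec.map depth Es)) Es
          good = (λ b → ≤-trans (ℕ.≤-reflexive (sym (Vec.lookup-map b depth Es))) (lookup≤maxV (Vec.map depth Es) b))
              , guardV⁻ Es g

      elim1⁻ : ∀ P xs → Coherent (removeAt τ i) ss xs → Tr (ev (valA ρ ss xs) (guards P)) →
          Tr (ev (valA ρ ss xs) (elim1 P)) →
        Σ Tm λ x → shape S x ≡ lookup ss (lookup τ i) × Tr (ev (valA ρ ss (insertAt xs i x)) P)
      elim1⁻ P xs coh g h with some⁻ {e = valA ρ ss xs} (guesses (bind P flatAtom)) _ h
      ... | (φ , l) , gu , h' with and⁻ {e = valA ρ ss xs} φ (elimCA [] [] l) h'
      ...   | hφ , hl with elimCA⁻ ρ ss xs coh [] [] l [] hl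
      ...     | x , px , _ , rt = x , px , trans (sym (flat-ev P xs x (Coherent-insert τ i {ss} {xs} coh px) g))
                  (trans (guesses-sound (valFA ρ ss xs x) (bind P flatAtom) gu rt) hφ)

      elim1⁺ : ∀ P xs x → Coherent τ ss (insertAt xs i x) → Coherent (removeAt τ i) ss xs →
          Tr (ev (valA ρ ss xs) (guards P)) →
        Tr (ev (valA ρ ss (insertAt xs i x)) P) → Tr (ev (valA ρ ss xs) (elim1 P))
      elim1⁺ P xs x coh coh' g h with guesses-complete (valFA ρ ss xs x) (bind P flatAtom)
      ... | (φ , l) , gu , rt = some⁺ {e = valA ρ ss xs} _ gu (and⁺ {e = valA ρ ss xs} {φ} {elimCA [] [] l}
          (trans (sym (guesses-sound (valFA ρ ss xs x) (bind P flatAtom) gu rt)) (trans (flat-ev P xs x coh g) h))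
          (elimCA⁺ ρ ss xs coh' [] [] l [] x
              (trans (cong (shape S) (sym (Vec.insertAt-lookup xs i x))) (coh i) , refl , rt)))

      occ-child : ∀ {f} (es : Vec (TE (suc q)) (ar f)) k → Occ i (lookup es k) →
        height (lookup ss (lookup τ i)) < height (valS ρ ss (shE τ (node f es)))
      occ-child {f} es k o = subst (height (lookup ss (lookup τ i)) <_)
        (cong height (sym (eval-sub {alg = fS} {shLeaf} {vr ∘ lookup τ} {leafS ρ} {lookup ss} (λ _ → refl)
            (λ _ → refl) (node f es))))
        (occ-height-node {l = valS ρ ss ∘ shLeaf} {v = lookup ss ∘ lookup τ} es k o)

      module _ (max : ∀ j → height (lookup ss (lookup τ j)) ≤ height (lookup ss (lookup τ i))) (xs : Vec Tm q) where
        mutual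
          guard-max : ∀ E → Tr (ev (valA ρ ss xs) (guard E))
          guard-max (vr j) = refl
          guard-max (leaf a) = refl
          guard-max (node f es) = and⁺ {e = valA ρ ss xs} {guardNode (node f es)} {guardV es} (guardNode-max f es)
              (guardV-max es)

          guardV-max : ∀ {k} (Es : Vec (TE (suc q)) k) → Tr (ev (valA ρ ss xs) (guardV Es))
          guardV-max [] = refl
          guardV-max (E ∷ Es) = and⁺ {e = valA ρ ss xs} {guard E} {guardV Es} (guard-max E) (guardV-max Es)

          -- A node with the variable strictly inside is higher than the variable, hence higher than
          -- every bound variable when this one has maximal height.
          guardNode-max : ∀ f es → Tr (ev (valA ρ ss xs) (guardNode (node f es)))
          guardNode-max f es with thin? i (node f es)
          ... | inj₁ _ = refl
          ... | inj₂ (there k o) = every⁺ {e = valA ρ ss xs} (allFin (suc q)) _ λ {j} _ →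
              neg⁺ {e = valA ρ ss xs} (atm (same (shE τ (node f es)) (vr (lookup τ j))))
                  λ h → ℕ.<⇒≱ (occ-child es k o) (≤-trans
                      (ℕ.≤-reflexive (cong height (does⁻ (valS ρ ss (shE τ (node f es)) ≟S lookup ss (lookup τ j))
                      h))) (max j))

        guards-max : ∀ P → Tr (ev (valA ρ ss xs) (guards P))
        guards-max P = every⁺ {e = valA ρ ss xs} (atoms P) guardAtom λ {a} _ → one a
          where
          one : ∀ a → Tr (ev (valA ρ ss xs) (guardAtom a))
          one (same _ _) = refl
          one (size _ _ _) = refl
          one (card ψ Es j) = guardV-max Es

  -- A variable of maximal height is eliminated first: no term built from it can
  -- have the shape of another bound variable, so no selectors on bound variables arise.
  elimT : ∀ {r} q → Vec (Fin r) q → BF (Atom r q) → BF (Atom r 0)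
  elimT zero τ P = P
  elimT (suc q) τ P = some (allFin (suc q)) λ i →
      elimT q (removeAt τ i) (and (Elim1.guards τ i P) (Elim1.elim1 τ i P))

  module _ (ρ : Env S) {r} (ss : Vec Sh r) where

    elimT⁻ : ∀ q (τ : Vec (Fin r) q) P → Tr (ev (valA ρ ss []) (elimT q τ P)) →
      Σ (Vec Tm q) λ xs → Coherent τ ss xs × Tr (ev (valA ρ ss xs) P)
    elimT⁻ zero τ P h = [] , (λ ()) , h
    elimT⁻ (suc q) τ P h with some⁻ {e = valA ρ ss []} (allFin (suc q)) _ h
    ... | i , _ , h' with elimT⁻ q (removeAt τ i) (and (Elim1.guards τ i P) (Elim1.elim1 τ i P)) h'
    ...   | xs , coh , h″ with and⁻ {e = valA ρ ss xs} (Elim1.guards τ i P) (Elim1.elim1 τ i P) h″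
    ...     | g , h‴ with Elim1.elim1⁻ τ i ρ ss P xs coh g h‴
    ...       | x , px , p = insertAt xs i x , Coherent-insert τ i {ss} {xs} coh px , p

    elimT⁺ : ∀ q (τ : Vec (Fin r) q) P xs → Coherent τ ss xs → Tr (ev (valA ρ ss xs) P) →
        Tr (ev (valA ρ ss []) (elimT q τ P))
    elimT⁺ zero τ P [] coh h = h
    elimT⁺ (suc q) τ P ys coh h with argmax (Vec.map (height ∘ lookup ss) τ)
    ... | i , max = some⁺ {e = valA ρ ss []} _ (∈-allFin i) (elimT⁺ q (removeAt τ i) _ xs coh'
          (and⁺ {e = valA ρ ss xs} {Elim1.guards τ i P} {Elim1.elim1 τ i P} g
            (Elim1.elim1⁺ τ i ρ ss P xs (lookup ys i) (subst (Coherent τ ss) (sym back) coh) coh' g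
              (subst (λ ys → Tr (ev (valA ρ ss ys) P)) (sym back) h))))
      where
      xs = removeAt ys i
      back : insertAt xs i (lookup ys i) ≡ ys
      back = Vec.insertAt-removeAt ys i
      coh' : Coherent (removeAt τ i) ss xs
      coh' = Coherent-remove τ i {ss} {ys} coh
      g = Elim1.guards-max τ i ρ ss (λ j → subst₂ _≤_ (Vec.lookup-map j _ τ) (Vec.lookup-map i _ τ) (max j)) xs P

  -- Finite sets of sample shapes

  tuples : ∀ {A : Set} → List A → ∀ k → List (Vec A k)
  tuples L zero = [] ∷ []
  tuples L (suc k) = List.cartesianProductWith _∷_ L (tuples L k)

  ∈-tuples⁺ : ∀ {A : Set} {L : List A} {k} (xs : Vec A k) → (∀ i → lookup xs i ∈ L) → xs ∈ tuples L k
  ∈-tuples⁺ [] h = here refl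
  ∈-tuples⁺ (x ∷ xs) h = ∈-cartesianProductWith⁺ _∷_ (h zero) (∈-tuples⁺ xs (h ∘ suc))

  ∈-tuples⁻ : ∀ {A : Set} {L : List A} {k} (xs : Vec A k) → xs ∈ tuples L k → ∀ i → lookup xs i ∈ L
  ∈-tuples⁻ {L = L} {suc k} xs m i with ∈-cartesianProductWith⁻ _∷_ L (tuples L k) m
  ∈-tuples⁻ xs m zero | x , ys , p , q , refl = p
  ∈-tuples⁻ xs m (suc i) | x , ys , p , q , refl = ∈-tuples⁻ ys q i

  unique-length : ∀ {A : Set} {xs ys : List A} → Unique xs → (∀ {x} → x ∈ xs → x ∈ ys) → length xs ≤ length ys
  unique-length {xs = []} u h = z≤n
  unique-length {xs = x ∷ xs} (x∉ ∷ u) h with ∈-∃++ (h (here refl))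
  ... | as , bs , refl = ≤-trans (s≤s (unique-length u λ {y} i → skip as (h (there i)) (LAll.lookup x∉ i ∘ sym)))
      (ℕ.≤-reflexive (trans (cong suc (List.length-++ as))
          (trans (sym (ℕ.+-suc (length as) (length bs))) (sym (List.length-++ as)))))
    where
    skip : ∀ as {y bs} → y ∈ as ++ x ∷ bs → y ≢ x → y ∈ as ++ bs
    skip [] (here e) ne = ⊥-elim (ne e)
    skip [] (there i) ne = i
    skip (a ∷ as) (here e) ne = here e
    skip (a ∷ as) (there i) ne = there (skip as i ne)

  unique-full : ∀ {A : Set} (_≟_ : DecidableEquality A) {xs ys : List A} → Unique xs → (∀ {x} → x ∈ xs → x ∈ ys) →
    length ys ≤ length xs → ∀ {y} → y ∈ ys → y ∈ xs
  unique-full _≟_ {xs} u h le {y} i with DecMembership._∈?_ _≟_ y xs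
  ... | yes p = p
  ... | no ∉ = ⊥-elim (ℕ.<⇒≱ (unique-length (LAll.tabulate (λ j e → ∉ (subst (_∈ xs) (sym e) j)) ∷ u)
      (λ { (here refl) → i ; (there j) → h j })) le)

  -- Each step without equality raises `f` by at least one, so the initial gap to `B` bounds the
  -- search.
  stabilises : ∀ (f : ℕ → ℕ) B → (∀ h → f h ≤ f (suc h)) → (∀ h → f h ≤ B) → Σ ℕ λ h → f (suc h) ≡ f h
  stabilises f B mono bd = search B 0 (ℕ.m≤n+m B (f 0))
    where
    search : ∀ k h → B ≤ f h + k → Σ ℕ λ h → f (suc h) ≡ f h
    search k h le with f (suc h) Data.Nat.≟ f h
    ... | yes e = h , e
    search zero h le | no ne = ⊥-elim
        (ne (ℕ.≤-antisym (≤-trans (bd (suc h)) (≤-trans le (ℕ.≤-reflexive (ℕ.+-identityʳ (f h))))) (mono h)))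
    search (suc k) h le | no ne = search k (suc h)
        (≤-trans le (≤-trans (ℕ.≤-reflexive (ℕ.+-suc (f h) k)) (ℕ.+-monoˡ-≤ k (ℕ.≤∧≢⇒< (mono h) (ne ∘ sym)))))

  sum-mono : ∀ {A : Set} (f g : A → ℕ) xs → (∀ x → f x ≤ g x) → sum (List.map f xs) ≤ sum (List.map g xs)
  sum-mono f g [] h = z≤n
  sum-mono f g (x ∷ xs) h = ℕ.+-mono-≤ (h x) (sum-mono f g xs h)

  sum-tight : ∀ {A : Set} (f g : A → ℕ) xs → (∀ x → f x ≤ g x) → sum (List.map g xs) ≡ sum (List.map f xs) → ∀ {x} →
      x ∈ xs → g x ≡ f x
  sum-tight f g (x ∷ xs) h e (here refl) = ℕ.≤-antisym
    (ℕ.+-cancelʳ-≤ (sum (List.map f xs)) (g x) (f x)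
        (≤-trans (ℕ.+-monoʳ-≤ (g x) (sum-mono f g xs h)) (ℕ.≤-reflexive e))) (h x)
  sum-tight f g (x ∷ xs) h e (there i) = sum-tight f g xs h (ℕ.≤-antisym
    (ℕ.+-cancelˡ-≤ (f x) _ _ (≤-trans (ℕ.+-monoˡ-≤ _ (h x)) (ℕ.≤-reflexive e))) (sum-mono f g xs h)) i

  all-or-some : ∀ {k} {A B : Fin k → Set} → (∀ i → A i ⊎ B i) → (∀ i → A i) ⊎ Σ (Fin k) B
  all-or-some {zero} h = inj₁ λ ()
  all-or-some {suc k} h with h zero | all-or-some (h ∘ suc)
  ... | inj₂ b | _ = inj₂ (zero , b)
  ... | inj₁ a | inj₂ (i , b) = inj₂ (suc i , b)
  ... | inj₁ a | inj₁ as = inj₁ λ { zero → a ; (suc i) → as i }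

  -- A finite set of shapes in which every class of a finite congruence is either
  -- completely listed or has more than M members: once the numbers of members
  -- found up to height h, truncated at M + 1, agree with those up to height h + 1,
  -- they never grow again.
  module Ground {Q : Set} (_≟Q_ : DecidableEquality Q) (Qs : List Q) (∈-Qs : ∀ q → q ∈ Qs) (c : Sh → Q)
    (c-hom : ∀ f ss us → (∀ i → c (lookup ss i) ≡ c (lookup us i)) → c (fS f ss) ≡ c (fS f us)) (M : ℕ) where

    -- The shapes of height below the given number, possibly listed with repetitions.
    layer : ℕ → List Sh
    layer zero = []
    layer (suc h) = cS ∷ concatMap (λ f → List.map (fS f) (tuples (layer h) (ar f))) (allFin m)

    layer-fS⁺ : ∀ {h} f ss → (∀ i → lookup ss i ∈ layer h) → fS f ss ∈ layer (suc h)
    layer-fS⁺ {h} f ss p = there (∈-concatMap⁺ (λ f → List.map (fS f) (tuples (layer h) (ar f)))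
      (lose (∈-allFin f) (∈-map⁺ (fS f) (∈-tuples⁺ ss p))))

    layer-fS⁻ : ∀ {h} f ss → fS f ss ∈ layer (suc h) → ∀ i → lookup ss i ∈ layer h
    layer-fS⁻ {h} f ss (there m) with Any.satisfied
        (∈-concatMap⁻ (λ f → List.map (fS f) (tuples (layer h) (ar f))) {xs = allFin _} m)
    ... | g , m' with ∈-map⁻ (fS g) m'
    ...   | .ss , m″ , refl = ∈-tuples⁻ ss m″

    layer-mono : ∀ h {s} → s ∈ layer h → s ∈ layer (suc h)
    layer-mono (suc h) {cS} i = here refl
    layer-mono (suc h) {fS f ss} i = layer-fS⁺ f ss λ k → layer-mono h (layer-fS⁻ f ss i k)

    members : ℕ → Q → List Sh
    members h q = filter (λ s → c s ≟Q q) (deduplicate _≟S_ (layer h))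

    members-unique : ∀ h q → Unique (members h q)
    members-unique h q = Unique.filter⁺ (λ s → c s ≟Q q) (Unique.deduplicate-! _≟S_ (layer h))

    ∈-members⁺ : ∀ {h q s} → s ∈ layer h → c s ≡ q → s ∈ members h q
    ∈-members⁺ i e = ∈-filter⁺ _ (∈-deduplicate⁺ _≟S_ i) e

    ∈-members⁻ : ∀ {h q s} → s ∈ members h q → s ∈ layer h × c s ≡ q
    ∈-members⁻ {h} {q} i with ∈-filter⁻ (λ s → c s ≟Q q) i
    ... | j , e = ∈-deduplicate⁻ _≟S_ (layer h) j , e

    members-mono : ∀ h q {s} → s ∈ members h q → s ∈ members (suc h) q
    members-mono h q i with ∈-members⁻ {h} i
    ... | j , e = ∈-members⁺ {suc h} (layer-mono h j) e

    found : ℕ → Q → ℕ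
    found h q = length (members h q) ⊓ suc M

    found-mono : ∀ h q → found h q ≤ found (suc h) q
    found-mono h q = ℕ.⊓-monoˡ-≤ (suc M) (unique-length (members-unique h q) (members-mono h q))

    total : ℕ → ℕ
    total h = sum (List.map (found h) Qs)

    abstract
      settled : Σ ℕ λ h → total (suc h) ≡ total h
      settled = stabilises total _ (λ h → sum-mono (found h) (found (suc h)) Qs (found-mono h))
        (λ h → sum-mono (found h) (λ _ → suc M) Qs (λ q → ℕ.m⊓n≤n _ (suc M)))

    H : ℕ
    H = proj₁ settled

    found-stable : ∀ q → found (suc H) q ≡ found H q
    found-stable q = sum-tight (found H) (found (suc H)) Qs (found-mono H) (proj₂ settled) (∈-Qs q)

    Rich : ℕ → Q → Set
    Rich h q = M < length (members h q)

    -- Richness means that the truncated number has reached its cap `suc M`, and the truncated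
    -- numbers at `H` and `suc H` agree.
    rich-down : ∀ {q} → Rich (suc H) q → Rich H q
    rich-down {q} r = ℕ.≤-trans (ℕ.≤-reflexive (trans (sym (ℕ.m≥n⇒m⊓n≡n r)) (found-stable q)))
        (ℕ.m⊓n≤m (length (members H q)) (suc M))

    -- Below the cap truncation is invisible: equal numbers then say that passing from `H` to
    -- `suc H` found no new member of the class.
    poor-down : ∀ {s} → ¬ Rich (suc H) (c s) → s ∈ layer (suc H) → s ∈ layer H
    poor-down {s} ¬r i = proj₁ (∈-members⁻ {H}
        (unique-full _≟S_ (members-unique H (c s)) (members-mono H (c s)) le (∈-members⁺ {suc H} i refl)))
      where
      le : length (members (suc H) (c s)) ≤ length (members H (c s))
      le = ≤-trans (ℕ.≤-reflexive (trans (sym (ℕ.m≤n⇒m⊓n≡m (ℕ.m≤n⇒m≤1+n (ℕ.≮⇒≥ ¬r)))) (found-stable (c s))))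
          (ℕ.m⊓n≤m _ (suc M))

    mutual
      -- If some component lies in a rich class, let it range over the more than `M` members found
      -- there, and put representatives from `layer H` in the other places. The congruence keeps all
      -- results in the class of the given shape, they are pairwise distinct, and they lie in
      -- `layer (suc H)`. If all components are listed, the shape itself lies in that layer.
      listed-or-rich : ∀ s → s ∈ layer H ⊎ Rich (suc H) (c s)
      listed-or-rich cS = close (here refl)
      listed-or-rich (fS f ss) with all-or-some (listed-or-richV ss)
      ... | inj₁ p = close (layer-fS⁺ f ss p)
      ... | inj₂ (k , r) = inj₂ (ℕ.<-≤-trans
          (subst (M <_) (sym (List.length-map variant (members H (c (lookup ss k))))) (rich-down r))
          (unique-length (Unique.map⁺ variant-injective (members-unique H (c (lookup ss k)))) variants))
        where
        rep : ∀ i → Σ Sh λ s → s ∈ layer H × c s ≡ c (lookup ss i)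
        rep i with listed-or-richV ss i
        ... | inj₁ p = lookup ss i , p , refl
        ... | inj₂ r with members H (c (lookup ss i)) in eq | rich-down r
        ...   | s ∷ _ | _ = s , ∈-members⁻ {H} (subst (s ∈_) (sym eq) (here refl))
        reps : Vec Sh (ar f)
        reps = tabulate (proj₁ ∘ rep)
        variant : Sh → Sh
        variant v = fS f (reps [ k ]≔ v)
        variant-injective : ∀ {v w} → variant v ≡ variant w → v ≡ w
        variant-injective {v} {w} e = trans (sym (Vec.lookup∘update k reps v))
            (trans (cong (λ us → lookup us k) (fS-injective e)) (Vec.lookup∘update k reps w))
        component : ∀ v → v ∈ members H (c (lookup ss k)) → ∀ i → lookup (reps [ k ]≔ v) i ∈ layer H ×
            c (lookup (reps [ k ]≔ v) i) ≡ c (lookup ss i)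
        component v v∈ i with i Fin.≟ k
        ... | yes refl rewrite Vec.lookup∘update i reps v = ∈-members⁻ {H} v∈
        ... | no ne rewrite Vec.lookup∘update′ ne reps v | Vec.lookup∘tabulate (proj₁ ∘ rep) i = proj₂ (rep i)
        variants : ∀ {s} → s ∈ List.map variant (members H (c (lookup ss k))) → s ∈ members (suc H) (c (fS f ss))
        variants i with ∈-map⁻ variant i
        ... | v , v∈ , refl = ∈-members⁺ {suc H} (layer-fS⁺ f _ (proj₁ ∘ component v v∈))
            (c-hom f _ ss (proj₂ ∘ component v v∈))

      listed-or-richV : ∀ {k} (ss : Vec Sh k) i → lookup ss i ∈ layer H ⊎ Rich (suc H) (c (lookup ss i))
      listed-or-richV (s ∷ ss) zero = listed-or-rich s
      listed-or-richV (s ∷ ss) (suc i) = listed-or-richV ss i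

      close : ∀ {s} → s ∈ layer (suc H) → s ∈ layer H ⊎ Rich (suc H) (c s)
      close {s} i with suc M ≤? length (members (suc H) (c s))
      ... | yes r = inj₂ r
      ... | no ¬r = inj₁ (poor-down ¬r i)

    abstract
      ground-set : List Sh
      ground-set = layer (suc H)

      ground-spec : ∀ s → s ∈ ground-set ⊎ Σ (List Sh) λ xs → Unique xs × M < length xs ×
          (∀ {x} → x ∈ xs → x ∈ ground-set × c x ≡ c s)
      ground-spec s with listed-or-rich s
      ... | inj₁ i = inj₁ (layer-mono H i)
      ... | inj₂ r = inj₂ (members (suc H) (c s) , members-unique (suc H) (c s) , r , ∈-members⁻ {suc H})

  -- Equations between shapes in one unknown.

  module _ {L V : Set} (c : L) where
    mutual
      ground : Sh → Ex L V
      ground cS = leaf c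
      ground (fS f ss) = node f (groundV ss)

      groundV : ∀ {k} → Vec Sh k → Vec (Ex L V) k
      groundV [] = []
      groundV (s ∷ ss) = ground s ∷ groundV ss

    module _ {l : L → Sh} {v : V → Sh} (l-c : l c ≡ cS) where
      mutual
        eval-ground : ∀ s → eval fS l v (ground s) ≡ s
        eval-ground cS = l-c
        eval-ground (fS f ss) = cong (fS f) (evalV-ground ss)

        evalV-ground : ∀ {k} (ss : Vec Sh k) → evalV fS l v (groundV ss) ≡ ss
        evalV-ground [] = refl
        evalV-ground (s ∷ ss) = cong₂ _∷_ (eval-ground s) (evalV-ground ss)

  Poly : Set
  Poly = Ex ⊤ (Fin 1)

  plug : Sh → Poly → Sh
  plug w = eval fS (λ _ → cS) (lookup (w ∷ []))

  plugV : ∀ {k} → Sh → Vec Poly k → Vec Sh k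
  plugV w = evalV fS (λ _ → cS) (lookup (w ∷ []))

  fS-head : ∀ {f g ss us} → fS {S} f ss ≡ fS g us → f ≡ g
  fS-head refl = refl

  -- Either the unknown occurs on the right, and its value would be a proper part of itself, or the
  -- right-hand side is constant.
  unknown≢node : ∀ {f u u'} (es : Vec Poly (ar f)) → u ≡ plug u (node f es) → u' ≡ plug u' (node f es) → u ≡ u'
  unknown≢node {f} {u} {u'} es p q with thinV? zero es
  ... | inj₁ (es' , refl) = trans p (trans (constant u) (trans (sym (constant u')) (sym q)))
    where
    constant : ∀ w → plug w (thin zero (node f es')) ≡ eval fS (λ _ → cS) (lookup []) (node f es')
    constant w = eval-thin {alg = fS} {λ _ → cS} [] zero w (node f es')
  ... | inj₂ (k , o) = ⊥-elim (ℕ.<-irrefl (cong height p) (occ-height-node es k o))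

  mutual
    -- Descending in both expressions in parallel, the unknown set against anything but itself would
    -- determine its value; two distinct solutions therefore exclude every mismatch.
    unique-solution : ∀ {u u'} → u ≢ u' → ∀ A B → plug u A ≡ plug u B → plug u' A ≡ plug u' B → A ≡ B
    unique-solution ne (vr zero) (vr zero) p q = refl
    unique-solution ne (leaf tt) (leaf tt) p q = refl
    unique-solution ne (vr zero) (leaf tt) p q = ⊥-elim (ne (trans p (sym q)))
    unique-solution ne (leaf tt) (vr zero) p q = ⊥-elim (ne (trans (sym p) q))
    unique-solution ne (vr zero) (node f es) p q = ⊥-elim (ne (unknown≢node es p q))
    unique-solution ne (node f es) (vr zero) p q = ⊥-elim (ne (unknown≢node es (sym p) (sym q)))
    unique-solution ne (leaf tt) (node f es) () q
    unique-solution ne (node f es) (leaf tt) () q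
    unique-solution ne (node f es) (node g gs) p q with fS-head p
    ... | refl = cong (node f) (unique-solutionV ne es gs (fS-injective p) (fS-injective q))

    unique-solutionV : ∀ {u u' k} → u ≢ u' → ∀ (as bs : Vec Poly k) → plugV u as ≡ plugV u bs → plugV u' as
        ≡ plugV u' bs → as ≡ bs
    unique-solutionV ne [] [] p q = refl
    unique-solutionV ne (a ∷ as) (b ∷ bs) p q =
        cong₂ _∷_ (unique-solution ne a b (Vec.∷-injectiveˡ p) (Vec.∷-injectiveˡ q))
      (unique-solutionV ne as bs (Vec.∷-injectiveʳ p) (Vec.∷-injectiveʳ q))

  -- Leaf counts up to a threshold.

  trunc-+ : ∀ K a b → (a + b) ⊓ K ≡ ((a ⊓ K) + (b ⊓ K)) ⊓ K
  trunc-+ K a b with ℕ.≤-total a K | ℕ.≤-total b K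
  ... | inj₂ p | _ rewrite ℕ.m≥n⇒m⊓n≡n p =
      trans (ℕ.m≥n⇒m⊓n≡n (≤-trans p (ℕ.m≤m+n a b))) (sym (ℕ.m≥n⇒m⊓n≡n (ℕ.m≤m+n K _)))
  ... | inj₁ p | inj₂ q rewrite ℕ.m≥n⇒m⊓n≡n q =
      trans (ℕ.m≥n⇒m⊓n≡n (≤-trans q (ℕ.m≤n+m b a))) (sym (ℕ.m≥n⇒m⊓n≡n (ℕ.m≤n+m K (a ⊓ K))))
  ... | inj₁ p | inj₁ q rewrite ℕ.m≤n⇒m⊓n≡m p | ℕ.m≤n⇒m⊓n≡m q = refl

  ≤ᵇ-trunc : ∀ {j K} a → j ≤ K → (j ≤ᵇ a) ≡ (j ≤ᵇ a ⊓ K)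
  ≤ᵇ-trunc {j} {K} a le = Tr⇒≡ (λ h → ≤ᵇ⁺ (ℕ.⊓-glb (≤ᵇ⁻ {j} {a} h) le))
      (λ h → ≤ᵇ⁺ (≤-trans (≤ᵇ⁻ {j} {a ⊓ K} h) (ℕ.m⊓n≤m a K)))

  module Class (K : ℕ) where

    -- Quantifying over all predicates on variances is what makes this a congruence: an argument of
    -- negative variance exchanges the two signs.
    _~_ : Sh → Sh → Set
    s ~ u = ∀ w → cntR w (signs s) ⊓ K ≡ cntR w (signs u) ⊓ K

    ~V : ∀ {k} (ss us : Vec Sh k) → (∀ i → lookup ss i ~ lookup us i) → ∀ v w → cntR w (signsV v ss) ⊓ K
        ≡ cntR w (signsV v us) ⊓ K
    ~V [] [] h v w = refl
    ~V (s ∷ ss) (u ∷ us) h v w = trans (unfold s ss)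
        (trans (cong₂ (λ a b → (a + b) ⊓ K) (h zero (w ∘ (v zero Sg.*_))) (~V ss us (h ∘ suc) (v ∘ suc) w))
        (sym (unfold u us)))
      where
      unfold : ∀ s ss → cntR w (signsV v (s ∷ ss)) ⊓ K
          ≡ ((cntR (w ∘ (v zero Sg.*_)) (signs s) ⊓ K) + (cntR w (signsV (v ∘ suc) ss) ⊓ K)) ⊓ K
      unfold s ss = trans (cong (_⊓ K) (trans (cntR-++ w (List.map (v zero Sg.*_) (signs s)) (signsV (v ∘ suc) ss))
        (cong (_+ cntR w (signsV (v ∘ suc) ss)) (cntR-map w (v zero Sg.*_) (signs s)))))
            (trunc-+ K _ (cntR w (signsV (v ∘ suc) ss)))

    ~-fS : ∀ f ss us → (∀ i → lookup ss i ~ lookup us i) → fS f ss ~ fS f us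
    ~-fS f ss us h = ~V ss us h (var f)

    weight : Bool × Bool → Sg.Sign → Bool
    weight (a , b) Sg.+ = a
    weight (a , b) Sg.- = b

    -- There are only four predicates on variances, so a table of four truncated counts decides
    -- `_~_` and the classes are finite in number.
    weights : Vec (Bool × Bool) 4
    weights = (true , true) ∷ (true , false) ∷ (false , true) ∷ (false , false) ∷ []

    position : ∀ a b → Σ (Fin 4) λ i → lookup weights i ≡ (a , b)
    position true true = zero , refl
    position true false = suc zero , refl
    position false true = suc (suc zero) , refl
    position false false = suc (suc (suc zero)) , refl

    capped : Sh → Bool × Bool → Fin (suc K)
    capped s ab = fromℕ< (s≤s (ℕ.m⊓n≤n (cntR (weight ab) (signs s)) K))

    abstract
      cls : Sh → Vec (Fin (suc K)) 4
      cls s = Vec.map (capped s) weights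

      cls⇒~ : ∀ {s u} → cls s ≡ cls u → s ~ u
      cls⇒~ {s} {u} e w with position (w Sg.+) (w Sg.-)
      ... | i , eq = trans (side s) (trans (cong (λ q → toℕ (lookup q i)) e) (sym (side u)))
        where
        side : ∀ s → cntR w (signs s) ⊓ K ≡ toℕ (lookup (cls s) i)
        side s = trans (cong (_⊓ K) (cntR-cong (signs s) λ { Sg.+ → refl ; Sg.- → refl }))
          (sym (trans (cong toℕ (trans (Vec.lookup-map i (capped s) weights) (cong (capped s) eq))) (toℕ-fromℕ< _)))

      ~⇒cls : ∀ {s u} → s ~ u → cls s ≡ cls u
      ~⇒cls {s} {u} h = Vec.map-cong (λ ab →
          fromℕ<-cong (cntR (weight ab) (signs s) ⊓ K) (cntR (weight ab) (signs u) ⊓ K) (h (weight ab))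
          (s≤s (ℕ.m⊓n≤n _ K)) (s≤s (ℕ.m⊓n≤n _ K))) weights

      cls-hom : ∀ f ss us → (∀ i → cls (lookup ss i) ≡ cls (lookup us i)) → cls (fS f ss) ≡ cls (fS f us)
      cls-hom f ss us h = ~⇒cls {fS f ss} {fS f us} (~-fS f ss us λ i → cls⇒~ {lookup ss i} {lookup us i} (h i))

    ~-size : ∀ {s u j} ψ → s ~ u → j ≤ K → (j ≤ᵇ cnt ψ [] s) ≡ (j ≤ᵇ cnt ψ [] u)
    ~-size {s} {u} {j} ψ h le = trans (side s) (trans (cong (j ≤ᵇ_) (h _)) (sym (side u)))
      where
      side : ∀ s → (j ≤ᵇ cnt ψ [] s) ≡ (j ≤ᵇ cntR (λ σ → evalL S σ ψ []) (signs s) ⊓ K)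
      side s = trans (cong (j ≤ᵇ_) (cntR-map (evalR ψ) (_, []) (signs s)))
          (≤ᵇ-trunc (cntR (λ σ → evalL S σ ψ []) (signs s)) le)

    mutual
      ~-eval : ∀ {L V} {l : L → Sh} {v v' : V → Sh} → (∀ x → v x ~ v' x) → ∀ e → eval fS l v e ~ eval fS l v' e
      ~-eval h (vr x) = h x
      ~-eval h (leaf a) w = refl
      ~-eval {l = l} {v} {v'} h (node f es) =
          ~-fS f (evalV fS l v es) (evalV fS l v' es) (~-evalV {l = l} {v} {v'} h es)

      ~-evalV : ∀ {L V k} {l : L → Sh} {v v' : V → Sh} → (∀ x → v x ~ v' x) → ∀ (es : Vec (Ex L V) k) i →
        lookup (evalV fS l v es) i ~ lookup (evalV fS l v' es) i
      ~-evalV {l = l} {v} {v'} h (e ∷ es) zero = ~-eval {l = l} {v} {v'} h e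
      ~-evalV {l = l} {v} {v'} h (e ∷ es) (suc i) = ~-evalV {l = l} {v} {v'} h es i

    abstract
      classes : List (Vec (Fin (suc K)) 4)
      classes = tuples (allFin (suc K)) 4

      ∈-classes : ∀ q → q ∈ classes
      ∈-classes q = ∈-tuples⁺ q (λ i → ∈-allFin (lookup q i))

    module Samples (M : ℕ) = Ground (Vec.≡-dec Fin._≟_) classes ∈-classes cls cls-hom M

  -- Solved forms of an equation for the unknown of index i.

  module Candidates {r} (i : Fin (suc r)) where

    free : SE (suc r) → List (SE r)
    free e with thin? i e
    ... | inj₁ (e' , _) = e' ∷ []
    ... | inj₂ _ = []

    mutual
      candO : SE (suc r) → ℕ ⊎ ℕ → Pos → List (SE r)
      candO (node f es) o p = candOV es o (snoc p f)
      candO _ o p = leaf (so o p) ∷ []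

      candOV : ∀ {k} → Vec (SE (suc r)) k → ℕ ⊎ ℕ → (Fin k → Pos) → List (SE r)
      candOV [] o p = []
      candOV (e ∷ es) o p = candO e o (p zero) ++ candOV es o (p ∘ suc)

    mutual
      cands : SE (suc r) → SE (suc r) → List (SE r)
      cands (node f es) (node g gs) = candsV es gs
      cands (node f es) (leaf (so o p)) = candO (node f es) o p
      cands (leaf (so o p)) (node f es) = candO (node f es) o p
      cands a b = free a ++ free b

      candsV : ∀ {k l} → Vec (SE (suc r)) k → Vec (SE (suc r)) l → List (SE r)
      candsV (e ∷ es) (g ∷ gs) = cands e g ++ candsV es gs
      candsV _ _ = []

    module _ (ρ : Env S) (ss : Vec Sh r) (u : Sh) (max : ∀ j → height (lookup ss j) ≤ height u) where

      at' : Sh → SE (suc r) → Sh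
      at' w = valS ρ (insertAt ss i w)

      Solved : List (SE r) → Set
      Solved l = Σ (SE r) λ E → E ∈ l × valS ρ ss E ≡ u

      Outcome : SE (suc r) → SE (suc r) → List (SE r) → Set
      Outcome a b l = (∀ w → at' w a ≡ at' w b) ⊎ Solved l

      weaken : ∀ {l l'} → (∀ {E} → E ∈ l → E ∈ l') → Solved l → Solved l'
      weaken h (E , i , e) = E , h i , e

      self : at' u (vr i) ≡ u
      self = Vec.insertAt-lookup ss i u

      above : ∀ {f es} → Occ i (node f es) → height u < height (at' u (node f es))
      above (there {f} {es} k o) = subst (λ s → height s < height (at' u (node f es))) self
          (occ-height-node {l = leafS ρ} {v = lookup (insertAt ss i u)} es k o)

      NodeFree : SE (suc r) → SE (suc r) → Set
      NodeFree a b = (∀ {f es} → a ≡ node f es → height (at' u b) ≤ height u)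

      -- An occurs check by height: a node containing the unknown is higher than it, while the
      -- opposite side is not. What remains is an equation free of the unknown, the unknown against
      -- itself, or a solved form.
      simple : ∀ a b → NodeFree a b → NodeFree b a → at' u a ≡ at' u b → Outcome a b (free a ++ free b)
      simple a b na nb e with thin? i a | thin? i b
      ... | inj₁ (a' , refl) | inj₁ (b' , refl) = inj₁ λ w →
          trans (eval-thin ss i w a') (trans (sym (eval-thin ss i u a'))
              (trans e (trans (eval-thin ss i u b') (sym (eval-thin ss i w b')))))
      ... | inj₁ (a' , refl) | inj₂ here = inj₂ (a' , here refl , trans (sym (eval-thin ss i u a')) (trans e self))
      ... | inj₂ here | inj₁ (b' , refl) =
          inj₂ (b' , here refl , trans (sym (eval-thin ss i u b')) (trans (sym e) self))
      ... | inj₂ here | inj₂ here = inj₁ λ w → refl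
      ... | _ | inj₂ o@(there k _) = ⊥-elim
          (ℕ.<⇒≱ (above o) (≤-trans (ℕ.≤-reflexive (cong height (sym e))) (nb refl)))
      ... | inj₂ o@(there k _) | _ = ⊥-elim (ℕ.<⇒≱ (above o) (≤-trans (ℕ.≤-reflexive (cong height e)) (na refl)))

      low-vr : ∀ j → height (at' u (vr j)) ≤ height u
      low-vr j with i Fin.≟ j
      ... | yes refl = ℕ.≤-reflexive (cong height self)
      ... | no ne = subst (λ j → height (lookup (insertAt ss i u) j) ≤ height u) (punchIn-punchOut ne)
              (subst (λ s → height s ≤ height u) (sym (Vec.insertAt-punchIn ss i u (punchOut ne)))
                  (max (punchOut ne)))

      mutual
        candO-complete : ∀ e o p → at' u e ≡ navS (outer ρ o) p → (∀ w → at' w e ≡ navS (outer ρ o) p) ⊎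
            Solved (candO e o p)
        candO-complete (vr j) o p e = go (i Fin.≟ j)
          where
          go : Dec (i ≡ j) → (∀ w → at' w (vr j) ≡ navS (outer ρ o) p) ⊎ Solved (leaf (so o p) ∷ [])
          go (yes refl) = inj₂ (leaf (so o p) , here refl , trans (sym e) self)
          go (no ne) = inj₁ λ w → trans (off w) (trans (sym (off u)) e)
            where
            off : ∀ w → at' w (vr j) ≡ lookup ss (punchOut ne)
            off w = trans (cong (lookup (insertAt ss i w)) (sym (punchIn-punchOut ne)))
                (Vec.insertAt-punchIn ss i w (punchOut ne))
        candO-complete (leaf a) o p e = inj₁ λ w → e
        candO-complete (node f es) o p e with candOV-complete es o (snoc p f)
            (λ k → trans (sym (selSh-fS f k _)) (trans (cong (selSh f k) e) (sym (navS-snoc (outer ρ o) p f k))))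
        ... | inj₂ s = inj₂ s
        ... | inj₁ h = inj₁ λ w → trans (cong (fS f) (lookup-ext λ k → trans (h w k) (sym (h u k)))) e

        candOV-complete : ∀ {k} (es : Vec (SE (suc r)) k) o p →
            (∀ j → lookup (evalV fS (leafS ρ) (lookup (insertAt ss i u)) es) j ≡ navS (outer ρ o) (p j)) →
          (∀ w j → lookup (evalV fS (leafS ρ) (lookup (insertAt ss i w)) es) j ≡ navS (outer ρ o) (p j)) ⊎
              Solved (candOV es o p)
        candOV-complete [] o p h = inj₁ λ w ()
        candOV-complete (e ∷ es) o p h with candO-complete e o (p zero) (h zero) | candOV-complete es o (p ∘ suc)
            (h ∘ suc)
        ... | inj₂ s | _ = inj₂ (weaken ∈-++⁺ˡ s)
        ... | _ | inj₂ s = inj₂ (weaken (∈-++⁺ʳ (candO e o (p zero))) s)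
        ... | inj₁ a | inj₁ as = inj₁ λ { w zero → a w ; w (suc j) → as w j }

      mutual
        cands-complete : ∀ a b → at' u a ≡ at' u b → Outcome a b (cands a b)
        cands-complete (node f es) (node g gs) e with fS-head e
        ... | refl with candsV-complete es gs (fS-injective e)
        ...   | inj₁ h = inj₁ λ w → cong (fS f) (h w)
        ...   | inj₂ s = inj₂ s
        cands-complete (node f es) (leaf (so o p)) e = candO-complete (node f es) o p e
        cands-complete (leaf (so o p)) (node f es) e with candO-complete (node f es) o p (sym e)
        ... | inj₁ h = inj₁ λ w → sym (h w)
        ... | inj₂ s = inj₂ s
        cands-complete (node f es) (leaf scn) ()
        cands-complete (leaf scn) (node f es) ()
        cands-complete (node f es) (vr j) e = simple (node f es) (vr j) (λ _ → low-vr j) (λ ()) e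
        cands-complete (vr j) (node f es) e = simple (vr j) (node f es) (λ ()) (λ _ → low-vr j) e
        cands-complete (vr j) (vr k) e = simple (vr j) (vr k) (λ ()) (λ ()) e
        cands-complete (vr j) (leaf (so o p)) e = simple (vr j) (leaf (so o p)) (λ ()) (λ ()) e
        cands-complete (vr j) (leaf scn) e = simple (vr j) (leaf scn) (λ ()) (λ ()) e
        cands-complete (leaf (so o p)) (vr k) e = simple (leaf (so o p)) (vr k) (λ ()) (λ ()) e
        cands-complete (leaf scn) (vr k) e = simple (leaf scn) (vr k) (λ ()) (λ ()) e
        cands-complete (leaf (so o p)) (leaf a) e = inj₁ λ w → e
        cands-complete (leaf scn) (leaf a) e = inj₁ λ w → e

        candsV-complete : ∀ {k} (as bs : Vec (SE (suc r)) k) →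
          evalV fS (leafS ρ) (lookup (insertAt ss i u)) as ≡ evalV fS (leafS ρ) (lookup (insertAt ss i u)) bs →
          (∀ w → evalV fS (leafS ρ) (lookup (insertAt ss i w)) as ≡ evalV fS (leafS ρ) (lookup (insertAt ss i w)) bs)
              ⊎ Solved (candsV as bs)
        candsV-complete [] [] e = inj₁ λ w → refl
        candsV-complete (a ∷ as) (b ∷ bs) e with cands-complete a b (Vec.∷-injectiveˡ e) | candsV-complete as bs
            (Vec.∷-injectiveʳ e)
        ... | inj₂ s | _ = inj₂ (weaken ∈-++⁺ˡ s)
        ... | _ | inj₂ s = inj₂ (weaken (∈-++⁺ʳ (cands a b)) s)
        ... | inj₁ h | inj₁ hs = inj₁ λ w → cong₂ _∷_ (h w) (hs w)

  -- Eliminating a bound shape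

  map-lookup-insertAt : ∀ {A B : Set} {k} (h : A → B) (xs : Vec A k) i x {ys y} → Vec.map h xs ≡ ys → h x ≡ y →
    ∀ j → h (lookup (insertAt xs i x) j) ≡ lookup (insertAt ys i y) j
  map-lookup-insertAt h xs i x refl refl j = trans (sym (Vec.lookup-map j h (insertAt xs i x)))
    (cong (λ v → lookup v j) (Vec.map-insertAt h x xs i))

  subS : ∀ {r} → Fin (suc r) → SE r → SE (suc r) → SE r
  subS i E = sub leaf (lookup (insertAt (tabulate vr) i E))

  valS-subS : ∀ ρ {r} (ss : Vec Sh r) i E e → valS ρ ss (subS i E e) ≡ valS ρ (insertAt ss i (valS ρ ss E)) e
  valS-subS ρ ss i E = eval-sub (λ _ → refl) (map-lookup-insertAt (valS ρ ss) (tabulate vr) i E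
    (trans (sym (Vec.tabulate-∘ (valS ρ ss) vr)) (Vec.tabulate∘lookup ss)) refl)

  subA : ∀ {r} → Fin (suc r) → SE r → Atom (suc r) 0 → Atom r 0
  subA i E (same a b) = same (subS i E a) (subS i E b)
  subA i E (size ψ a j) = size ψ (subS i E a) j
  subA i E (card ψ Es j) = card ψ Es j

  valA-subA : ∀ ρ {r} (ss : Vec Sh r) i E a → valA ρ ss [] (subA i E a) ≡ valA ρ (insertAt ss i (valS ρ ss E)) [] a
  valA-subA ρ ss i E (same a b) = cong₂ (λ s u → does (s ≟S u)) (valS-subS ρ ss i E a) (valS-subS ρ ss i E b)
  valA-subA ρ ss i E (size ψ a j) = cong (λ s → j ≤ᵇ cnt ψ [] s) (valS-subS ρ ss i E a)
  valA-subA ρ ss i E (card ψ Es j) = refl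

  subP : ∀ {r} → Fin (suc r) → SE r → BF (Atom (suc r) 0) → BF (Atom r 0)
  subP i E P = bind P (atm ∘ subA i E)

  ev-subP : ∀ ρ {r} (ss : Vec Sh r) i E P → ev (valA ρ ss []) (subP i E P)
      ≡ ev (valA ρ (insertAt ss i (valS ρ ss E)) []) P
  ev-subP ρ ss i E P = trans (ev-bind P (atm ∘ subA i E)) (ev-cong P (valA-subA ρ ss i E))

  -- Everything except the unknown is frozen to its value, so that `unique-solution` compares
  -- expressions in the unknown alone.
  toPoly : Env S → ∀ {r} → Vec Sh r → Fin (suc r) → SE (suc r) → Poly
  toPoly ρ ss i = sub (ground tt ∘ leafS ρ) (lookup (insertAt (Vec.map (ground tt) ss) i (vr zero)))

  plug-toPoly : ∀ ρ {r} (ss : Vec Sh r) i w e → plug w (toPoly ρ ss i e) ≡ valS ρ (insertAt ss i w) e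
  plug-toPoly ρ ss i w = eval-sub (λ a → eval-ground tt refl (leafS ρ a))
      (map-lookup-insertAt (plug w) (Vec.map (ground tt) ss) i (vr zero)
    (trans (sym (Vec.map-∘ (plug w) (ground tt) ss)) (trans (Vec.map-cong (eval-ground tt refl) ss) (Vec.map-id ss)))
        refl)

  module _ {A X : Set} (bad : A → X → Bool) where

    AtMostOne : A → List X → Set
    AtMostOne a xs = ∀ {x y} → x ∈ xs → y ∈ xs → Tr (bad a x) → Tr (bad a y) → x ≡ y

    good : A → List X → List X
    good a = filter (λ x → bad a x Bool.≟ false)

    good-length : ∀ a xs → Unique xs → AtMostOne a xs → length xs ≤ suc (length (good a xs))
    good-length a [] u one = z≤n
    good-length a (x ∷ xs) (x∉ ∷ u) one with bad a x in eq
    ... | false = s≤s (good-length a xs u λ i j → one (there i) (there j))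
    ... | true = s≤s (ℕ.≤-reflexive (cong length (sym (List.filter-all (λ x → bad a x Bool.≟ false)
          (LAll.tabulate λ {y} i → ¬Tr⇒false λ b → LAll.lookup x∉ i (one (here refl) (there i) eq b))))))

    -- Each requirement rules out at most one element, so a list longer than the number of
    -- requirements keeps an element that meets them all.
    avoid : ∀ as xs → Unique xs → length as < length xs → (∀ {a} → a ∈ as → AtMostOne a xs) →
      Σ X λ x → x ∈ xs × (∀ {a} → a ∈ as → bad a x ≡ false)
    avoid [] (x ∷ xs) u lt one = x , here refl , λ ()
    avoid (a ∷ as) xs u lt one with avoid as (good a xs) (Unique.filter⁺ _ u)
      (ℕ.≤-pred (≤-trans lt (good-length a xs u (one (here refl)))))
          (λ a∈ i j → one (there a∈) (proj₁ (∈-filter⁻ _ i)) (proj₁ (∈-filter⁻ _ j)))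
    ... | x , i , ok with ∈-filter⁻ (λ x → bad a x Bool.≟ false) {xs = xs} i
    ...   | j , e = x , j , λ { (here refl) → e ; (there a∈) → ok a∈ }

  threshold : ∀ {r q} → Atom r q → ℕ
  threshold (size ψ s j) = j
  threshold _ = 0

  maxOf : ∀ {A : Set} → (A → ℕ) → List A → ℕ
  maxOf g [] = 0
  maxOf g (x ∷ xs) = g x ⊔ maxOf g xs

  ≤maxOf : ∀ {A : Set} (g : A → ℕ) {x xs} → x ∈ xs → g x ≤ maxOf g xs
  ≤maxOf g {xs = y ∷ xs} (here refl) = ℕ.m≤m⊔n (g y) (maxOf g xs)
  ≤maxOf g {xs = y ∷ xs} (there i) = ≤-trans (≤maxOf g i) (ℕ.m≤n⊔m (g y) (maxOf g xs))

  module Eliminate {r} (i : Fin (suc r)) (P : BF (Atom (suc r) 0)) where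
    open Candidates i
    -- Counts truncated at the largest threshold make every `size` atom an invariant of the class.
    -- The second parameter, the number of atoms, ensures that a rich class contains a shape spared
    -- by every atom.
    open Class (maxOf threshold (atoms P))
    open Samples (length (atoms P))

    candsA : Atom (suc r) 0 → List (SE r)
    candsA (same a b) = cands a b
    candsA _ = []

    solutions : List (SE r)
    solutions = concatMap candsA (atoms P)

    testPoints : List (SE r)
    testPoints = solutions ++ List.map (ground scn) ground-set

    module _ (ρ : Env S) (ss : Vec Sh r) (u : Sh) (max : ∀ j → height (lookup ss j) ≤ height u) where

      value : Sh → Atom (suc r) 0 → Bool
      value w = valA ρ (insertAt ss i w) []

      differs : Atom (suc r) 0 → Sh → Bool
      differs a w = not (does (value w a Bool.≟ value u a))

      differs-false : ∀ a w → differs a w ≡ false → value w a ≡ value u a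
      differs-false a w e with value w a Bool.≟ value u a
      ... | yes p = p

      differs-true : ∀ a w → Tr (differs a w) → value w a ≢ value u a
      differs-true a w e p with value w a Bool.≟ value u a
      ... | no ne = ne p

      module _ (unsolved : ∀ {E} → E ∈ solutions → valS ρ ss E ≢ u) where

        -- `size` atoms are invariants of the class. An equation true at `u` is an identity, because
        -- no solved form yields `u`, and so it never differs. An equation false at `u` is no
        -- identity and has at most one solution, which is the only place where it can differ.
        differs-once : ∀ {a} → a ∈ atoms P → ∀ {x y} → cls x ≡ cls u → cls y ≡ cls u → Tr (differs a x) →
            Tr (differs a y) → x ≡ y
        differs-once {card ψ Es j} a∈ {x} cx cy dx dy = ⊥-elim (differs-true (card ψ Es j) x dx refl)
        differs-once {size ψ s j} a∈ {x} cx cy dx dy = ⊥-elim (differs-true (size ψ s j) x dx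
          (~-size {valS ρ (insertAt ss i x) s} {valS ρ (insertAt ss i u) s} ψ
              (~-eval {l = leafS ρ} {lookup (insertAt ss i x)} {lookup (insertAt ss i u)} moved s)
              (≤maxOf threshold a∈)))
          where
          moved : ∀ j → lookup (insertAt ss i x) j ~ lookup (insertAt ss i u) j
          moved j with i Fin.≟ j
          ... | yes refl rewrite Vec.insertAt-lookup ss i x | Vec.insertAt-lookup ss i u = cls⇒~ {x} {u} cx
          ... | no ne rewrite sym (punchIn-punchOut ne) | Vec.insertAt-punchIn ss i x (punchOut ne) |
              Vec.insertAt-punchIn ss i u (punchOut ne) = λ w → refl
        differs-once {same a b} a∈ {x} {y} cx cy dx dy = go (equal? u) (x ≟S y)
          where
          equal? : ∀ w → Dec (valS ρ (insertAt ss i w) a ≡ valS ρ (insertAt ss i w) b)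
          equal? w = valS ρ (insertAt ss i w) a ≟S valS ρ (insertAt ss i w) b
          poly-eq : ∀ w → valS ρ (insertAt ss i w) a ≡ valS ρ (insertAt ss i w) b → plug w (toPoly ρ ss i a)
              ≡ plug w (toPoly ρ ss i b)
          poly-eq w e = trans (plug-toPoly ρ ss i w a) (trans e (sym (plug-toPoly ρ ss i w b)))
          solves : ∀ w → Tr (differs (same a b) w) → valS ρ (insertAt ss i u) a ≢ valS ρ (insertAt ss i u) b →
            valS ρ (insertAt ss i w) a ≡ valS ρ (insertAt ss i w) b
          solves w d ne = decidable-stable (equal? w) λ q → differs-true (same a b) w d
            (trans (¬Tr⇒false (q ∘ does⁻ (equal? w))) (sym (¬Tr⇒false (ne ∘ does⁻ (equal? u)))))
          go : Dec (valS ρ (insertAt ss i u) a ≡ valS ρ (insertAt ss i u) b) → Dec (x ≡ y) → x ≡ y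
          go _ (yes e) = e
          go (yes e) (no _) with cands-complete ρ ss u max a b e
          ... | inj₁ id = ⊥-elim (differs-true (same a b) x dx
              (trans (does⁺ (equal? x) (id x)) (sym (does⁺ (equal? u) e))))
          ... | inj₂ (E , E∈ , eqE) = ⊥-elim (unsolved (∈-concatMap⁺ candsA (lose a∈ E∈)) eqE)
          go (no ne) (no x≢y) = ⊥-elim (ne (trans (sym (plug-toPoly ρ ss i u a)) (trans (cong (plug u)
            (unique-solution x≢y (toPoly ρ ss i a) (toPoly ρ ss i b) (poly-eq x (solves x dx ne))
                (poly-eq y (solves y dy ne)))) (plug-toPoly ρ ss i u b))))

      Tested : Set
      Tested = Σ (SE r) λ E → E ∈ testPoints × Tr (ev (valA ρ ss []) (subP i E P))

      at-solution : Any.Any (λ E → valS ρ ss E ≡ u) solutions → Tr (ev (value u) P) → Tested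
      at-solution p h = let E , E∈ , e = find p in
        E , ∈-++⁺ˡ E∈ , trans (ev-subP ρ ss i E P) (trans (cong (λ w → ev (value w) P) e) h)

      at-sample : ∀ {x} → x ∈ ground-set → Tr (ev (value x) P) → Tested
      at-sample {x} x∈ h = ground scn x , ∈-++⁺ʳ solutions (∈-map⁺ (ground scn) x∈) ,
        trans (ev-subP ρ ss i (ground scn x) P) (trans (cong (λ w → ev (value w) P) (eval-ground scn refl x)) h)

      testPoints-complete : Tr (ev (value u) P) → Tested
      testPoints-complete h = go (Any.any? (λ E → valS ρ ss E ≟S u) solutions) (ground-spec u)
        where
        go : Dec (Any.Any (λ E → valS ρ ss E ≡ u) solutions) →
          u ∈ ground-set ⊎ Σ (List Sh) (λ xs → Unique xs × length (atoms P) < length xs ×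
              (∀ {x} → x ∈ xs → x ∈ ground-set × cls x ≡ cls u)) → Tested
        go (yes p) _ = at-solution p h
        go (no ¬p) (inj₁ u∈) = at-sample u∈ h
        go (no ¬p) (inj₂ (xs , uniq , lt , xs∈)) =
          let x , x∈ , ok = avoid differs (atoms P) xs uniq lt
                (λ {a} a∈ {x} {y} x∈ y∈ → differs-once (λ E∈ e → ¬p (lose E∈ e)) {a} a∈ {x} {y} (proj₂ (xs∈ {x} x∈))
                    (proj₂ (xs∈ {y} y∈)))
          in at-sample {x} (proj₁ (xs∈ {x} x∈)) (trans (ev-cong-∈ P (λ a a∈ → differs-false a x (ok a∈))) h)

  elimS : ∀ r → BF (Atom r 0) → BF (Atom 0 0)
  elimS zero P = P
  elimS (suc r) P = elimS r (some (allFin (suc r)) λ i → some (Eliminate.testPoints i P) λ E → subP i E P)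

  module _ (ρ : Env S) where
    elimS⁻ : ∀ r P → Tr (ev (valA ρ [] []) (elimS r P)) → Σ (Vec Sh r) λ ss → Tr (ev (valA ρ ss []) P)
    elimS⁻ zero P h = [] , h
    elimS⁻ (suc r) P h with elimS⁻ r _ h
    ... | ss , h₁ with some⁻ {e = valA ρ ss []} (allFin (suc r)) _ h₁
    ...   | i , _ , h₂ with some⁻ {e = valA ρ ss []} (Eliminate.testPoints i P) _ h₂
    ...     | E , _ , h₃ = insertAt ss i (valS ρ ss E) , trans (sym (ev-subP ρ ss i E P)) h₃

    elimS⁺ : ∀ r P ss → Tr (ev (valA ρ ss []) P) → Tr (ev (valA ρ [] []) (elimS r P))
    elimS⁺ zero P [] h = h
    elimS⁺ (suc r) P ss h with argmax (Vec.map height ss)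
    ... | i , max with Eliminate.testPoints-complete i P ρ (removeAt ss i) (lookup ss i)
            (λ j → subst₂ _≤_ (trans (Vec.lookup-map (punchIn i j) height ss)
                (cong height (sym (lookup-removeAt ss i j)))) (Vec.lookup-map i height ss) (max (punchIn i j)))
            (subst (λ ss → Tr (ev (valA ρ ss []) P)) (sym (Vec.insertAt-removeAt ss i)) h)
    ...   | E , E∈ , h' = elimS⁺ r _ (removeAt ss i)
        (some⁺ {e = valA ρ (removeAt ss i) []} _ (∈-allFin i) (some⁺ {e = valA ρ (removeAt ss i) []} _ E∈ h'))

  -- Patterns.

  Pat : ℕ → Set
  Pat r = Ex (Fin n) (Fin r)

  valP : ∀ {r} → Vec Tm r → Pat r → Tm
  valP xs = eval app con (lookup xs)

  valPV : ∀ {r k} → Vec Tm r → Vec (Pat r) k → Vec Tm k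
  valPV xs = evalV app con (lookup xs)

  ren : ∀ {L V V'} → (V → V') → Ex L V → Ex L V'
  ren g = sub leaf (vr ∘ g)

  join : ∀ {k} → Σ ℕ Pat → Σ ℕ (λ r → Vec (Pat r) k) → Σ ℕ (λ r → Vec (Pat r) (suc k))
  join (r , π) (r' , πs) = r + r' , ren (_↑ˡ r') π ∷ Vec.map (ren (r ↑ʳ_)) πs

  patsV : List (Σ ℕ Pat) → ∀ k → List (Σ ℕ λ r → Vec (Pat r) k)
  patsV L zero = (0 , []) ∷ []
  patsV L (suc k) = List.cartesianProductWith join L (patsV L k)

  -- Terms cut at depth `d`: variables stand exactly at that depth, constants may stand above it.
  pats : ℕ → List (Σ ℕ Pat)
  pats zero = (1 , vr zero) ∷ []
  pats (suc d) = List.map (λ c → 0 , leaf c) (allFin n) ++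
    concatMap (λ f → List.map (λ rπs → proj₁ rπs , node f (proj₂ rπs)) (patsV (pats d) (ar f))) (allFin m)

  valP-left : ∀ {r r'} (xs : Vec Tm r) (ys : Vec Tm r') π → valP (xs Vec.++ ys) (ren (_↑ˡ r') π) ≡ valP xs π
  valP-left xs ys = eval-sub (λ _ → refl) (Vec.lookup-++ˡ xs ys)

  valP-right : ∀ {r r'} (xs : Vec Tm r) (ys : Vec Tm r') π → valP (xs Vec.++ ys) (ren (r ↑ʳ_) π) ≡ valP ys π
  valP-right xs ys = eval-sub (λ _ → refl) (Vec.lookup-++ʳ xs ys)

  mutual
    match : ∀ d t → Σ (Σ ℕ Pat) λ rπ → rπ ∈ pats d × Σ (Vec Tm (proj₁ rπ)) λ xs → valP xs (proj₂ rπ) ≡ t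
    match zero t = _ , here refl , t ∷ [] , refl
    match (suc d) (con c) = _ , ∈-++⁺ˡ (∈-map⁺ _ (∈-allFin c)) , [] , refl
    match (suc d) (app f ts) with matchV d ts
    ... | (r , πs) , i , xs , e = (r , node f πs) ,
            ∈-++⁺ʳ (List.map (λ c → 0 , leaf c) (allFin n)) (∈-concatMap⁺ _ (lose (∈-allFin f) (∈-map⁺ _ i))) , xs ,
                cong (app f) e

    matchV : ∀ d {k} (ts : Vec Tm k) → Σ (Σ ℕ λ r → Vec (Pat r) k) λ rπs → rπs ∈ patsV (pats d) k ×
        Σ (Vec Tm (proj₁ rπs)) λ xs → valPV xs (proj₂ rπs) ≡ ts
    matchV d [] = _ , here refl , [] , refl
    matchV d (t ∷ ts) with match d t | matchV d ts
    ... | (r , π) , i , xs , refl | (r' , πs) , j , ys , refl = join (r , π) (r' , πs) ,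
        ∈-cartesianProductWith⁺ join i j , xs Vec.++ ys ,
            cong₂ _∷_ (valP-left xs ys π) (trans (evalV-map _ _ _ (Vec.map (ren (r ↑ʳ_)) πs))
              (trans (sym (Vec.map-∘ _ _ πs))
                  (trans (Vec.map-cong (valP-right xs ys) πs) (sym (evalV-map _ _ _ πs)))))

  -- No variable stands above depth `d`, so a path of length at most `d` never selects from a
  -- variable.
  Deep : ∀ {r} → ℕ → Pat r → Set
  Deep zero π = ⊤
  Deep (suc d) (vr x) = ⊥
  Deep (suc d) (leaf c) = ⊤
  Deep (suc d) (node f πs) = ∀ k → Deep d (lookup πs k)

  Deep-pred : ∀ {r} d (π : Pat r) → Deep (suc d) π → Deep d π
  Deep-pred zero π h = tt
  Deep-pred (suc d) (leaf c) h = tt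
  Deep-pred (suc d) (node f πs) h k = Deep-pred d (lookup πs k) (h k)

  Deep-≤ : ∀ {r d d'} {π : Pat r} → d ≤ d' → Deep d' π → Deep d π
  Deep-≤ {d = zero} le h = tt
  Deep-≤ {d = suc d} {suc d'} {leaf c} le h = tt
  Deep-≤ {d = suc d} {suc d'} {node f πs} (s≤s le) h k = Deep-≤ le (h k)

  Deep-ren : ∀ {r r'} (g : Fin r → Fin r') d π → Deep d π → Deep d (ren g π)
  Deep-ren g zero π h = tt
  Deep-ren g (suc d) (leaf c) h = tt
  Deep-ren g (suc d) (node f πs) h k =
      subst (Deep d) (sym (lookup-evalV _ _ _ πs k)) (Deep-ren g d (lookup πs k) (h k))

  mutual
    pats-deep : ∀ d {rπ} → rπ ∈ pats d → Deep d (proj₂ rπ)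
    pats-deep zero i = tt
    pats-deep (suc d) i with ∈-++⁻ (List.map (λ c → 0 , leaf c) (allFin n)) i
    ... | inj₁ j with ∈-map⁻ _ j
    ...   | c , _ , refl = tt
    pats-deep (suc d) i | inj₂ j with Any.satisfied
        (∈-concatMap⁻ (λ f → List.map (λ rπs → proj₁ rπs , node f (proj₂ rπs)) (patsV (pats d) (ar f)))
        {xs = allFin m} j)
    ... | f , j' with ∈-map⁻ _ j'
    ...   | rπs , l , refl = patsV-deep d (ar f) l

    patsV-deep : ∀ d k {rπs} → rπs ∈ patsV (pats d) k → ∀ l → Deep d (lookup (proj₂ rπs) l)
    patsV-deep d (suc k) i l with ∈-cartesianProductWith⁻ join (pats d) (patsV (pats d) k) i
    patsV-deep d (suc k) i zero | (r , π) , (r' , πs) , p , q , refl = Deep-ren _ d π (pats-deep d p)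
    patsV-deep d (suc k) i (suc l) | (r , π) , (r' , πs) , p , q , refl =
      subst (Deep d) (sym (Vec.lookup-map l _ πs)) (Deep-ren _ d (lookup πs l) (patsV-deep d k q l))

  selP : ∀ {r} (f : Fin m) → Fin (ar f) → Pat r → Pat r
  selP f k (node g πs) with g Fin.≟ f
  ... | yes refl = lookup πs k
  ... | no _ = node g πs
  selP f k π = π

  navP : ∀ {r} → Pat r → Pos → Pat r
  navP π [] = π
  navP π ((f , k) ∷ p) = navP (selP f k π) p

  -- A matching selector uses up one level; a mismatched one is the identity and leaves the pattern
  -- deeper than demanded.
  selP-deep : ∀ {r} d f k (π : Pat r) → Deep (suc d) π → Deep d (selP f k π)
  selP-deep zero f k π h = tt
  selP-deep (suc d) f k (leaf c) h = tt
  selP-deep (suc d) f k (node g πs) h with g Fin.≟ f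
  ... | yes refl = h k
  ... | no _ = Deep-pred (suc d) (node g πs) h

  valP-sel : ∀ {r} (xs : Vec Tm r) d f k π → Deep (suc d) π → valP xs (selP f k π) ≡ selT f k (valP xs π)
  valP-sel xs d f k (leaf c) h = refl
  valP-sel xs d f k (node g πs) h with g Fin.≟ f
  ... | yes refl = sym (lookup-evalV _ _ _ πs k)
  ... | no _ = refl

  valP-nav : ∀ {r} (xs : Vec Tm r) π p → Deep (length p) π → valP xs (navP π p) ≡ navT (valP xs π) p
  valP-nav xs π [] h = refl
  valP-nav xs π ((f , k) ∷ p) h = trans (valP-nav xs (selP f k π) p (selP-deep (length p) f k π h))
    (cong (λ t → navT t p) (valP-sel xs (length p) f k π h))

  asTE : ∀ {r} → Pat r → TE r
  asTE = sub (leaf ∘ tcn) vr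

  valT-asTE : ∀ ρ {r} (xs : Vec Tm r) π → valT ρ xs (asTE π) ≡ valP xs π
  valT-asTE ρ xs = eval-sub (λ _ → refl) (λ _ → refl)

  -- A quantified shape is treated as the shape of a quantified term.

  _≟O_ : (o v : ℕ ⊎ ℕ) → Dec (o ≡ v)
  _≟O_ = Sum⊎.≡-dec Data.Nat._≟_ Data.Nat._≟_

  setV : Env S → ℕ ⊎ ℕ → Tm → Env S
  setV ρ (inj₁ x) t = setT S ρ x t
  setV ρ (inj₂ x) t = setS S ρ x (shape S t)

  upd-hit : ∀ {A : Set} (g : ℕ → A) x a → upd S g x a x ≡ a
  upd-hit g x a with x Data.Nat.≟ x
  ... | yes _ = refl
  ... | no ne = ⊥-elim (ne refl)

  upd-miss : ∀ {A : Set} (g : ℕ → A) {x y} a → y ≢ x → upd S g x a y ≡ g y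
  upd-miss g {x} {y} a ne with y Data.Nat.≟ x
  ... | yes e = ⊥-elim (ne e)
  ... | no _ = refl

  tenv-hit : ∀ ρ x t → tenv (setV ρ (inj₁ x) t) x ≡ t
  tenv-hit ρ x t = upd-hit (tenv ρ) x t

  tenv-miss : ∀ ρ v t {y} → inj₁ y ≢ v → tenv (setV ρ v t) y ≡ tenv ρ y
  tenv-miss ρ (inj₁ x) t ne = upd-miss (tenv ρ) t (ne ∘ cong inj₁)
  tenv-miss ρ (inj₂ x) t ne = refl

  outer-hit : ∀ ρ v t → outer (setV ρ v t) v ≡ shape S t
  outer-hit ρ (inj₁ x) t = cong (shape S) (upd-hit (tenv ρ) x t)
  outer-hit ρ (inj₂ x) t = upd-hit (senv ρ) x (shape S t)

  outer-miss : ∀ ρ v t o → o ≢ v → outer (setV ρ v t) o ≡ outer ρ o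
  outer-miss ρ v t (inj₁ y) ne = cong (shape S) (tenv-miss ρ v t ne)
  outer-miss ρ (inj₁ x) t (inj₂ y) ne = refl
  outer-miss ρ (inj₂ x) t (inj₂ y) ne = upd-miss (senv ρ) (shape S t) (ne ∘ cong inj₂)

  module _ (v : ℕ ⊎ ℕ) {r} (π : Pat r) where

    instTL : TL → TE r
    instTL (to y p) with inj₁ y ≟O v
    ... | yes _ = asTE (navP π p)
    ... | no _ = leaf (to y p)
    instTL (tcn c) = leaf (tcn c)

    instSL : SL → SE r
    instSL (so o p) with o ≟O v
    ... | yes _ = shE (Vec.allFin r) (asTE (navP π p))
    ... | no _ = leaf (so o p)
    instSL scn = leaf scn

    instT : TE 0 → TE r
    instT = sub instTL (λ ())

    instS : SE 0 → SE r
    instS = sub instSL (λ ())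

    -- Each pattern variable becomes a bound term and a bound shape of the same index, whence
    -- `Vec.allFin r` as the assignment of shapes to terms.
    instA : Atom 0 0 → Atom r r
    instA (same a b) = same (instS a) (instS b)
    instA (size ψ a j) = size ψ (instS a) j
    instA (card ψ Es j) = card ψ (Vec.map instT Es) j

  lenT : TL → ℕ
  lenT (to y p) = length p
  lenT (tcn c) = 0

  lenS : SL → ℕ
  lenS (so o p) = length p
  lenS scn = 0

  maxL : ∀ {L V} → (L → ℕ) → Ex L V → ℕ
  maxL len = eval (λ _ → maxV) len (λ _ → 0)

  lenA : Atom 0 0 → ℕ
  lenA (same a b) = maxL lenS a ⊔ maxL lenS b
  lenA (size ψ a j) = maxL lenS a
  lenA (card ψ Es j) = maxV (Vec.map (maxL lenT) Es)

  module _ {L L' V' A : Set} {alg : Alg A} {l : L → Ex L' V'} {w : Fin 0 → Ex L' V'} {l'} {w'} {l″ : L → A}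
      {w″ : Fin 0 → A}
    (len : L → ℕ) {d : ℕ} (h : ∀ a → len a ≤ d → eval alg l' w' (l a) ≡ l″ a) where
    mutual
      eval-sub≤ : ∀ e → maxL len e ≤ d → eval alg l' w' (sub l w e) ≡ eval alg l″ w″ e
      eval-sub≤ (leaf a) le = h a le
      eval-sub≤ (node f es) le = cong (alg f) (evalV-sub≤ es le)

      evalV-sub≤ : ∀ {k} (es : Vec (Ex L (Fin 0)) k) → maxV (evalV (λ _ → maxV) len (λ _ → 0) es) ≤ d →
        evalV alg l' w' (evalV node l w es) ≡ evalV alg l″ w″ es
      evalV-sub≤ [] le = refl
      evalV-sub≤ (e ∷ es) le = cong₂ _∷_ (eval-sub≤ e (ℕ.m⊔n≤o⇒m≤o _ _ le))
          (evalV-sub≤ es (ℕ.m⊔n≤o⇒n≤o (maxL len e) _ le))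

  module _ (ρ : Env S) (v : ℕ ⊎ ℕ) {r} (π : Pat r) {d} (deep : Deep d π) (ss : Vec Sh r) (xs : Vec Tm r)
      (coh : Coherent (Vec.allFin r) ss xs) where

    ρ' : Env S
    ρ' = setV ρ v (valP xs π)

    valT-nav : ∀ p → length p ≤ d → valT ρ xs (asTE (navP π p)) ≡ navT (valP xs π) p
    valT-nav p le = trans (valT-asTE ρ xs (navP π p)) (valP-nav xs π p (Deep-≤ le deep))

    instTL-ok : ∀ a → lenT a ≤ d → valT ρ xs (instTL v π a) ≡ leafT ρ' a
    instTL-ok (tcn c) le = refl
    instTL-ok (to y p) le with inj₁ y ≟O v
    ... | yes refl = trans (valT-nav p le) (cong (λ t → navT t p) (sym (tenv-hit ρ y (valP xs π))))
    ... | no ne = cong (λ t → navT t p) (sym (tenv-miss ρ v (valP xs π) ne))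

    instSL-ok : ∀ a → lenS a ≤ d → valS ρ ss (instSL v π a) ≡ leafS ρ' a
    instSL-ok scn le = refl
    instSL-ok (so o p) le with o ≟O v
    ... | yes refl = trans (valS-shE ρ {τ = Vec.allFin r} {ss} {xs} coh (asTE (navP π p)))
        (trans (cong (shape S) (valT-nav p le))
            (trans (shape-navT (valP xs π) p) (cong (λ s → navS s p) (sym (outer-hit ρ o (valP xs π))))))
    ... | no ne = cong (λ s → navS s p) (sym (outer-miss ρ v (valP xs π) o ne))

    valT-inst : ∀ E → maxL lenT E ≤ d → valT ρ xs (instT v π E) ≡ valT ρ' [] E
    valT-inst = eval-sub≤ lenT instTL-ok

    valS-inst : ∀ E → maxL lenS E ≤ d → valS ρ ss (instS v π E) ≡ valS ρ' [] E
    valS-inst = eval-sub≤ lenS instSL-ok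

    valA-inst : ∀ a → lenA a ≤ d → valA ρ ss xs (instA v π a) ≡ valA ρ' [] [] a
    valA-inst (same a b) le = cong₂ (λ s u → does (s ≟S u)) (valS-inst a (ℕ.m⊔n≤o⇒m≤o _ _ le))
        (valS-inst b (ℕ.m⊔n≤o⇒n≤o (maxL lenS a) _ le))
    valA-inst (size ψ a j) le = cong (λ s → j ≤ᵇ cnt ψ [] s) (valS-inst a le)
    valA-inst (card ψ Es j) le = cong (λ ts → does (card? ψ ts j)) args
      where
      args : Vec.map (valT ρ xs) (Vec.map (instT v π) Es) ≡ Vec.map (valT ρ' []) Es
      args = lookup-ext λ b → trans (Vec.lookup-map b (valT ρ xs) (Vec.map (instT v π) Es))
        (trans (cong (valT ρ xs) (Vec.lookup-map b (instT v π) Es)) (trans (valT-inst (lookup Es b)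
          (≤-trans (ℕ.≤-reflexive (sym (Vec.lookup-map b (maxL lenT) Es)))
              (≤-trans (lookup≤maxV (Vec.map (maxL lenT) Es) b) le)))
          (sym (Vec.lookup-map b (valT ρ' []) Es))))

    ev-inst : ∀ P → maxOf lenA (atoms P) ≤ d → ev (valA ρ ss xs) (bind P (atm ∘ instA v π)) ≡ ev (valA ρ' [] []) P
    ev-inst P le = trans (ev-bind P (atm ∘ instA v π))
        (ev-cong-∈ P λ a a∈ → valA-inst a (≤-trans (≤maxOf lenA a∈) le))

  -- Eliminating one quantifier

  qe1 : ℕ ⊎ ℕ → BF (Atom 0 0) → BF (Atom 0 0)
  qe1 v P = some (pats (maxOf lenA (atoms P))) λ rπ →
    elimS (proj₁ rπ) (elimT (proj₁ rπ) (Vec.allFin (proj₁ rπ)) (bind P (atm ∘ instA v (proj₂ rπ))))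

  sem : Env S → BF (Atom 0 0) → Bool
  sem ρ = ev (valA ρ [] [])

  qe1⁻ : ∀ ρ v P → Tr (sem ρ (qe1 v P)) → Σ Tm λ t → Tr (sem (setV ρ v t) P)
  qe1⁻ ρ v P h with some⁻ {e = valA ρ [] []} (pats (maxOf lenA (atoms P))) _ h
  ... | (r , π) , i , h₁ with elimS⁻ ρ r (elimT r (Vec.allFin r) (bind P (atm ∘ instA v π))) h₁
  ...   | ss , h₂ with elimT⁻ ρ ss r (Vec.allFin r) (bind P (atm ∘ instA v π)) h₂
  ...     | xs , coh , h₃ = valP xs π , trans (sym (ev-inst ρ v π (pats-deep _ i) ss xs coh P ≤-refl)) h₃

  qe1⁺ : ∀ ρ v P t → Tr (sem (setV ρ v t) P) → Tr (sem ρ (qe1 v P))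
  qe1⁺ ρ v P t h with match (maxOf lenA (atoms P)) t
  ... | (r , π) , i , xs , refl = some⁺ {e = valA ρ [] []} _ i (elimS⁺ ρ r _ ss (elimT⁺ ρ ss r (Vec.allFin r) _ xs coh
          (trans (ev-inst ρ v π (pats-deep _ i) ss xs coh P ≤-refl) h)))
    where
    ss = Vec.map (shape S) xs
    coh : Coherent (Vec.allFin r) ss xs
    coh j = sym (trans (cong (lookup ss) (Vec.lookup-allFin j)) (Vec.lookup-map j (shape S) xs))

  -- Translating expressions and their definedness

  -- A selector meeting a constructor is cancelled or, on a mismatch, dropped; afterwards selectors
  -- remain on outer variables only.
  selE : (f : Fin m) → Fin (ar f) → TE 0 → TE 0
  selE f k (leaf (to x p)) = leaf (to x (snoc p f k))
  selE f k (leaf (tcn c)) = leaf (tcn c)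
  selE f k (node g es) with g Fin.≟ f
  ... | yes refl = lookup es k
  ... | no _ = node g es

  selSE : (f : Fin m) → Fin (ar f) → SE 0 → SE 0
  selSE f k (leaf (so o p)) = leaf (so o (snoc p f k))
  selSE f k (leaf scn) = leaf scn
  selSE f k (node g es) with g Fin.≟ f
  ... | yes refl = lookup es k
  ... | no _ = node g es

  valT-selE : ∀ ρ f k E → valT ρ [] (selE f k E) ≡ selT f k (valT ρ [] E)
  valT-selE ρ f k (leaf (to x p)) = navT-snoc (tenv ρ x) p f k
  valT-selE ρ f k (leaf (tcn c)) = refl
  valT-selE ρ f k (node g es) with g Fin.≟ f
  ... | yes refl = sym (lookup-evalV _ _ _ es k)
  ... | no _ = refl

  valS-selSE : ∀ ρ f k E → valS ρ [] (selSE f k E) ≡ selSh f k (valS ρ [] E)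
  valS-selSE ρ f k (leaf (so o p)) = navS-snoc (outer ρ o) p f k
  valS-selSE ρ f k (leaf scn) = refl
  valS-selSE ρ f k (node g es) with g Fin.≟ f
  ... | yes refl = sym (lookup-evalV _ _ _ es k)
  ... | no _ = refl

  -- There is no atom for tests. A shape is headed by `f` exactly if it equals `f` applied to its
  -- own total selections.
  headS : Fin m → SE 0 → BF (Atom 0 0)
  headS f (leaf (so o p)) = atm (same (leaf (so o p)) (node f (tabulate λ k → leaf (so o (snoc p f k)))))
  headS f (leaf scn) = cst false
  headS f (node g es) = cst (does (g Fin.≟ f))

  headS⁻ : ∀ ρ f E → Tr (sem ρ (headS f E)) → IsAppS S f (valS ρ [] E)
  headS⁻ ρ f (leaf (so o p)) h = _ , does⁻ (navS (outer ρ o) p ≟S _) h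
  headS⁻ ρ f (node g es) h with g Fin.≟ f
  ... | yes refl = _ , refl

  headS⁺ : ∀ ρ f E → IsAppS S f (valS ρ [] E) → Tr (sem ρ (headS f E))
  headS⁺ ρ f (leaf (so o p)) (ss , e) = does⁺ (navS (outer ρ o) p ≟S _) (trans e (cong (fS f) (lookup-ext λ k →
    sym (trans (lookup-evalV _ _ _ (tabulate children) k) (trans (cong (valS ρ []) (Vec.lookup∘tabulate children k))
      (trans (navS-snoc (outer ρ o) p f k) (trans (cong (selSh f k) e) (selSh-fS f k ss))))))))
    where
    children : Fin (ar f) → SE 0
    children k = leaf (so o (snoc p f k))
  headS⁺ ρ f (node g es) (ss , e) with g Fin.≟ f
  ... | yes _ = refl
  headS⁺ ρ f (node .f es) (ss , refl) | no ne = ⊥-elim (ne refl)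

  shape0 : TE 0 → SE 0
  shape0 = shE []

  valS-shape0 : ∀ ρ E → valS ρ [] (shape0 E) ≡ shape S (valT ρ [] E)
  valS-shape0 ρ = valS-shE ρ {τ = []} {[]} {[]} (λ ())

  mutual
    texp : TExp S → TE 0
    texp (tv x) = leaf (to x [])
    texp (tc c) = leaf (tcn c)
    texp (tf f es) = node f (texps es)
    texp (tsel f k e) = selE f k (texp e)

    texps : ∀ {k} → Vec (TExp S) k → Vec (TE 0) k
    texps [] = []
    texps (e ∷ es) = texp e ∷ texps es

  mutual
    sexp : SExp S → SE 0
    sexp (sv x) = leaf (so (inj₂ x) [])
    sexp sc = leaf scn
    sexp (sf f es) = node f (sexps es)
    sexp (ssel f k e) = selSE f k (sexp e)
    sexp (sshape e) = shape0 (texp e)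

    sexps : ∀ {k} → Vec (SExp S) k → Vec (SE 0) k
    sexps [] = []
    sexps (e ∷ es) = sexp e ∷ sexps es

  mutual
    -- Selectors are the only source of undefinedness in expressions. The constructor at the head of
    -- a term is visible in its shape, so `headS` serves terms as well.
    tdef : TExp S → BF (Atom 0 0)
    tdef (tv x) = cst true
    tdef (tc c) = cst true
    tdef (tf f es) = tdefs es
    tdef (tsel f k e) = and (tdef e) (headS f (shape0 (texp e)))

    tdefs : ∀ {k} → Vec (TExp S) k → BF (Atom 0 0)
    tdefs [] = cst true
    tdefs (e ∷ es) = and (tdef e) (tdefs es)

  mutual
    sdef : SExp S → BF (Atom 0 0)
    sdef (sv x) = cst true
    sdef sc = cst true
    sdef (sf f es) = sdefs es
    sdef (ssel f k e) = and (sdef e) (headS f (sexp e))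
    sdef (sshape e) = tdef e

    sdefs : ∀ {k} → Vec (SExp S) k → BF (Atom 0 0)
    sdefs [] = cst true
    sdefs (e ∷ es) = and (sdef e) (sdefs es)

  IsAppS⇒IsApp : ∀ {f t} → IsAppS S f (shape S t) → IsApp S f t
  IsAppS⇒IsApp {t = t} (ss , e) with shape≡fS t e
  ... | ts , e' , _ = ts , e'

  IsApp⇒IsAppS : ∀ {f t} → IsApp S f t → IsAppS S f (shape S t)
  IsApp⇒IsAppS (ts , refl) = _ , refl

  sel-app : ∀ f k ts → sel S f k (app f ts) ≡ just (lookup ts k)
  sel-app f k ts with f Fin.≟ f
  ... | yes refl = refl
  ... | no ne = ⊥-elim (ne refl)

  selS-fS : ∀ f k ss → selS S f k (fS f ss) ≡ just (lookup ss k)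
  selS-fS f k ss with f Fin.≟ f
  ... | yes refl = refl
  ... | no ne = ⊥-elim (ne refl)

  sel-just : ∀ f k u {t} → sel S f k u ≡ just t → IsApp S f u
  sel-just f k (app g ts) e with g Fin.≟ f
  ... | yes refl = ts , refl

  selS-just : ∀ f k u {t} → selS S f k u ≡ just t → IsAppS S f u
  selS-just f k (fS g ss) e with g Fin.≟ f
  ... | yes refl = ss , refl

  module _ (ρ : Env S) where

    vT : TExp S → Tm
    vT e = valT ρ [] (texp e)

    vTs : ∀ {k} → Vec (TExp S) k → Vec Tm k
    vTs es = evalV app (leafT ρ) (lookup []) (texps es)

    vS : SExp S → Sh
    vS e = valS ρ [] (sexp e)

    vSs : ∀ {k} → Vec (SExp S) k → Vec Sh k
    vSs es = evalV fS (leafS ρ) (lookup []) (sexps es)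

    private
      E0 : Atom 0 0 → Bool
      E0 = valA ρ [] []

    mutual
      tdef⁻ : ∀ e → Tr (sem ρ (tdef e)) → evT S ρ e ≡ just (vT e)
      tdef⁻ (tv x) h = refl
      tdef⁻ (tc c) h = refl
      tdef⁻ (tf f es) h rewrite tdefs⁻ es h = refl
      tdef⁻ (tsel f k e) h with and⁻ {e = E0} (tdef e) (headS f (shape0 (texp e))) h
      ... | d , hd rewrite tdef⁻ e d with IsAppS⇒IsApp {t = vT e}
          (subst (IsAppS S f) (valS-shape0 ρ (texp e)) (headS⁻ ρ f (shape0 (texp e)) hd))
      ...   | ts , eq = trans (cong (sel S f k) eq) (trans (sel-app f k ts)
                (cong just (sym (trans (valT-selE ρ f k (texp e)) (trans (cong (selT f k) eq) (selT-app f k ts))))))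

      tdefs⁻ : ∀ {k} (es : Vec (TExp S) k) → Tr (sem ρ (tdefs es)) → evTs S ρ es ≡ just (vTs es)
      tdefs⁻ [] h = refl
      tdefs⁻ (e ∷ es) h with and⁻ {e = E0} (tdef e) (tdefs es) h
      ... | d , ds rewrite tdef⁻ e d | tdefs⁻ es ds = refl

    mutual
      tdef⁺ : ∀ e {t} → evT S ρ e ≡ just t → Tr (sem ρ (tdef e))
      tdef⁺ (tv x) h = refl
      tdef⁺ (tc c) h = refl
      tdef⁺ (tf f es) h with evTs S ρ es in eq
      ... | just ts = tdefs⁺ es eq
      tdef⁺ (tsel f k e) h with evT S ρ e in eq
      ... | just u = and⁺ {e = E0} {tdef e} {headS f (shape0 (texp e))} d
          (headS⁺ ρ f (shape0 (texp e)) (subst (IsAppS S f) (sym (valS-shape0 ρ (texp e)))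
              (IsApp⇒IsAppS (subst (IsApp S f) (just-injective (trans (sym eq) (tdef⁻ e d))) (sel-just f k u h)))))
        where d = tdef⁺ e eq

      tdefs⁺ : ∀ {k} (es : Vec (TExp S) k) {ts} → evTs S ρ es ≡ just ts → Tr (sem ρ (tdefs es))
      tdefs⁺ [] h = refl
      tdefs⁺ (e ∷ es) h with evT S ρ e in eq | evTs S ρ es in eqs
      ... | just t | just ts = and⁺ {e = E0} {tdef e} {tdefs es} (tdef⁺ e eq) (tdefs⁺ es eqs)

    mutual
      sdef⁻ : ∀ e → Tr (sem ρ (sdef e)) → evS S ρ e ≡ just (vS e)
      sdef⁻ (sv x) h = refl
      sdef⁻ sc h = refl
      sdef⁻ (sf f es) h rewrite sdefs⁻ es h = refl
      sdef⁻ (sshape e) h rewrite tdef⁻ e h = cong just (sym (valS-shape0 ρ (texp e)))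
      sdef⁻ (ssel f k e) h with and⁻ {e = E0} (sdef e) (headS f (sexp e)) h
      ... | d , hd rewrite sdef⁻ e d with headS⁻ ρ f (sexp e) hd
      ...   | ss , eq = trans (cong (selS S f k) eq) (trans (selS-fS f k ss)
                (cong just (sym (trans (valS-selSE ρ f k (sexp e)) (trans (cong (selSh f k) eq) (selSh-fS f k ss))))))

      sdefs⁻ : ∀ {k} (es : Vec (SExp S) k) → Tr (sem ρ (sdefs es)) → evSs S ρ es ≡ just (vSs es)
      sdefs⁻ [] h = refl
      sdefs⁻ (e ∷ es) h with and⁻ {e = E0} (sdef e) (sdefs es) h
      ... | d , ds rewrite sdef⁻ e d | sdefs⁻ es ds = refl

    mutual
      sdef⁺ : ∀ e {t} → evS S ρ e ≡ just t → Tr (sem ρ (sdef e))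
      sdef⁺ (sv x) h = refl
      sdef⁺ sc h = refl
      sdef⁺ (sf f es) h with evSs S ρ es in eq
      ... | just ss = sdefs⁺ es eq
      sdef⁺ (sshape e) h with evT S ρ e in eq
      ... | just t = tdef⁺ e eq
      sdef⁺ (ssel f k e) h with evS S ρ e in eq
      ... | just u = and⁺ {e = E0} {sdef e} {headS f (sexp e)} d (headS⁺ ρ f (sexp e)
              (subst (IsAppS S f) (just-injective (trans (sym eq) (sdef⁻ e d))) (selS-just f k u h)))
        where d = sdef⁺ e eq

      sdefs⁺ : ∀ {k} (es : Vec (SExp S) k) {ss} → evSs S ρ es ≡ just ss → Tr (sem ρ (sdefs es))
      sdefs⁺ [] h = refl
      sdefs⁺ (e ∷ es) h with evS S ρ e in eq | evSs S ρ es in eqs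
      ... | just s | just ss = and⁺ {e = E0} {sdef e} {sdefs es} (sdef⁺ e eq) (sdefs⁺ es eqs)

    vT≡ : ∀ e {t} → evT S ρ e ≡ just t → vT e ≡ t
    vT≡ e h = just-injective (trans (sym (tdef⁻ e (tdef⁺ e h))) h)

    vTs≡ : ∀ {k} (es : Vec (TExp S) k) {ts} → evTs S ρ es ≡ just ts → vTs es ≡ ts
    vTs≡ es h = just-injective (trans (sym (tdefs⁻ es (tdefs⁺ es h))) h)

    vS≡ : ∀ e {t} → evS S ρ e ≡ just t → vS e ≡ t
    vS≡ e h = just-injective (trans (sym (sdef⁻ e (sdef⁺ e h))) h)

  -- Equality of terms: equal shapes and no leaf with different labels.

  ++-cancel : ∀ {A : Set} (as bs : List A) {as' bs'} → length as ≡ length bs → as ++ as' ≡ bs ++ bs' → as ≡ bs × as'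
      ≡ bs'
  ++-cancel [] [] l e = refl , e
  ++-cancel (a ∷ as) (b ∷ bs) l e with ++-cancel as bs (suc-injective l) (List.∷-injectiveʳ e)
  ... | p , q = cong₂ _∷_ (List.∷-injectiveˡ e) p , q

  mutual
    labs-injective : ∀ t u → shape S t ≡ shape S u → labs t ≡ labs u → t ≡ u
    labs-injective (con c) (con d) p q = cong con (List.∷-injectiveˡ q)
    labs-injective (app f ts) (app g us) p q with fS-head p
    ... | refl = cong (app f) (labsV-injective ts us (fS-injective p) q)

    labsV-injective : ∀ {k} (ts us : Vec Tm k) → shapeV S ts ≡ shapeV S us → labsV ts ≡ labsV us → ts ≡ us
    labsV-injective [] [] p q = refl
    labsV-injective (t ∷ ts) (u ∷ us) p q with ++-cancel (labs t) (labs u)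
      (trans (length-labs t) (trans (cong (length ∘ signs) (Vec.∷-injectiveˡ p)) (sym (length-labs u)))) q
    ... | q₁ , q₂ = cong₂ _∷_ (labs-injective t u (Vec.∷-injectiveˡ p) q₁)
        (labsV-injective ts us (Vec.∷-injectiveʳ p) q₂)

  unequal : LF 2
  unequal = lnot (leq zero (suc zero))

  evalR-unequal : ∀ σ c d → evalR unequal (σ , c ∷ d ∷ []) ≡ not (does (c Fin.≟ d))
  evalR-unequal Sg.+ c d = refl
  evalR-unequal Sg.- c d = refl

  unequal⁻ : ∀ cs ds (R : List (Row 0)) → length cs ≡ length R → length ds ≡ length R →
    cntR (evalR unequal) (zipRow cs (zipRow ds R)) ≡ 0 → cs ≡ ds
  unequal⁻ [] [] [] p q h = refl
  unequal⁻ (c ∷ cs) (d ∷ ds) ((σ , []) ∷ R) p q h rewrite evalR-unequal σ c d with c Fin.≟ d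
  ... | yes refl = cong (c ∷_) (unequal⁻ cs ds R (suc-injective p) (suc-injective q) h)

  unequal⁺ : ∀ cs (R : List (Row 0)) → cntR (evalR unequal) (zipRow cs (zipRow cs R)) ≡ 0
  unequal⁺ [] R = refl
  unequal⁺ (c ∷ cs) [] = refl
  unequal⁺ (c ∷ cs) ((σ , []) ∷ R) rewrite evalR-unequal σ c c | does⁺ (c Fin.≟ c) refl = unequal⁺ cs R

  eqF : TE 0 → TE 0 → BF (Atom 0 0)
  eqF A B = and (atm (same (shape0 A) (shape0 B))) (neg (atm (card unequal (A ∷ B ∷ []) 1)))

  eqF⁻ : ∀ ρ A B → Tr (sem ρ (eqF A B)) → valT ρ [] A ≡ valT ρ [] B
  eqF⁻ ρ A B h with and⁻ {e = valA ρ [] []} (atm (same (shape0 A) (shape0 B)))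
      (neg (atm (card unequal (A ∷ B ∷ []) 1))) h
  ... | h₁ , h₂ = labs-injective a b sh (unequal⁻ (labs a) (labs b) (rows [] (shape S a))
          (trans (length-labs a) (sym (length-rows [] (shape S a) [])))
              (trans (length-labs b) (trans (cong (length ∘ signs) (sym sh)) (sym (length-rows [] (shape S a) []))))
          (ℕ.n<1⇒n≡0 (ℕ.≰⇒> λ le → neg⁻ {e = valA ρ [] []} (atm (card unequal (A ∷ B ∷ []) 1)) h₂
              (does⁺ (card? unequal (a ∷ b ∷ []) 1) (refl ∷ sym sh ∷ [] , le)))))
    where
    a = valT ρ [] A
    b = valT ρ [] B
    sh : shape S a ≡ shape S b
    sh = trans (sym (valS-shape0 ρ A))
        (trans (does⁻ (valS ρ [] (shape0 A) ≟S valS ρ [] (shape0 B)) h₁) (valS-shape0 ρ B))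

  eqF⁺ : ∀ ρ A B → valT ρ [] A ≡ valT ρ [] B → Tr (sem ρ (eqF A B))
  eqF⁺ ρ A B e = and⁺ {e = valA ρ [] []} {atm (same (shape0 A) (shape0 B))} {neg (atm (card unequal (A ∷ B ∷ []) 1))}
    (does⁺ (valS ρ [] (shape0 A) ≟S valS ρ [] (shape0 B))
        (trans (valS-shape0 ρ A) (trans (cong (shape S) e) (sym (valS-shape0 ρ B)))))
    (neg⁺ {e = valA ρ [] []} (atm (card unequal (A ∷ B ∷ []) 1)) λ h →
        differ e (proj₂ (does⁻ (card? unequal (valT ρ [] A ∷ valT ρ [] B ∷ []) 1) h)))
    where
    differ : ∀ {a b} → a ≡ b → ¬ (1 ≤ cnt unequal (a ∷ b ∷ []) (shape S a))
    differ {a} refl le with cnt unequal (a ∷ a ∷ []) (shape S a) | unequal⁺ (labs a) (rows [] (shape S a))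
    differ refl () | .0 | refl

  -- Translating formulas

  -- Definedness of a cardinality relation. It is a conjunct of `T` and of `F` alike, because the
  -- atom `card` is false, not undefined, when shapes differ.
  cargs : ∀ {k} → Vec (TExp S) k → SExp S → BF (Atom 0 0)
  cargs {k} es se = and (tdefs es)
      (and (sdef se) (every (allFin k) (λ b → atm (same (shape0 (lookup (texps es) b)) (sexp se)))))

  cardF : ∀ {k} → LF k → Vec (TE 0) k → SE 0 → ℕ → BF (Atom 0 0)
  cardF {zero} ψ Es E j = atm (size ψ E j)
  cardF {suc k} ψ Es E j = atm (card ψ Es j)

  exactF : ∀ {k} → LF k → Vec (TE 0) k → SE 0 → ℕ → BF (Atom 0 0)
  exactF ψ Es E j = and (cardF ψ Es E j) (neg (cardF ψ Es E (suc j)))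

  module _ (ρ : Env S) {k} (es : Vec (TExp S) k) (se : SExp S) where

    private
      E0 : Atom 0 0 → Bool
      E0 = valA ρ [] []

      shapesF : BF (Atom 0 0)
      shapesF = every (allFin k) (λ b → atm (same (shape0 (lookup (texps es) b)) (sexp se)))

      shape-at : ∀ b → valS ρ [] (shape0 (lookup (texps es) b)) ≡ shape S (lookup (vTs ρ es) b)
      shape-at b = trans (valS-shape0 ρ (lookup (texps es) b))
          (cong (shape S) (sym (lookup-evalV _ _ _ (texps es) b)))

    cargs⁻ : Tr (sem ρ (cargs es se)) → evTs S ρ es ≡ just (vTs ρ es) × evS S ρ se ≡ just (vS ρ se) ×
        All (λ t → shape S t ≡ vS ρ se) (vTs ρ es)
    cargs⁻ h with and⁻ {e = E0} (tdefs es) (and (sdef se) shapesF) h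
    ... | d , h' with and⁻ {e = E0} (sdef se) shapesF h'
    ...   | d' , h″ = tdefs⁻ ρ es d , sdef⁻ ρ se d' , all-lookup (vTs ρ es) λ b → trans (sym (shape-at b))
              (does⁻ (valS ρ [] (shape0 (lookup (texps es) b)) ≟S vS ρ se)
                  (every⁻ {e = E0} (λ b → atm (same (shape0 (lookup (texps es) b)) (sexp se))) h″ (∈-allFin b)))

    cargs⁺ : ∀ {ts s} → evTs S ρ es ≡ just ts → evS S ρ se ≡ just s → All (λ t → shape S t ≡ s) ts →
        Tr (sem ρ (cargs es se))
    cargs⁺ et es' ps = and⁺ {e = E0} {tdefs es} {and (sdef se) shapesF} (tdefs⁺ ρ es et)
        (and⁺ {e = E0} {sdef se} {shapesF} (sdef⁺ ρ se es')
      (every⁺ {e = E0} (allFin k) _ λ {b} _ → does⁺ (valS ρ [] (shape0 (lookup (texps es) b)) ≟S vS ρ se)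
        (trans (shape-at b) (trans (cong (λ ts → shape S (lookup ts b)) (vTs≡ ρ es et))
            (trans (all-at ps b) (sym (vS≡ ρ se es')))))))

  sem-cardF : ∀ ρ {k} (ψ : LF k) (Es : Vec (TE 0) k) E j →
      All (λ t → shape S t ≡ valS ρ [] E) (evalV app (leafT ρ) (lookup []) Es) →
    sem ρ (cardF ψ Es E j) ≡ (j ≤ᵇ count S ψ (evalV app (leafT ρ) (lookup []) Es) (valS ρ [] E))
  sem-cardF ρ {zero} ψ [] E j ps = cong (j ≤ᵇ_) (sym (count≡cnt ψ [] (valS ρ [] E) []))
  sem-cardF ρ {suc k} ψ (A ∷ Es) E j (p ∷ ps) = Tr⇒≡
      (λ h → ≤ᵇ⁺ (subst (j ≤_) (trans (cong₂ (cnt ψ) (sym vals) p) (sym (count≡cnt ψ _ _ (p ∷ ps))))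
          (proj₂ (does⁻ (card? ψ (Vec.map (valT ρ []) (A ∷ Es)) j) h))))
      (λ h → does⁺ (card? ψ (Vec.map (valT ρ []) (A ∷ Es)) j)
          (subst (λ ts → All (λ t → shape S t ≡ shape S (valT ρ [] A)) ts) vals
          (VAll.map (λ e → trans e (sym p)) (p ∷ ps)) ,
        subst (j ≤_) (trans (count≡cnt ψ _ _ (p ∷ ps)) (cong₂ (cnt ψ) vals (sym p))) (≤ᵇ⁻ h)))
    where
    vals : evalV app (leafT ρ) (lookup []) (A ∷ Es) ≡ Vec.map (valT ρ []) (A ∷ Es)
    vals = evalV-map _ _ _ (A ∷ Es)

  mutual
    -- T φ and F φ express that φ is true and that φ is false; both fail if φ is undefined.
    T F : Formula S → BF (Atom 0 0)
    T (eqT a b) = and (tdef a) (and (tdef b) (eqF (texp a) (texp b)))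
    T (eqS a b) = and (sdef a) (and (sdef b) (atm (same (sexp a) (sexp b))))
    T (isT f a) = and (tdef a) (headS f (shape0 (texp a)))
    T (isS f a) = and (sdef a) (headS f (sexp a))
    T (cardEq ψ es se j) = and (cargs es se) (exactF ψ (texps es) (sexp se) j)
    T (cardGe ψ es se j) = and (cargs es se) (cardF ψ (texps es) (sexp se) j)
    T (fnot φ) = F φ
    T (fand φ ψ) = and (T φ) (T ψ)
    T (for φ ψ) = or (T φ) (T ψ)
    T (allT x φ) = neg (qe1 (inj₁ x) (neg (T φ)))
    T (exT x φ) = qe1 (inj₁ x) (T φ)
    T (allS x φ) = neg (qe1 (inj₂ x) (neg (T φ)))
    T (exS x φ) = qe1 (inj₂ x) (T φ)

    F (eqT a b) = and (tdef a) (and (tdef b) (neg (eqF (texp a) (texp b))))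
    F (eqS a b) = and (sdef a) (and (sdef b) (neg (atm (same (sexp a) (sexp b)))))
    F (isT f a) = and (tdef a) (neg (headS f (shape0 (texp a))))
    F (isS f a) = and (sdef a) (neg (headS f (sexp a)))
    F (cardEq ψ es se j) = and (cargs es se) (neg (exactF ψ (texps es) (sexp se) j))
    F (cardGe ψ es se j) = and (cargs es se) (neg (cardF ψ (texps es) (sexp se) j))
    F (fnot φ) = T φ
    F (fand φ ψ) = or (F φ) (F ψ)
    F (for φ ψ) = and (F φ) (F ψ)
    F (allT x φ) = qe1 (inj₁ x) (F φ)
    F (exT x φ) = neg (qe1 (inj₁ x) (neg (F φ)))
    F (allS x φ) = qe1 (inj₂ x) (F φ)
    F (exS x φ) = neg (qe1 (inj₂ x) (neg (F φ)))

  mutual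
    someLabel : Tm → Fin n
    someLabel (con c) = c
    someLabel (app f ts) = someLabelV ts (ar≥1 f)

    someLabelV : ∀ {k} → Vec Tm k → 1 ≤ k → Fin n
    someLabelV (t ∷ ts) _ = someLabel t

  -- A label is taken from the valuation: it supplies a term, and positive arities give every term a
  -- leaf. Over an empty carrier there are no terms and hence no valuations.
  shape-onto : Env S → ∀ s → Σ Tm λ t → shape S t ≡ s
  shape-onto ρ s with label s (List.map (λ _ → someLabel (tenv ρ 0)) (signs s)) (List.length-map _ (signs s))
  ... | t , e , _ = t , e

  module _ (ρ : Env S) where

    private
      E0 : Atom 0 0 → Bool
      E0 = valA ρ [] []

    and₃⁻ : ∀ P Q R → Tr (sem ρ (and P (and Q R))) → Tr (sem ρ P) × Tr (sem ρ Q) × Tr (sem ρ R)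
    and₃⁻ P Q R h with and⁻ {e = E0} P (and Q R) h
    ... | p , h' with and⁻ {e = E0} Q R h'
    ...   | q , r = p , q , r

    and₃⁺ : ∀ P Q R → Tr (sem ρ P) → Tr (sem ρ Q) → Tr (sem ρ R) → Tr (sem ρ (and P (and Q R)))
    and₃⁺ P Q R p q r = and⁺ {e = E0} {P} {and Q R} p (and⁺ {e = E0} {Q} {R} q r)

    all⁻ : ∀ v P → Tr (sem ρ (neg (qe1 v (neg P)))) → ∀ t → Tr (sem (setV ρ v t) P)
    all⁻ v P h t = decidable-stable (_ Bool.≟ true) λ ne →
      neg⁻ {e = E0} (qe1 v (neg P)) h (qe1⁺ ρ v (neg P) t (neg⁺ {e = valA (setV ρ v t) [] []} P ne))

    all⁺ : ∀ v P → (∀ t → Tr (sem (setV ρ v t) P)) → Tr (sem ρ (neg (qe1 v (neg P))))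
    all⁺ v P h = neg⁺ {e = E0} (qe1 v (neg P)) λ q → let t , ne = qe1⁻ ρ v (neg P) q in
      neg⁻ {e = valA (setV ρ v t) [] []} P ne (h t)

    exactF⁻ : ∀ {k} (ψ : LF k) Es E j → All (λ t → shape S t ≡ valS ρ [] E) (evalV app (leafT ρ) (lookup []) Es) →
      Tr (sem ρ (exactF ψ Es E j)) → count S ψ (evalV app (leafT ρ) (lookup []) Es) (valS ρ [] E) ≡ j
    exactF⁻ ψ Es E j ps h with and⁻ {e = E0} (cardF ψ Es E j) (neg (cardF ψ Es E (suc j))) h
    ... | ge , ng = ℕ.≤-antisym (ℕ.≮⇒≥ λ lt →
        neg⁻ {e = E0} (cardF ψ Es E (suc j)) ng (trans (sem-cardF ρ ψ Es E (suc j) ps) (≤ᵇ⁺ lt)))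
            (≤ᵇ⁻ (trans (sym (sem-cardF ρ ψ Es E j ps)) ge))

    exactF⁺ : ∀ {k} (ψ : LF k) Es E j → All (λ t → shape S t ≡ valS ρ [] E) (evalV app (leafT ρ) (lookup []) Es) →
      count S ψ (evalV app (leafT ρ) (lookup []) Es) (valS ρ [] E) ≡ j → Tr (sem ρ (exactF ψ Es E j))
    exactF⁺ ψ Es E j ps e = and⁺ {e = E0} {cardF ψ Es E j} {neg (cardF ψ Es E (suc j))}
      (trans (sem-cardF ρ ψ Es E j ps) (≤ᵇ⁺ (ℕ.≤-reflexive (sym e))))
      (neg⁺ {e = E0} (cardF ψ Es E (suc j)) λ h →
          ℕ.<-irrefl (sym e) (≤ᵇ⁻ {suc j} (trans (sym (sem-cardF ρ ψ Es E (suc j) ps)) h)))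

  module _ {k} (es : Vec (TExp S) k) (se : SExp S) (ρ : Env S) (P : BF (Atom 0 0)) (Q : Vec Tm k → Sh → Set) where

    cardArgs⁻ : (All (λ t → shape S t ≡ vS ρ se) (vTs ρ es) → Tr (sem ρ P) → Q (vTs ρ es) (vS ρ se)) →
      Tr (sem ρ (and (cargs es se) P)) → CardArgs S ρ es se Q
    cardArgs⁻ h p with and⁻ {e = valA ρ [] []} (cargs es se) P p
    ... | c , p' with cargs⁻ ρ es se c
    ...   | et , es' , ps = _ , _ , et , es' , ps , h ps p'

    cardArgs⁺ : (All (λ t → shape S t ≡ vS ρ se) (vTs ρ es) → Q (vTs ρ es) (vS ρ se) → Tr (sem ρ P)) →
      CardArgs S ρ es se Q → Tr (sem ρ (and (cargs es se) P))
    cardArgs⁺ h (ts , s , et , es' , ps , q) = and⁺ {e = valA ρ [] []} {cargs es se} {P} c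
      (h (proj₂ (proj₂ (cargs⁻ ρ es se c))) (subst₂ Q (sym (vTs≡ ρ es et)) (sym (vS≡ ρ se es')) q))
      where c = cargs⁺ ρ es se et es' ps

  mutual
    T⁻ : ∀ φ ρ → Tr (sem ρ (T φ)) → IsTrue S φ ρ
    T⁻ (eqT a b) ρ h with and₃⁻ ρ (tdef a) (tdef b) (eqF (texp a) (texp b)) h
    ... | da , db , e = _ , _ , tdef⁻ ρ a da , tdef⁻ ρ b db , eqF⁻ ρ (texp a) (texp b) e
    T⁻ (eqS a b) ρ h with and₃⁻ ρ (sdef a) (sdef b) (atm (same (sexp a) (sexp b))) h
    ... | da , db , e = _ , _ , sdef⁻ ρ a da , sdef⁻ ρ b db , does⁻ (vS ρ a ≟S vS ρ b) e
    T⁻ (isT f a) ρ h with and⁻ {e = valA ρ [] []} (tdef a) (headS f (shape0 (texp a))) h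
    ... | d , e = _ , tdef⁻ ρ a d ,
        IsAppS⇒IsApp (subst (IsAppS S f) (valS-shape0 ρ (texp a)) (headS⁻ ρ f (shape0 (texp a)) e))
    T⁻ (isS f a) ρ h with and⁻ {e = valA ρ [] []} (sdef a) (headS f (sexp a)) h
    ... | d , e = _ , sdef⁻ ρ a d , headS⁻ ρ f (sexp a) e
    T⁻ (cardEq ψ es se j) ρ = cardArgs⁻ es se ρ (exactF ψ (texps es) (sexp se) j) _
        (exactF⁻ ρ ψ (texps es) (sexp se) j)
    T⁻ (cardGe ψ es se j) ρ = cardArgs⁻ es se ρ (cardF ψ (texps es) (sexp se) j) _ λ ps h →
        ≤ᵇ⁻ (trans (sym (sem-cardF ρ ψ (texps es) (sexp se) j ps)) h)
    T⁻ (fnot φ) ρ h = F⁻ φ ρ h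
    T⁻ (fand φ ψ) ρ h with and⁻ {e = valA ρ [] []} (T φ) (T ψ) h
    ... | p , q = T⁻ φ ρ p , T⁻ ψ ρ q
    T⁻ (for φ ψ) ρ h with or⁻ {e = valA ρ [] []} (T φ) (T ψ) h
    ... | inj₁ p = inj₁ (T⁻ φ ρ p)
    ... | inj₂ q = inj₂ (T⁻ ψ ρ q)
    T⁻ (allT x φ) ρ h t = T⁻ φ _ (all⁻ ρ (inj₁ x) (T φ) h t)
    T⁻ (exT x φ) ρ h with qe1⁻ ρ (inj₁ x) (T φ) h
    ... | t , p = t , T⁻ φ _ p
    T⁻ (allS x φ) ρ h s with shape-onto ρ s
    ... | t , refl = T⁻ φ _ (all⁻ ρ (inj₂ x) (T φ) h t)
    T⁻ (exS x φ) ρ h with qe1⁻ ρ (inj₂ x) (T φ) h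
    ... | t , p = shape S t , T⁻ φ _ p

    T⁺ : ∀ φ ρ → IsTrue S φ ρ → Tr (sem ρ (T φ))
    T⁺ (eqT a b) ρ (u , v , ea , eb , e) =
        and₃⁺ ρ (tdef a) (tdef b) (eqF (texp a) (texp b)) (tdef⁺ ρ a ea) (tdef⁺ ρ b eb)
      (eqF⁺ ρ (texp a) (texp b) (trans (vT≡ ρ a ea) (trans e (sym (vT≡ ρ b eb)))))
    T⁺ (eqS a b) ρ (u , v , ea , eb , e) =
        and₃⁺ ρ (sdef a) (sdef b) (atm (same (sexp a) (sexp b))) (sdef⁺ ρ a ea) (sdef⁺ ρ b eb)
      (does⁺ (vS ρ a ≟S vS ρ b) (trans (vS≡ ρ a ea) (trans e (sym (vS≡ ρ b eb)))))
    T⁺ (isT f a) ρ (u , ea , e) = and⁺ {e = valA ρ [] []} {tdef a} {headS f (shape0 (texp a))} (tdef⁺ ρ a ea)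
      (headS⁺ ρ f (shape0 (texp a)) (subst (IsAppS S f)
          (sym (trans (valS-shape0 ρ (texp a)) (cong (shape S) (vT≡ ρ a ea)))) (IsApp⇒IsAppS e)))
    T⁺ (isS f a) ρ (u , ea , e) = and⁺ {e = valA ρ [] []} {sdef a} {headS f (sexp a)} (sdef⁺ ρ a ea)
      (headS⁺ ρ f (sexp a) (subst (IsAppS S f) (sym (vS≡ ρ a ea)) e))
    T⁺ (cardEq ψ es se j) ρ = cardArgs⁺ es se ρ (exactF ψ (texps es) (sexp se) j) (λ ts s → count S ψ ts s ≡ j)
        (exactF⁺ ρ ψ (texps es) (sexp se) j)
    T⁺ (cardGe ψ es se j) ρ = cardArgs⁺ es se ρ (cardF ψ (texps es) (sexp se) j) (λ ts s → j ≤ count S ψ ts s) λ ps h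
        → trans (sem-cardF ρ ψ (texps es) (sexp se) j ps) (≤ᵇ⁺ h)
    T⁺ (fnot φ) ρ h = F⁺ φ ρ h
    T⁺ (fand φ ψ) ρ (p , q) = and⁺ {e = valA ρ [] []} {T φ} {T ψ} (T⁺ φ ρ p) (T⁺ ψ ρ q)
    T⁺ (for φ ψ) ρ (inj₁ p) = or⁺ˡ {e = valA ρ [] []} (T φ) (T ψ) (T⁺ φ ρ p)
    T⁺ (for φ ψ) ρ (inj₂ q) = or⁺ʳ {e = valA ρ [] []} (T φ) (T ψ) (T⁺ ψ ρ q)
    T⁺ (allT x φ) ρ h = all⁺ ρ (inj₁ x) (T φ) λ t → T⁺ φ _ (h t)
    T⁺ (exT x φ) ρ (t , h) = qe1⁺ ρ (inj₁ x) (T φ) t (T⁺ φ _ h)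
    T⁺ (allS x φ) ρ h = all⁺ ρ (inj₂ x) (T φ) λ t → T⁺ φ _ (h (shape S t))
    T⁺ (exS x φ) ρ (s , h) with shape-onto ρ s
    ... | t , refl = qe1⁺ ρ (inj₂ x) (T φ) t (T⁺ φ _ h)

    F⁻ : ∀ φ ρ → Tr (sem ρ (F φ)) → IsFalse S φ ρ
    F⁻ (eqT a b) ρ h with and₃⁻ ρ (tdef a) (tdef b) (neg (eqF (texp a) (texp b))) h
    ... | da , db , e = _ , _ , tdef⁻ ρ a da , tdef⁻ ρ b db , λ q →
        neg⁻ {e = valA ρ [] []} (eqF (texp a) (texp b)) e (eqF⁺ ρ (texp a) (texp b) q)
    F⁻ (eqS a b) ρ h with and₃⁻ ρ (sdef a) (sdef b) (neg (atm (same (sexp a) (sexp b)))) h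
    ... | da , db , e = _ , _ , sdef⁻ ρ a da , sdef⁻ ρ b db , λ q →
        neg⁻ {e = valA ρ [] []} (atm (same (sexp a) (sexp b))) e (does⁺ (vS ρ a ≟S vS ρ b) q)
    F⁻ (isT f a) ρ h with and⁻ {e = valA ρ [] []} (tdef a) (neg (headS f (shape0 (texp a)))) h
    ... | d , e = _ , tdef⁻ ρ a d , λ q → neg⁻ {e = valA ρ [] []} (headS f (shape0 (texp a))) e
            (headS⁺ ρ f (shape0 (texp a)) (subst (IsAppS S f) (sym (valS-shape0 ρ (texp a))) (IsApp⇒IsAppS q)))
    F⁻ (isS f a) ρ h with and⁻ {e = valA ρ [] []} (sdef a) (neg (headS f (sexp a))) h
    ... | d , e = _ , sdef⁻ ρ a d , λ q → neg⁻ {e = valA ρ [] []} (headS f (sexp a)) e (headS⁺ ρ f (sexp a) q)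
    F⁻ (cardEq ψ es se j) ρ = cardArgs⁻ es se ρ (neg (exactF ψ (texps es) (sexp se) j)) _ λ ps h q →
      neg⁻ {e = valA ρ [] []} (exactF ψ (texps es) (sexp se) j) h (exactF⁺ ρ ψ (texps es) (sexp se) j ps q)
    F⁻ (cardGe ψ es se j) ρ = cardArgs⁻ es se ρ (neg (cardF ψ (texps es) (sexp se) j)) _ λ ps h q →
      neg⁻ {e = valA ρ [] []} (cardF ψ (texps es) (sexp se) j) h
          (trans (sem-cardF ρ ψ (texps es) (sexp se) j ps) (≤ᵇ⁺ q))
    F⁻ (fnot φ) ρ h = T⁻ φ ρ h
    F⁻ (fand φ ψ) ρ h with or⁻ {e = valA ρ [] []} (F φ) (F ψ) h
    ... | inj₁ p = inj₁ (F⁻ φ ρ p)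
    ... | inj₂ q = inj₂ (F⁻ ψ ρ q)
    F⁻ (for φ ψ) ρ h with and⁻ {e = valA ρ [] []} (F φ) (F ψ) h
    ... | p , q = F⁻ φ ρ p , F⁻ ψ ρ q
    F⁻ (allT x φ) ρ h with qe1⁻ ρ (inj₁ x) (F φ) h
    ... | t , p = t , F⁻ φ _ p
    F⁻ (exT x φ) ρ h t = F⁻ φ _ (all⁻ ρ (inj₁ x) (F φ) h t)
    F⁻ (allS x φ) ρ h with qe1⁻ ρ (inj₂ x) (F φ) h
    ... | t , p = shape S t , F⁻ φ _ p
    F⁻ (exS x φ) ρ h s with shape-onto ρ s
    ... | t , refl = F⁻ φ _ (all⁻ ρ (inj₂ x) (F φ) h t)

    F⁺ : ∀ φ ρ → IsFalse S φ ρ → Tr (sem ρ (F φ))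
    F⁺ (eqT a b) ρ (u , v , ea , eb , e) =
        and₃⁺ ρ (tdef a) (tdef b) (neg (eqF (texp a) (texp b))) (tdef⁺ ρ a ea) (tdef⁺ ρ b eb)
      (neg⁺ {e = valA ρ [] []} (eqF (texp a) (texp b)) λ h →
          e (trans (sym (vT≡ ρ a ea)) (trans (eqF⁻ ρ (texp a) (texp b) h) (vT≡ ρ b eb))))
    F⁺ (eqS a b) ρ (u , v , ea , eb , e) =
        and₃⁺ ρ (sdef a) (sdef b) (neg (atm (same (sexp a) (sexp b)))) (sdef⁺ ρ a ea) (sdef⁺ ρ b eb)
      (neg⁺ {e = valA ρ [] []} (atm (same (sexp a) (sexp b))) λ h →
          e (trans (sym (vS≡ ρ a ea)) (trans (does⁻ (vS ρ a ≟S vS ρ b) h) (vS≡ ρ b eb))))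
    F⁺ (isT f a) ρ (u , ea , e) = and⁺ {e = valA ρ [] []} {tdef a} {neg (headS f (shape0 (texp a)))} (tdef⁺ ρ a ea)
      (neg⁺ {e = valA ρ [] []} (headS f (shape0 (texp a))) λ h →
          e (IsAppS⇒IsApp (subst (IsAppS S f) (trans (valS-shape0 ρ (texp a)) (cong (shape S) (vT≡ ρ a ea)))
          (headS⁻ ρ f (shape0 (texp a)) h))))
    F⁺ (isS f a) ρ (u , ea , e) = and⁺ {e = valA ρ [] []} {sdef a} {neg (headS f (sexp a))} (sdef⁺ ρ a ea)
      (neg⁺ {e = valA ρ [] []} (headS f (sexp a)) λ h → e (subst (IsAppS S f) (vS≡ ρ a ea) (headS⁻ ρ f (sexp a) h)))
    F⁺ (cardEq ψ es se j) ρ = cardArgs⁺ es se ρ (neg (exactF ψ (texps es) (sexp se) j)) (λ ts s → count S ψ ts s ≢ j)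
        λ ps q →
      neg⁺ {e = valA ρ [] []} (exactF ψ (texps es) (sexp se) j) λ h → q (exactF⁻ ρ ψ (texps es) (sexp se) j ps h)
    F⁺ (cardGe ψ es se j) ρ = cardArgs⁺ es se ρ (neg (cardF ψ (texps es) (sexp se) j))
        (λ ts s → ¬ (j ≤ count S ψ ts s)) λ ps q →
      neg⁺ {e = valA ρ [] []} (cardF ψ (texps es) (sexp se) j) λ h →
          q (≤ᵇ⁻ (trans (sym (sem-cardF ρ ψ (texps es) (sexp se) j ps)) h))
    F⁺ (fnot φ) ρ h = T⁺ φ ρ h
    F⁺ (fand φ ψ) ρ (inj₁ p) = or⁺ˡ {e = valA ρ [] []} (F φ) (F ψ) (F⁺ φ ρ p)
    F⁺ (fand φ ψ) ρ (inj₂ q) = or⁺ʳ {e = valA ρ [] []} (F φ) (F ψ) (F⁺ ψ ρ q)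
    F⁺ (for φ ψ) ρ (p , q) = and⁺ {e = valA ρ [] []} {F φ} {F ψ} (F⁺ φ ρ p) (F⁺ ψ ρ q)
    F⁺ (allT x φ) ρ (t , h) = qe1⁺ ρ (inj₁ x) (F φ) t (F⁺ φ _ h)
    F⁺ (exT x φ) ρ h = all⁺ ρ (inj₁ x) (F φ) λ t → F⁺ φ _ (h t)
    F⁺ (allS x φ) ρ (s , h) with shape-onto ρ s
    ... | t , refl = qe1⁺ ρ (inj₂ x) (F φ) t (F⁺ φ _ h)
    F⁺ (exS x φ) ρ h = all⁺ ρ (inj₂ x) (F φ) λ t → F⁺ φ _ (h (shape S t))

  -- Back to formulas: a total selector is resolved by a case distinction.

  Val : Formula S → Env S → Bool → Set
  Val φ ρ true = IsTrue S φ ρ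
  Val φ ρ false = IsFalse S φ ρ

  Val-not : ∀ {φ ρ} b → Val φ ρ b → Val (fnot φ) ρ (not b)
  Val-not true h = h
  Val-not false h = h

  Val-and : ∀ {φ ψ ρ} a b → Val φ ρ a → Val ψ ρ b → Val (fand φ ψ) ρ (a ∧ b)
  Val-and true true p q = p , q
  Val-and true false p q = inj₂ q
  Val-and false b p q = inj₁ p

  Val-or : ∀ {φ ψ ρ} a b → Val φ ρ a → Val ψ ρ b → Val (for φ ψ) ρ (a ∨ b)
  Val-or true b p q = inj₁ p
  Val-or false true p q = inj₂ q
  Val-or false false p q = p , q

  -- Strong Kleene logic makes the case distinction safe: the branch not taken may be undefined, but
  -- it stands in conjunction with a false test.
  Val-if : ∀ {χ φ ψ ρ} b → (IsTrue S χ ρ × Val φ ρ b) ⊎ (IsFalse S χ ρ × Val ψ ρ b) →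
      Val (for (fand χ φ) (fand (fnot χ) ψ)) ρ b
  Val-if true (inj₁ h) = inj₁ h
  Val-if true (inj₂ h) = inj₂ h
  Val-if false (inj₁ (c , h)) = inj₂ h , inj₁ c
  Val-if false (inj₂ (c , h)) = inj₁ c , inj₂ h

  -- Written with a continuation because the case distinction is a formula and has to stand outside
  -- the atom in which the expression occurs.
  goT : TExp S → Pos → (TExp S → Formula S) → Formula S
  goT e [] K = K e
  goT e ((f , i) ∷ p) K = for (fand (isT f e) (goT (tsel f i e) p K)) (fand (fnot (isT f e)) (goT e p K))

  goS : SExp S → Pos → (SExp S → Formula S) → Formula S
  goS e [] K = K e
  goS e ((f , i) ∷ p) K = for (fand (isS f e) (goS (ssel f i e) p K)) (fand (fnot (isS f e)) (goS e p K))

  mutual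
    resT : TE 0 → (TExp S → Formula S) → Formula S
    resT (leaf (to x p)) K = goT (tv x) p K
    resT (leaf (tcn c)) K = K (tc c)
    resT (node f es) K = resTs es (λ es' → K (tf f es'))

    resTs : ∀ {k} → Vec (TE 0) k → (Vec (TExp S) k → Formula S) → Formula S
    resTs [] K = K []
    resTs (e ∷ es) K = resT e (λ e' → resTs es (λ es' → K (e' ∷ es')))

  mutual
    resS : SE 0 → (SExp S → Formula S) → Formula S
    resS (leaf (so (inj₁ x) p)) K = goT (tv x) p (λ e → K (sshape e))
    resS (leaf (so (inj₂ x) p)) K = goS (sv x) p K
    resS (leaf scn) K = K sc
    resS (node f es) K = resSs es (λ es' → K (sf f es'))

    resSs : ∀ {k} → Vec (SE 0) k → (Vec (SExp S) k → Formula S) → Formula S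
    resSs [] K = K []
    resSs (e ∷ es) K = resS e (λ e' → resSs es (λ es' → K (e' ∷ es')))

  truth : Bool → Formula S
  truth true = eqS sc sc
  truth false = fnot (eqS sc sc)

  sameShapes : ∀ {k} → SExp S → Vec (TExp S) k → Formula S
  sameShapes s [] = truth true
  sameShapes s (e ∷ es) = fand (eqS (sshape e) s) (sameShapes s es)

  backA : Atom 0 0 → Formula S
  backA (same a b) = resS a λ a' → resS b λ b' → eqS a' b'
  backA (size ψ a j) = resS a λ a' → cardGe ψ [] a' j
  -- On terms of different shapes `cardGe` is undefined; the preceding conjunct is then false and
  -- makes the whole false, as the atom requires.
  backA (card ψ Es j) = resTs Es λ es →
      fand (sameShapes (sshape (Vec.head es)) es) (cardGe ψ es (sshape (Vec.head es)) j)

  back : BF (Atom 0 0) → Formula S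
  back (atm a) = backA a
  back (cst b) = truth b
  back (neg φ) = fnot (back φ)
  back (and φ ψ) = fand (back φ) (back ψ)
  back (or φ ψ) = for (back φ) (back ψ)

  goT-QF : ∀ e p {K} → (∀ e → QF S (K e)) → QF S (goT e p K)
  goT-QF e [] h = h e
  goT-QF e ((f , i) ∷ p) h = (tt , goT-QF (tsel f i e) p h) , (tt , goT-QF e p h)

  goS-QF : ∀ e p {K} → (∀ e → QF S (K e)) → QF S (goS e p K)
  goS-QF e [] h = h e
  goS-QF e ((f , i) ∷ p) h = (tt , goS-QF (ssel f i e) p h) , (tt , goS-QF e p h)

  mutual
    resT-QF : ∀ E {K} → (∀ e → QF S (K e)) → QF S (resT E K)
    resT-QF (leaf (to x p)) h = goT-QF (tv x) p h
    resT-QF (leaf (tcn c)) h = h (tc c)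
    resT-QF (node f es) h = resTs-QF es (λ es' → h (tf f es'))

    resTs-QF : ∀ {k} (Es : Vec (TE 0) k) {K} → (∀ es → QF S (K es)) → QF S (resTs Es K)
    resTs-QF [] h = h []
    resTs-QF (e ∷ es) h = resT-QF e (λ e' → resTs-QF es (λ es' → h (e' ∷ es')))

  mutual
    resS-QF : ∀ E {K} → (∀ e → QF S (K e)) → QF S (resS E K)
    resS-QF (leaf (so (inj₁ x) p)) h = goT-QF (tv x) p (λ e → h (sshape e))
    resS-QF (leaf (so (inj₂ x) p)) h = goS-QF (sv x) p h
    resS-QF (leaf scn) h = h sc
    resS-QF (node f es) h = resSs-QF es (λ es' → h (sf f es'))

    resSs-QF : ∀ {k} (Es : Vec (SE 0) k) {K} → (∀ es → QF S (K es)) → QF S (resSs Es K)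
    resSs-QF [] h = h []
    resSs-QF (e ∷ es) h = resS-QF e (λ e' → resSs-QF es (λ es' → h (e' ∷ es')))

  truth-QF : ∀ b → QF S (truth b)
  truth-QF true = tt
  truth-QF false = tt

  sameShapes-QF : ∀ {k} s (es : Vec (TExp S) k) → QF S (sameShapes s es)
  sameShapes-QF s [] = tt
  sameShapes-QF s (e ∷ es) = tt , sameShapes-QF s es

  back-QF : ∀ P → QF S (back P)
  back-QF (atm (same a b)) = resS-QF a λ a' → resS-QF b λ b' → tt
  back-QF (atm (size ψ a j)) = resS-QF a λ a' → tt
  back-QF (atm (card ψ Es j)) = resTs-QF Es λ es → sameShapes-QF _ es , tt
  back-QF (cst b) = truth-QF b
  back-QF (neg φ) = back-QF φ
  back-QF (and φ ψ) = back-QF φ , back-QF ψ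
  back-QF (or φ ψ) = back-QF φ , back-QF ψ

  isApp? : ∀ f t → Dec (IsApp S f t)
  isApp? f (con c) = no λ { (_ , ()) }
  isApp? f (app g ts) with g Fin.≟ f
  ... | yes refl = yes (ts , refl)
  ... | no ne = no λ { (_ , refl) → ne refl }

  isAppS? : ∀ f s → Dec (IsAppS S f s)
  isAppS? f cS = no λ { (_ , ()) }
  isAppS? f (fS g ss) with g Fin.≟ f
  ... | yes refl = yes (ss , refl)
  ... | no ne = no λ { (_ , refl) → ne refl }

  selT-junk : ∀ f k t → ¬ IsApp S f t → selT f k t ≡ t
  selT-junk f k (con c) h = refl
  selT-junk f k (app g ts) h with g Fin.≟ f
  ... | yes refl = ⊥-elim (h (ts , refl))
  ... | no _ = refl

  selSh-junk : ∀ f k s → ¬ IsAppS S f s → selSh f k s ≡ s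
  selSh-junk f k cS h = refl
  selSh-junk f k (fS g ss) h with g Fin.≟ f
  ... | yes refl = ⊥-elim (h (ss , refl))
  ... | no _ = refl

  module _ (ρ : Env S) (b : Bool) where

    goT-Val : ∀ e p {K t} → evT S ρ e ≡ just t → (∀ e' → evT S ρ e' ≡ just (navT t p) → Val (K e') ρ b) →
        Val (goT e p K) ρ b
    goT-Val e [] ev h = h e ev
    goT-Val e ((f , i) ∷ p) {K} {t} ev h with isApp? f t
    ... | yes (ts , refl) = Val-if b (inj₁ ((_ , ev , ts , refl) , goT-Val (tsel f i e) p selected h))
      where
      selected : evT S ρ (tsel f i e) ≡ just (selT f i (app f ts))
      selected rewrite ev = trans (sel-app f i ts) (cong just (sym (selT-app f i ts)))
    ... | no ne = Val-if b (inj₂ ((_ , ev , ne) , goT-Val e p (trans ev (cong just (sym (selT-junk f i t ne)))) h))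

    goS-Val : ∀ e p {K t} → evS S ρ e ≡ just t → (∀ e' → evS S ρ e' ≡ just (navS t p) → Val (K e') ρ b) →
        Val (goS e p K) ρ b
    goS-Val e [] ev h = h e ev
    goS-Val e ((f , i) ∷ p) {K} {t} ev h with isAppS? f t
    ... | yes (ss , refl) = Val-if b (inj₁ ((_ , ev , ss , refl) , goS-Val (ssel f i e) p selected h))
      where
      selected : evS S ρ (ssel f i e) ≡ just (selSh f i (fS f ss))
      selected rewrite ev = trans (selS-fS f i ss) (cong just (sym (selSh-fS f i ss)))
    ... | no ne = Val-if b (inj₂ ((_ , ev , ne) , goS-Val e p (trans ev (cong just (sym (selSh-junk f i t ne)))) h))

    mutual
      resT-Val : ∀ E {K} → (∀ e → evT S ρ e ≡ just (valT ρ [] E) → Val (K e) ρ b) → Val (resT E K) ρ b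
      resT-Val (leaf (to x p)) h = goT-Val (tv x) p refl h
      resT-Val (leaf (tcn c)) h = h (tc c) refl
      resT-Val (node f es) h = resTs-Val es λ es' e → h (tf f es') (built es' e)
        where
        built : ∀ es' {ts} → evTs S ρ es' ≡ just ts → evT S ρ (tf f es') ≡ just (app f ts)
        built es' e rewrite e = refl

      resTs-Val : ∀ {k} (Es : Vec (TE 0) k) {K} →
          (∀ es → evTs S ρ es ≡ just (evalV app (leafT ρ) (lookup []) Es) → Val (K es) ρ b) → Val (resTs Es K) ρ b
      resTs-Val [] h = h [] refl
      resTs-Val (E ∷ Es) h = resT-Val E λ e p → resTs-Val Es λ es ps → h (e ∷ es) (built e es p ps)
        where
        built : ∀ e {k} (es : Vec (TExp S) k) {t ts} → evT S ρ e ≡ just t → evTs S ρ es ≡ just ts → evTs S ρ (e ∷ es)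
            ≡ just (t ∷ ts)
        built e es p ps rewrite p | ps = refl

    mutual
      resS-Val : ∀ E {K} → (∀ e → evS S ρ e ≡ just (valS ρ [] E) → Val (K e) ρ b) → Val (resS E K) ρ b
      resS-Val (leaf (so (inj₁ x) p)) h = goT-Val (tv x) p refl λ e q → h (sshape e) (shaped e q)
        where
        shaped : ∀ e → evT S ρ e ≡ just (navT (tenv ρ x) p) → evS S ρ (sshape e) ≡ just (navS (shape S (tenv ρ x)) p)
        shaped e q rewrite q = cong just (shape-navT (tenv ρ x) p)
      resS-Val (leaf (so (inj₂ x) p)) h = goS-Val (sv x) p refl h
      resS-Val (leaf scn) h = h sc refl
      resS-Val (node f es) h = resSs-Val es λ es' e → h (sf f es') (built es' e)
        where
        built : ∀ es' {ss} → evSs S ρ es' ≡ just ss → evS S ρ (sf f es') ≡ just (fS f ss)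
        built es' e rewrite e = refl

      resSs-Val : ∀ {k} (Es : Vec (SE 0) k) {K} →
          (∀ es → evSs S ρ es ≡ just (evalV fS (leafS ρ) (lookup []) Es) → Val (K es) ρ b) → Val (resSs Es K) ρ b
      resSs-Val [] h = h [] refl
      resSs-Val (E ∷ Es) h = resS-Val E λ e p → resSs-Val Es λ es ps → h (e ∷ es) (built e es p ps)
        where
        built : ∀ e {k} (es : Vec (SExp S) k) {t ts} → evS S ρ e ≡ just t → evSs S ρ es ≡ just ts → evSs S ρ (e ∷ es)
            ≡ just (t ∷ ts)
        built e es p ps rewrite p | ps = refl

  eqS-Val : ∀ ρ a b {s u} → evS S ρ a ≡ just s → evS S ρ b ≡ just u → Val (eqS a b) ρ (does (s ≟S u))
  eqS-Val ρ a b {s} {u} p q with s ≟S u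
  ... | yes e = s , u , p , q , e
  ... | no ne = s , u , p , q , ne

  truth-Val : ∀ ρ b → Val (truth b) ρ b
  truth-Val ρ true = cS , cS , refl , refl , refl
  truth-Val ρ false = cS , cS , refl , refl , refl

  sameShapes-Val : ∀ ρ {k} s (es : Vec (TExp S) k) {u ts} → evS S ρ s ≡ just u → evTs S ρ es ≡ just ts →
    Val (sameShapes s es) ρ (does (VAll.all? (λ t → shape S t ≟S u) ts))
  sameShapes-Val ρ s [] {ts = []} p q = truth-Val ρ true
  sameShapes-Val ρ s (e ∷ es) p q with evT S ρ e in eqe | evTs S ρ es in eqes
  sameShapes-Val ρ s (e ∷ es) {u} p refl | just t | just ts =
      Val-and (does (shape S t ≟S u)) (does (VAll.all? (λ t → shape S t ≟S u) ts))
    (eqS-Val ρ (sshape e) s shaped p) (sameShapes-Val ρ s es p eqes)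
    where
    shaped : evS S ρ (sshape e) ≡ just (shape S t)
    shaped rewrite eqe = refl

  card-Val : ∀ ρ {k} (ψ : LF k) es se j {ts s} → evTs S ρ es ≡ just ts → evS S ρ se ≡ just s →
      All (λ t → shape S t ≡ s) ts →
    Val (cardGe ψ es se j) ρ (j ≤ᵇ cnt ψ ts s)
  card-Val ρ ψ es se j {ts} {s} p q ps with j ≤ᵇ cnt ψ ts s in eq
  ... | true = ts , s , p , q , ps , subst (j ≤_) (sym (count≡cnt ψ ts s ps)) (≤ᵇ⁻ eq)
  ... | false = ts , s , p , q , ps , λ le → false⇒¬Tr eq (≤ᵇ⁺ (subst (j ≤_) (count≡cnt ψ ts s ps) le))

  head-ev : ∀ ρ {k} (es : Vec (TExp S) (suc k)) {ts} → evTs S ρ es ≡ just ts → evS S ρ (sshape (Vec.head es))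
      ≡ just (shape S (Vec.head ts))
  head-ev ρ (e ∷ es) q with evT S ρ e | evTs S ρ es
  head-ev ρ (e ∷ es) refl | just t | just ts = refl

  guarded-Val : ∀ ρ {k} (ψ : LF (suc k)) es j {ts} → evTs S ρ es ≡ just ts →
    Val (fand (sameShapes (sshape (Vec.head es)) es) (cardGe ψ es (sshape (Vec.head es)) j)) ρ (does (card? ψ ts j))
  guarded-Val ρ ψ es j {ts} q with VAll.all? (λ t → shape S t ≟S shape S (Vec.head ts)) ts | sameShapes-Val ρ
      (sshape (Vec.head es)) es (head-ev ρ es q) q
  ... | yes ps | h = Val-and true (j ≤ᵇ cnt ψ ts (shape S (Vec.head ts))) h
      (card-Val ρ ψ es (sshape (Vec.head es)) j q (head-ev ρ es q) ps)
  ... | no _ | h = inj₁ h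

  back-Val : ∀ ρ P → Val (back P) ρ (sem ρ P)
  back-Val ρ (atm a@(same s u)) = resS-Val ρ (sem ρ (atm a)) s λ s' p → resS-Val ρ (sem ρ (atm a)) u λ u' q →
      eqS-Val ρ s' u' p q
  back-Val ρ (atm a@(size ψ s j)) = resS-Val ρ (sem ρ (atm a)) s λ s' p → card-Val ρ ψ [] s' j refl p []
  back-Val ρ (atm a@(card ψ Es j)) = resTs-Val ρ (sem ρ (atm a)) Es λ es q →
      guarded-Val ρ ψ es j (trans q (cong just (evalV-map _ _ _ Es)))
  back-Val ρ (cst b) = truth-Val ρ b
  back-Val ρ (neg φ) = Val-not (sem ρ φ) (back-Val ρ φ)
  back-Val ρ (and φ ψ) = Val-and (sem ρ φ) (sem ρ ψ) (back-Val ρ φ) (back-Val ρ ψ)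
  back-Val ρ (or φ ψ) = Val-or (sem ρ φ) (sem ρ ψ) (back-Val ρ φ) (back-Val ρ ψ)

  -- Correctness of the elimination

  consistent : ∀ φ ρ → IsTrue S φ ρ → ¬ IsFalse S φ ρ
  consistent (eqT a b) ρ (_ , _ , p , q , e) (_ , _ , p' , q' , ne) =
      ne (trans (just-injective (trans (sym p') p)) (trans e (just-injective (trans (sym q) q'))))
  consistent (eqS a b) ρ (_ , _ , p , q , e) (_ , _ , p' , q' , ne) =
      ne (trans (just-injective (trans (sym p') p)) (trans e (just-injective (trans (sym q) q'))))
  consistent (isT f a) ρ (_ , p , e) (_ , p' , ne) = ne (subst (IsApp S f) (just-injective (trans (sym p) p')) e)
  consistent (isS f a) ρ (_ , p , e) (_ , p' , ne) = ne (subst (IsAppS S f) (just-injective (trans (sym p) p')) e)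
  consistent (cardEq ψ es se j) ρ (_ , _ , p , q , _ , e) (_ , _ , p' , q' , _ , ne) =
    ne (subst₂ (λ ts s → count S ψ ts s ≡ j) (just-injective (trans (sym p) p')) (just-injective (trans (sym q) q'))
        e)
  consistent (cardGe ψ es se j) ρ (_ , _ , p , q , _ , e) (_ , _ , p' , q' , _ , ne) =
    ne (subst₂ (λ ts s → j ≤ count S ψ ts s) (just-injective (trans (sym p) p')) (just-injective (trans (sym q) q'))
        e)
  consistent (fnot φ) ρ h h' = consistent φ ρ h' h
  consistent (fand φ ψ) ρ (p , q) (inj₁ h) = consistent φ ρ p h
  consistent (fand φ ψ) ρ (p , q) (inj₂ h) = consistent ψ ρ q h
  consistent (for φ ψ) ρ (inj₁ p) (h , h') = consistent φ ρ p h
  consistent (for φ ψ) ρ (inj₂ q) (h , h') = consistent ψ ρ q h'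
  consistent (allT x φ) ρ h (t , h') = consistent φ _ (h t) h'
  consistent (exT x φ) ρ (t , h) h' = consistent φ _ h (h' t)
  consistent (allS x φ) ρ h (s , h') = consistent φ _ (h s) h'
  consistent (exS x φ) ρ (s , h) h' = consistent φ _ h (h' s)

  eliminate : Formula S → Formula S
  eliminate φ = back (T φ)

  -- `back` yields a formula that is true or false everywhere, according to whether the given
  -- formula is true. Equivalence could fail only where the latter is undefined, which
  -- well-definedness excludes.
  eliminate-equivalent : ∀ φ → WellDefined S φ → Equivalent S φ (eliminate φ)
  eliminate-equivalent φ wd ρ = go (sem ρ (T φ)) refl (back-Val ρ (T φ))
    where
    go : ∀ b → sem ρ (T φ) ≡ b → Val (eliminate φ) ρ b →
      (IsTrue S φ ρ ⇔ IsTrue S (eliminate φ) ρ) × (IsFalse S φ ρ ⇔ IsFalse S (eliminate φ) ρ)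
    go true e v = mk⇔ (λ _ → v) (λ _ → t) ,
        mk⇔ (λ h → ⊥-elim (consistent φ ρ t h)) (λ h → ⊥-elim (consistent (eliminate φ) ρ v h))
      where t = T⁻ φ ρ e
    go false e v = mk⇔ (λ h → ⊥-elim (¬t h)) (λ h → ⊥-elim (consistent (eliminate φ) ρ h v)) , mk⇔ (λ _ → v) (λ _ → f)
      where
      ¬t : ¬ IsTrue S φ ρ
      ¬t h = false⇒¬Tr e (T⁺ φ ρ h)
      f : IsFalse S φ ρ
      -- `WellDefined` excludes undefinedness only up to double negation, which is removed because
      -- falsity is decided by the Boolean value of `F φ`.
      f = F⁻ φ ρ (decidable-stable (sem ρ (F φ) Bool.≟ true) λ ne → wd ρ (¬t , λ h → ne (F⁺ φ ρ h)))

mainTheorem3 : (S : Setting) →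
    Σ (Formula S → Formula S) λ qe →
    (φ : Formula S) → QF S (qe φ) × (WellDefined S φ → Equivalent S φ (qe φ))
mainTheorem3 S = QE.eliminate S , λ φ → QE.back-QF S (QE.T S φ) , QE.eliminate-equivalent S φ
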